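{- Let $n$ be a positive odd integer and $a$ an indeterminate. Then, modulo $\Phi_{n}(q)(1-aq^{n})(a-q^{n})$, \[ \sum_{k=0}^{(n-1)/2}[6k+1]\frac{(q;q^{4})_{k}(q;q^{2})_{k}(aq,q/a;q^{2})_{k}}{(q^{2};q^{2})_{k}(q^{4};q^{4})_{k}(aq^{4},q^{4}/a;q^{4})_{k}}q^{k^{2}+k} \equiv \begin{cases} \dfrac{(q^{2};q^{4})_{(n-1)/4}}{(q^{4};q^{4})_{(n-1)/4}}[n]\,q^{(1-n)/4}, & \text{if } n\equiv 1 \pmod 4,\\[6pt] 0, & \text{if } n\equiv 3 \pmod 4. \end{cases} \]
   Context: For an indeterminate $q$, $(x;q)_k=(1-x)(1-xq)\cdots(1-xq^{k-1})$ (with $(x;q)_0=1$), and $(x_1,\dots,x_m;q)_k=(x_1;q)_k\cdots(x_m;q)_k$. $[m]=(1-q^m)/(1-q)$ is the $q$-integer and $\Phi_n(q)$ is the $n$-th cyclotomic polynomial. A congruence between rational functions in $q$ and $a$ modulo a polynomial $P(q,a)$ means that the difference is $P(q,a)$ times a rational function in $q,a$ whose denominator is coprime to $P(q,a)$. -}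

module Defs where

open import Data.Nat as ℕ using (ℕ; zero; suc; _≡ᵇ_; _∸_; _%_; _/_)
open import Data.Nat.Divisibility using (_∣?_)
open import Data.Integer as ℤ using (ℤ; 0ℤ; 1ℤ)
open import Data.Bool using (if_then_else_; _∧_)
open import Data.List using (List; []; _∷_; _++_; map; concatMap; foldr; upTo; filter)
open import Data.Product using (Σ; _×_; _,_)
open import Relation.Binary.PropositionalEquality using (_≡_)
open import Relation.Nullary using (¬_)

-- Polynomials in ℤ[q, a], as finite formal sums of monomials c·q^i·a^j.
-- Equality is equality of all coefficients.

Mono : Set
Mono = ℤ × ℕ × ℕ          -- (c , i , j) stands for c · q^i · a^j

Poly : Set
Poly = List Mono

coeff : Poly → ℕ → ℕ → ℤ
coeff [] i j = 0ℤ
coeff ((c , i' , j') ∷ p) i j =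
  if (i' ≡ᵇ i) ∧ (j' ≡ᵇ j) then c ℤ.+ coeff p i j else coeff p i j

infix 4 _≈ₚ_
_≈ₚ_ : Poly → Poly → Set
p ≈ₚ r = ∀ i j → coeff p i j ≡ coeff r i j

0ₚ 1ₚ qₚ aₚ : Poly
0ₚ = []
1ₚ = (1ℤ , 0 , 0) ∷ []
qₚ = (1ℤ , 1 , 0) ∷ []
aₚ = (1ℤ , 0 , 1) ∷ []

mono : ℕ → ℕ → Poly
mono i j = (1ℤ , i , j) ∷ []

infixl 6 _+ₚ_ _-ₚ_
infixl 7 _*ₚ_
_+ₚ_ : Poly → Poly → Poly
_+ₚ_ = _++_

-ₚ_ : Poly → Poly
-ₚ_ = map (λ { (c , i , j) → (ℤ.- c , i , j) })

_-ₚ_ : Poly → Poly → Poly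
p -ₚ r = p +ₚ (-ₚ r)

_*ₚ_ : Poly → Poly → Poly
p *ₚ r = concatMap (λ { (c , i , j) → map (λ { (d , k , l) → (c ℤ.* d , i ℕ.+ k , j ℕ.+ l) }) r }) p

_∣ₚ_ : Poly → Poly → Set
f ∣ₚ g = Σ Poly λ h → f *ₚ h ≈ₚ g

NonZeroₚ : Poly → Set
NonZeroₚ p = ¬ (p ≈ₚ 0ₚ)

IsConst : Poly → Set
IsConst p = ∀ i j → ¬ (i ≡ 0 × j ≡ 0) → coeff p i j ≡ 0ℤ

Coprimeₚ : Poly → Poly → Set
Coprimeₚ f g = ∀ h → h ∣ₚ f → h ∣ₚ g → IsConst h

record Frac : Set where
  constructor frac
  field
    num : Poly
    den : Poly

infix 4 _≈F_
_≈F_ : Frac → Frac → Set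
frac n d ≈F frac n' d' = n *ₚ d' ≈ₚ n' *ₚ d

poly→frac : Poly → Frac
poly→frac p = frac p 1ₚ

0F 1F qF aF : Frac
0F = poly→frac 0ₚ
1F = poly→frac 1ₚ
qF = poly→frac qₚ
aF = poly→frac aₚ

infixl 6 _+F_ _-F_
infixl 7 _*F_ _÷F_
_+F_ : Frac → Frac → Frac
frac n d +F frac n' d' = frac (n *ₚ d' +ₚ n' *ₚ d) (d *ₚ d')

_-F_ : Frac → Frac → Frac
frac n d -F frac n' d' = frac (n *ₚ d' -ₚ n' *ₚ d) (d *ₚ d')

_*F_ : Frac → Frac → Frac
frac n d *F frac n' d' = frac (n *ₚ n') (d *ₚ d')

invF : Frac → Frac
invF (frac n d) = frac d n

_÷F_ : Frac → Frac → Frac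
x ÷F y = x *F invF y

powF : Frac → ℕ → Frac
powF x zero = 1F
powF x (suc k) = powF x k *F x

prodF : ℕ → (ℕ → Frac) → Frac
prodF zero f = 1F
prodF (suc k) f = prodF k f *F f k

sumF : ℕ → (ℕ → Frac) → Frac
sumF zero f = 0F
sumF (suc k) f = sumF k f +F f k

poch : Frac → Frac → ℕ → Frac
poch x b k = prodF k (λ j → 1F -F x *F powF b j)

qint : ℕ → Frac
qint m = (1F -F powF qF m) ÷F (1F -F qF)

-- Cyclotomic polynomial Φ_n(q) as a rational function, via
-- q^n - 1 = ∏_{d ∣ n} Φ_d(q), i.e. Φ_n = (q^n - 1) / ∏_{d ∣ n, d < n} Φ_d.

properDivisors : ℕ → List ℕ
properDivisors n = filter (_∣? n) (map suc (upTo (n ∸ 1)))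

prodList : List Frac → Frac
prodList = foldr _*F_ 1F

cycAux : ℕ → ℕ → Frac            -- first argument is fuel (n suffices)
cycAux zero n = 1F
cycAux (suc fuel) n =
  (powF qF n -F 1F) ÷F prodList (map (cycAux fuel) (properDivisors n))

cyclotomicF : ℕ → Frac
cyclotomicF n = cycAux n n

IsCyclotomic : ℕ → Poly → Set
IsCyclotomic n Φ = poly→frac Φ ≈F cyclotomicF n

CongMod : Poly → Frac → Frac → Set
CongMod P F G =
  Σ Poly λ u → Σ Poly λ v →
    NonZeroₚ v × Coprimeₚ v P × (F -F G ≈F frac (P *ₚ u) v)

modulus : Poly → ℕ → Poly
modulus Φ n = Φ *ₚ (1ₚ -ₚ mono n 1) *ₚ (aₚ -ₚ mono n 0)

summand : ℕ → Frac
summand k =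
  qint (6 ℕ.* k ℕ.+ 1)
  *F ((poch qF (powF qF 4) k *F poch qF (powF qF 2) k
        *F poch (aF *F qF) (powF qF 2) k *F poch (qF ÷F aF) (powF qF 2) k)
      ÷F (poch (powF qF 2) (powF qF 2) k *F poch (powF qF 4) (powF qF 4) k
        *F poch (aF *F powF qF 4) (powF qF 4) k *F poch (powF qF 4 ÷F aF) (powF qF 4) k))
  *F powF qF (k ℕ.* k ℕ.+ k)

lhs : ℕ → Frac
lhs n = sumF (suc ((n ∸ 1) / 2)) summand

rhs1 : ℕ → Frac
rhs1 n = (poch (powF qF 2) (powF qF 4) m ÷F poch (powF qF 4) (powF qF 4) m)
         *F qint n *F invF (powF qF m)
  where m = (n ∸ 1) / 4

{-# OPTIONS --safe #-}
-- For α in place of a, the sum over k ≤ M is S_M(α) / D_M(α) with explicit polynomials S_M, D_M, and a q-WZ pair gives a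
-- first-order recurrence under α ↦ α q⁴ whose inhomogeneous term vanishes when α = q^{2j+1} with j small. Hence S_M / D_M
-- is known exactly at α = q^e for odd e ≤ n: it is zero for e ≡ 3 (mod 4) and a product for e ≡ 1 (mod 4).
-- At α = q^n this is the claimed value; since α ↦ 1/α only multiplies S_M and D_M by a power of α, the difference of the two
-- sides is divisible by (a - q^n)(1 - a q^n).
-- Modulo Φ_n, with M = (n-1)/2: the polynomial S_M(a) has degree at most n - 1 in a, and it vanishes at a = q^e for all
-- e = 0, …, n - 1. For odd e this holds because D_M(q^e) contains a factor divisible by 1 - q^n, and for even e by reversal
-- α ↦ 1/α. The differences q^i - q^j are invertible modulo Φ_n over ℚ, so Φ_n divides S_M(a).

module Submission where

open import Defs
open import Data.Nat using (ℕ; _%_)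
open import Data.Product using (_×_)
open import Relation.Binary.PropositionalEquality using (_≡_)
open import Algebra.Bundles using (CommutativeRing)
import Algebra.Solver.Ring
open import Algebra.Solver.Ring.AlmostCommutativeRing using (fromCommutativeRing; _-Raw-AlmostCommutative⟶_)
open import Data.Bool using (true; false; T; if_then_else_; _∧_)
open import Data.Empty using (⊥-elim)
open import Data.Integer as ℤ using (ℤ; 0ℤ; 1ℤ)
import Data.Integer.Properties as ℤₚ
import Data.Integer.Tactic.RingSolver as ℤSolver
open import Data.List using (List; []; _∷_; _++_; map; filter; foldr; upTo)
import Data.List.Properties as Listₚ
open import Data.List.Relation.Unary.All as All using (All; []; _∷_)
import Data.List.Relation.Unary.All.Properties as Allₚ
open import Data.Maybe using (Maybe; just; nothing)
open import Data.Nat as ℕ using (zero; suc; _≡ᵇ_; _≤_; _<_; _∸_; z≤n; s≤s)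
import Data.Nat.Divisibility as ND
open ND using () renaming (_∣_ to _∣ℕ_; _∣?_ to _∣ℕ?_)
import Data.Nat.DivMod as DM
open import Data.Nat.GCD using (gcd; gcd-GCD; gcd[m,n]∣m; gcd[m,n]∣n; module Bézout)
import Data.Nat.Properties as ℕₚ
import Data.Nat.Tactic.RingSolver as NatSolver
open import Data.Product using (Σ; _,_; proj₁; proj₂)
open import Data.Sum using (_⊎_; inj₁; inj₂)
open import Function using (_∘_)
open import Data.Unit using (tt)
open import Level using (0ℓ)
open import Relation.Binary.Definitions using (tri<; tri≈; tri>)
open import Relation.Binary.PropositionalEquality as ≡ using (_≢_; cong; cong₂; subst)
open import Relation.Nullary using (¬_; Dec; yes; no)
open import Relation.Nullary.Decidable using (decidable-stable)

-- Linear functionals and leading terms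

-- The linear functional on polynomials with value w i j on q^i a^j; all
-- coefficients are of this form, and multiplication becomes iteration.

-- `Coprimeₚ` accepts every constant as a common divisor, yet all cofactors must lie in ℤ[q, a].
-- Bézout identities are therefore only available up to a nonzero integer, and that integer has to
-- be removed again; for divisors of q^n - 1 this is possible because q^n - 1 has constant term -1.
-- The three factors of the modulus are put together by cancelling non-zero-divisors, and Φ_n enters
-- only through Φ_n ∣ q^n - 1 and its comaximality over ℚ with q^j - 1 for n ∤ j. The obstacle
-- modulo Φ_n is that D_M(q^e) is itself divisible by Φ_n for most of the e in question, so S_M /
-- D_M cannot be evaluated there. Hence all exact values are cross-multiplied, the vanishing is
-- proved for the polynomial S_M alone, and the coprimality of the final denominator with Φ_n is
-- tested at a = 0, where every factor of D_M stays comaximal with Φ_n.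

infix 8 ⟪_⟫_
⟪_⟫_ : Poly → (ℕ → ℕ → ℤ) → ℤ
⟪ [] ⟫ w = 0ℤ
⟪ (c , i , j) ∷ p ⟫ w = c ℤ.* w i j ℤ.+ ⟪ p ⟫ w

δ : ℕ → ℕ → ℕ → ℕ → ℤ
δ i j k l = if (k ≡ᵇ i) ∧ (l ≡ᵇ j) then 1ℤ else 0ℤ

coeff≡⟪⟫ : ∀ p i j → coeff p i j ≡ ⟪ p ⟫ δ i j
coeff≡⟪⟫ [] i j = ≡.refl
coeff≡⟪⟫ ((c , k , l) ∷ p) i j with (k ≡ᵇ i) ∧ (l ≡ᵇ j)
... | true = cong₂ ℤ._+_ (≡.sym (ℤₚ.*-identityʳ c)) (coeff≡⟪⟫ p i j)
... | false = ≡.trans (coeff≡⟪⟫ p i j) (≡.trans (≡.sym (ℤₚ.+-identityˡ _)) (cong (ℤ._+ ⟪ p ⟫ δ i j) (≡.sym (ℤₚ.*-zeroʳ c))))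

⟪⟫-ext : ∀ p {w w'} → (∀ i j → w i j ≡ w' i j) → ⟪ p ⟫ w ≡ ⟪ p ⟫ w'
⟪⟫-ext [] e = ≡.refl
⟪⟫-ext ((c , i , j) ∷ p) e = cong₂ (λ x y → c ℤ.* x ℤ.+ y) (e i j) (⟪⟫-ext p e)

⟪⟫-++ : ∀ p r w → ⟪ p ++ r ⟫ w ≡ ⟪ p ⟫ w ℤ.+ ⟪ r ⟫ w
⟪⟫-++ [] r w = ≡.sym (ℤₚ.+-identityˡ _)
⟪⟫-++ ((c , i , j) ∷ p) r w = ≡.trans (cong (ℤ._+_ (c ℤ.* w i j)) (⟪⟫-++ p r w)) (≡.sym (ℤₚ.+-assoc (c ℤ.* w i j) _ _))

⟪⟫-neg : ∀ p w → ⟪ -ₚ p ⟫ w ≡ ℤ.- ⟪ p ⟫ w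
⟪⟫-neg [] w = ≡.refl
⟪⟫-neg ((c , i , j) ∷ p) w = ≡.trans (cong (ℤ._+_ (ℤ.- c ℤ.* w i j)) (⟪⟫-neg p w)) (lem c (w i j) (⟪ p ⟫ w))
  where
  lem : ∀ c x y → ℤ.- c ℤ.* x ℤ.+ ℤ.- y ≡ ℤ.- (c ℤ.* x ℤ.+ y)
  lem = ℤSolver.solve-∀

⟪⟫-+ : ∀ p w w' → ⟪ p ⟫ (λ i j → w i j ℤ.+ w' i j) ≡ ⟪ p ⟫ w ℤ.+ ⟪ p ⟫ w'
⟪⟫-+ [] w w' = ≡.refl
⟪⟫-+ ((c , i , j) ∷ p) w w' = ≡.trans (cong (ℤ._+_ (c ℤ.* (w i j ℤ.+ w' i j))) (⟪⟫-+ p w w')) (lem c _ _ _ _)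
  where
  lem : ∀ c x y u v → c ℤ.* (x ℤ.+ y) ℤ.+ (u ℤ.+ v) ≡ (c ℤ.* x ℤ.+ u) ℤ.+ (c ℤ.* y ℤ.+ v)
  lem = ℤSolver.solve-∀

⟪⟫-scale : ∀ p c w → ⟪ p ⟫ (λ i j → c ℤ.* w i j) ≡ c ℤ.* ⟪ p ⟫ w
⟪⟫-scale [] c w = ≡.sym (ℤₚ.*-zeroʳ c)
⟪⟫-scale ((d , i , j) ∷ p) c w = ≡.trans (cong (ℤ._+_ (d ℤ.* (c ℤ.* w i j))) (⟪⟫-scale p c w)) (lem c d _ _)
  where
  lem : ∀ c d x y → d ℤ.* (c ℤ.* x) ℤ.+ c ℤ.* y ≡ c ℤ.* (d ℤ.* x ℤ.+ y)
  lem = ℤSolver.solve-∀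

⟪⟫-vanish : ∀ {p w} → All (λ m → w (proj₁ (proj₂ m)) (proj₂ (proj₂ m)) ≡ 0ℤ) p → ⟪ p ⟫ w ≡ 0ℤ
⟪⟫-vanish [] = ≡.refl
⟪⟫-vanish {(c , _) ∷ p} (e ∷ es) = cong₂ ℤ._+_ (≡.trans (cong (c ℤ.*_) e) (ℤₚ.*-zeroʳ c)) (⟪⟫-vanish es)

⟪⟫-0 : ∀ p → ⟪ p ⟫ (λ _ _ → 0ℤ) ≡ 0ℤ
⟪⟫-0 p = ⟪⟫-vanish (All.universal (λ _ → ≡.refl) p)

⟪⟫-swap : ∀ p r (w : ℕ → ℕ → ℕ → ℕ → ℤ) →
  ⟪ p ⟫ (λ i j → ⟪ r ⟫ w i j) ≡ ⟪ r ⟫ (λ k l → ⟪ p ⟫ (λ i j → w i j k l))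
⟪⟫-swap [] r w = ≡.sym (⟪⟫-0 r)
⟪⟫-swap ((c , i , j) ∷ p) r w =
  ≡.trans (cong₂ ℤ._+_ (≡.sym (⟪⟫-scale r c (w i j))) (⟪⟫-swap p r w)) (≡.sym (⟪⟫-+ r _ _))

shift : Mono → Poly → Poly
shift (c , i , j) = map (λ m → c ℤ.* proj₁ m , i ℕ.+ proj₁ (proj₂ m) , j ℕ.+ proj₂ (proj₂ m))

⟪⟫-shift : ∀ c i j r w → ⟪ shift (c , i , j) r ⟫ w ≡ c ℤ.* ⟪ r ⟫ (λ k l → w (i ℕ.+ k) (j ℕ.+ l))
⟪⟫-shift c i j [] w = ≡.sym (ℤₚ.*-zeroʳ c)
⟪⟫-shift c i j ((d , k , l) ∷ r) w = ≡.trans (cong (ℤ._+_ (c ℤ.* d ℤ.* w (i ℕ.+ k) (j ℕ.+ l))) (⟪⟫-shift c i j r w)) (lem c d _ _)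
  where
  lem : ∀ c d x y → c ℤ.* d ℤ.* x ℤ.+ c ℤ.* y ≡ c ℤ.* (d ℤ.* x ℤ.+ y)
  lem = ℤSolver.solve-∀

⟪⟫-* : ∀ p r w → ⟪ p *ₚ r ⟫ w ≡ ⟪ p ⟫ (λ i j → ⟪ r ⟫ (λ k l → w (i ℕ.+ k) (j ℕ.+ l)))
⟪⟫-* [] r w = ≡.refl
⟪⟫-* ((c , i , j) ∷ p) r w = ≡.trans (⟪⟫-++ (shift (c , i , j) r) (p *ₚ r) w) (cong₂ ℤ._+_ (⟪⟫-shift c i j r w) (⟪⟫-* p r w))

-- The order compares exponents of a first, so that the leading term determines the degree in a.

infix 4 _≺_
_≺_ : ℕ × ℕ → ℕ × ℕ → Set
(i , j) ≺ (k , l) = j < l ⊎ (j ≡ l × i < k)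

≺-trans : ∀ {x y z} → x ≺ y → y ≺ z → x ≺ z
≺-trans (inj₁ a) (inj₁ b) = inj₁ (ℕₚ.<-trans a b)
≺-trans (inj₁ a) (inj₂ (≡.refl , _)) = inj₁ a
≺-trans (inj₂ (≡.refl , _)) (inj₁ b) = inj₁ b
≺-trans (inj₂ (≡.refl , a)) (inj₂ (≡.refl , b)) = inj₂ (≡.refl , ℕₚ.<-trans a b)

≺-irrefl : ∀ {x} → ¬ x ≺ x
≺-irrefl (inj₁ a) = ℕₚ.<-irrefl ≡.refl a
≺-irrefl (inj₂ (_ , a)) = ℕₚ.<-irrefl ≡.refl a

≺-+ : ∀ {i j k l i' j' k' l'} → (i , j) ≺ (k , l) → (i' , j') ≡ (k' , l') ⊎ (i' , j') ≺ (k' , l') →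
  (i ℕ.+ i' , j ℕ.+ j') ≺ (k ℕ.+ k' , l ℕ.+ l')
≺-+ {i' = i'} {j'} (inj₁ a) (inj₁ ≡.refl) = inj₁ (ℕₚ.+-monoˡ-< j' a)
≺-+ {i' = i'} {j'} (inj₂ (≡.refl , a)) (inj₁ ≡.refl) = inj₂ (≡.refl , ℕₚ.+-monoˡ-< i' a)
≺-+ (inj₁ a) (inj₂ (inj₁ b)) = inj₁ (ℕₚ.+-mono-< a b)
≺-+ (inj₁ a) (inj₂ (inj₂ (≡.refl , b))) = inj₁ (ℕₚ.+-monoˡ-< _ a)
≺-+ {j = j} (inj₂ (≡.refl , a)) (inj₂ (inj₁ b)) = inj₁ (ℕₚ.+-monoʳ-< j b)
≺-+ (inj₂ (≡.refl , a)) (inj₂ (inj₂ (≡.refl , b))) = inj₂ (≡.refl , ℕₚ.+-mono-< a b)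

data Order (x y : ℕ × ℕ) : Set where
  less : x ≺ y → Order x y
  same : x ≡ y → Order x y
  more : y ≺ x → Order x y

order : ∀ x y → Order x y
order (i , j) (k , l) with ℕₚ.<-cmp j l
... | tri< a _ _ = less (inj₁ a)
... | tri> _ _ b = more (inj₁ b)
... | tri≈ _ ≡.refl _ with ℕₚ.<-cmp i k
...   | tri< a _ _ = less (inj₂ (≡.refl , a))
...   | tri> _ _ b = more (inj₂ (≡.refl , b))
...   | tri≈ _ ≡.refl _ = same ≡.refl

Below : ℕ × ℕ → Poly → Set
Below e = All (λ m → proj₂ m ≺ e)

data Sorted : Poly → Set where
  [] : Sorted []
  cons : ∀ {c e p} → c ≢ 0ℤ → Below e p → Sorted p → Sorted ((c , e) ∷ p)

Equiv : Poly → Poly → Set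
Equiv p r = ∀ w → ⟪ p ⟫ w ≡ ⟪ r ⟫ w

-- The last component says that a strict upper bound on the exponents survives insertion; the
-- recursive case needs it to put the old head back in front.
insert : ∀ c e p → c ≢ 0ℤ → Sorted p →
  Σ Poly λ r → Sorted r × Equiv r ((c , e) ∷ p) × (∀ {f} → e ≺ f → Below f p → Below f r)
insert c e [] c≢0 s = _ , cons c≢0 [] [] , (λ _ → ≡.refl) , (λ x _ → x ∷ [])
insert c e ((d , f) ∷ p) c≢0 s@(cons d≢0 b s') with order e f
... | more f≺e = _ , cons c≢0 (f≺e ∷ All.map (λ x → ≺-trans x f≺e) b) s , (λ _ → ≡.refl) , (λ x y → x ∷ y)
... | less e≺f with insert c e p c≢0 s'
...   | r , sr , eq , bel = (d , f) ∷ r , cons d≢0 (bel e≺f b) sr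
      , (λ w → ≡.trans (cong (ℤ._+_ (d ℤ.* _)) (eq w)) (lem (d ℤ.* _) (c ℤ.* _) _))
      , (λ { x (y ∷ ys) → y ∷ bel x ys })
  where
  lem : ∀ x y z → x ℤ.+ (y ℤ.+ z) ≡ y ℤ.+ (x ℤ.+ z)
  lem = ℤSolver.solve-∀
insert c e ((d , f) ∷ p) c≢0 s@(cons d≢0 b s') | same ≡.refl with (c ℤ.+ d) ℤ.≟ 0ℤ
... | no ne = (c ℤ.+ d , e) ∷ p , cons ne b s'
      , (λ w → lem c d _ _) , (λ { x (y ∷ ys) → y ∷ ys })
  where
  lem : ∀ c d x y → (c ℤ.+ d) ℤ.* x ℤ.+ y ≡ c ℤ.* x ℤ.+ (d ℤ.* x ℤ.+ y)
  lem = ℤSolver.solve-∀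
... | yes eq = p , s' , (λ w → ≡.sym (≡.trans (lem c d _ _) (≡.trans (cong (λ z → z ℤ.* _ ℤ.+ ⟪ p ⟫ w) eq) (ℤₚ.+-identityˡ _))))
      , (λ { x (y ∷ ys) → ys })
  where
  lem : ∀ c d x y → c ℤ.* x ℤ.+ (d ℤ.* x ℤ.+ y) ≡ (c ℤ.+ d) ℤ.* x ℤ.+ y
  lem = ℤSolver.solve-∀

sorted : ∀ p → Σ Poly λ r → Sorted r × Equiv r p
sorted [] = [] , [] , λ _ → ≡.refl
sorted ((c , e) ∷ p) with sorted p | c ℤ.≟ 0ℤ
... | r , s , eq | yes ≡.refl = r , s , λ w → ≡.trans (eq w) (≡.sym (ℤₚ.+-identityˡ _))
... | r , s , eq | no c≢0 with insert c e r c≢0 s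
...   | r' , s' , eq' , _ = r' , s' , λ w → ≡.trans (eq' w) (cong (ℤ._+_ (c ℤ.* _)) (eq w))

≡ᵇ-refl : ∀ m → (m ≡ᵇ m) ≡ true
≡ᵇ-refl zero = ≡.refl
≡ᵇ-refl (suc m) = ≡ᵇ-refl m

δ-same : ∀ i j → δ i j i j ≡ 1ℤ
δ-same i j rewrite ≡ᵇ-refl i | ≡ᵇ-refl j = ≡.refl

δ-diff : ∀ i j k l → (k , l) ≢ (i , j) → δ i j k l ≡ 0ℤ
δ-diff i j k l ne with k ≡ᵇ i in p | l ≡ᵇ j in r
... | false | _ = ≡.refl
... | true | false = ≡.refl
... | true | true = ⊥-elim (ne (cong₂ _,_ (ℕₚ.≡ᵇ⇒≡ k i (subst T (≡.sym p) tt)) (ℕₚ.≡ᵇ⇒≡ l j (subst T (≡.sym r) tt))))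

≺⇒≢ : ∀ {x y} → x ≺ y → x ≢ y
≺⇒≢ h ≡.refl = ≺-irrefl h

lead : ∀ {c i j p} → Below (i , j) p → ⟪ (c , i , j) ∷ p ⟫ δ i j ≡ c
lead {c} {i} {j} {p} b = ≡.trans (cong₂ (λ x y → c ℤ.* x ℤ.+ y) (δ-same i j)
    (⟪⟫-vanish (All.map (λ x → δ-diff i j _ _ (≺⇒≢ x)) b)))
  (≡.trans (ℤₚ.+-identityʳ _) (ℤₚ.*-identityʳ c))

-- A nonempty sorted representative would have its nonzero leading coefficient among the
-- coefficients of p. This carries coefficientwise equality over to all functionals, and with it
-- makes products respect equality.
≈0⇒⟪⟫≡0 : ∀ {p} → (∀ i j → coeff p i j ≡ 0ℤ) → ∀ w → ⟪ p ⟫ w ≡ 0ℤ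
≈0⇒⟪⟫≡0 {p} h w with sorted p
... | [] , _ , eq = ≡.sym (eq w)
... | (c , i , j) ∷ r , cons c≢0 b s , eq =
  ⊥-elim (c≢0 (≡.trans (≡.sym (lead b)) (≡.trans (eq _) (≡.trans (≡.sym (coeff≡⟪⟫ p i j)) (h i j)))))

≈⇒Equiv : ∀ p r → p ≈ₚ r → Equiv p r
≈⇒Equiv p r h w = ℤₚ.i-j≡0⇒i≡j _ _ (≡.trans (≡.sym (diff w)) (≈0⇒⟪⟫≡0 {p -ₚ r} (λ i j →
    ≡.trans (coeff≡⟪⟫ (p -ₚ r) i j) (≡.trans (diff (δ i j))
      (ℤₚ.i≡j⇒i-j≡0 (≡.trans (≡.sym (coeff≡⟪⟫ p i j)) (≡.trans (h i j) (coeff≡⟪⟫ r i j)))))) w))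
  where
  diff : ∀ w → ⟪ p -ₚ r ⟫ w ≡ ⟪ p ⟫ w ℤ.- ⟪ r ⟫ w
  diff w = ≡.trans (⟪⟫-++ p (-ₚ r) w) (cong (ℤ._+_ (⟪ p ⟫ w)) (⟪⟫-neg r w))

Equiv⇒≈ : ∀ p r → Equiv p r → p ≈ₚ r
Equiv⇒≈ p r h i j = ≡.trans (coeff≡⟪⟫ p i j) (≡.trans (h _) (≡.sym (coeff≡⟪⟫ r i j)))

-- The ring ℤ[q, a]

-- ≈ₚ wrapped in a record, so that its two sides can be inferred.

infix 4 _≋_
record _≋_ (p r : Poly) : Set where
  constructor mk
  field un : p ≈ₚ r
open _≋_

Equiv⇒≋ : ∀ {p r} → Equiv p r → p ≋ r
Equiv⇒≋ {p} {r} h = mk (Equiv⇒≈ p r h)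

≋⇒Equiv : ∀ {p r} → p ≋ r → Equiv p r
≋⇒Equiv {p} {r} (mk h) = ≈⇒Equiv p r h

infixl 6 _⊕_
infixl 7 _⊗_
-- Opaque, so that ring expressions are compared as expressions and not unfolded to lists of
-- monomials.
opaque
  κ : ℤ → Poly
  κ c = (c , 0 , 0) ∷ []

  _⊕_ _⊗_ : Poly → Poly → Poly
  _⊕_ = _+ₚ_
  _⊗_ = _*ₚ_

  ⊖_ : Poly → Poly
  ⊖_ = -ₚ_

  q a : Poly
  q = qₚ
  a = aₚ

opaque
  unfolding κ

  ⟪⊗⟫ : ∀ p r w → ⟪ p ⊗ r ⟫ w ≡ ⟪ p ⟫ (λ i j → ⟪ r ⟫ (λ k l → w (i ℕ.+ k) (j ℕ.+ l)))
  ⟪⊗⟫ = ⟪⟫-*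

  ⟪⊕⟫ : ∀ p r w → ⟪ p ⊕ r ⟫ w ≡ ⟪ p ⟫ w ℤ.+ ⟪ r ⟫ w
  ⟪⊕⟫ = ⟪⟫-++

  ⟪⊖⟫ : ∀ p w → ⟪ ⊖ p ⟫ w ≡ ℤ.- ⟪ p ⟫ w
  ⟪⊖⟫ = ⟪⟫-neg

  ⟪κ⟫ : ∀ c w → ⟪ κ c ⟫ w ≡ c ℤ.* w 0 0
  ⟪κ⟫ c w = ℤₚ.+-identityʳ _

  ⟪q⊗⟫ : ∀ p w → ⟪ q ⊗ p ⟫ w ≡ ⟪ p ⟫ (λ k l → w (suc k) l)
  ⟪q⊗⟫ p w = ≡.trans (⟪⊗⟫ q p w) (≡.trans (ℤₚ.+-identityʳ _) (ℤₚ.*-identityˡ _))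

  ⟪a⊗⟫ : ∀ p w → ⟪ a ⊗ p ⟫ w ≡ ⟪ p ⟫ (λ k l → w k (suc l))
  ⟪a⊗⟫ p w = ≡.trans (⟪⊗⟫ a p w) (≡.trans (ℤₚ.+-identityʳ _) (ℤₚ.*-identityˡ _))

module _ where
  open ≡.≡-Reasoning

  ⊗-comm : ∀ p r → p ⊗ r ≋ r ⊗ p
  ⊗-comm p r = Equiv⇒≋ λ w → begin
    ⟪ p ⊗ r ⟫ w ≡⟨ ⟪⊗⟫ p r w ⟩
    ⟪ p ⟫ (λ i j → ⟪ r ⟫ (λ k l → w (i ℕ.+ k) (j ℕ.+ l))) ≡⟨ ⟪⟫-swap p r _ ⟩
    ⟪ r ⟫ (λ k l → ⟪ p ⟫ (λ i j → w (i ℕ.+ k) (j ℕ.+ l))) ≡⟨ ⟪⟫-ext r (λ k l → ⟪⟫-ext p (λ i j → cong₂ w (ℕₚ.+-comm i k) (ℕₚ.+-comm j l))) ⟩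
    ⟪ r ⟫ (λ k l → ⟪ p ⟫ (λ i j → w (k ℕ.+ i) (l ℕ.+ j))) ≡⟨ ⟪⊗⟫ r p w ⟨
    ⟪ r ⊗ p ⟫ w ∎

  ⊗-assoc : ∀ p r s → (p ⊗ r) ⊗ s ≋ p ⊗ (r ⊗ s)
  ⊗-assoc p r s = Equiv⇒≋ λ w → begin
    ⟪ (p ⊗ r) ⊗ s ⟫ w ≡⟨ ⟪⊗⟫ (p ⊗ r) s w ⟩
    ⟪ p ⊗ r ⟫ _ ≡⟨ ⟪⊗⟫ p r _ ⟩
    ⟪ p ⟫ _ ≡⟨ ⟪⟫-ext p (λ i j → ⟪⟫-ext r (λ k l → ⟪⟫-ext s (λ m n → cong₂ w (ℕₚ.+-assoc i k m) (ℕₚ.+-assoc j l n)))) ⟩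
    ⟪ p ⟫ _ ≡⟨ ⟪⟫-ext p (λ i j → ⟪⊗⟫ r s (λ k l → w (i ℕ.+ k) (j ℕ.+ l))) ⟨
    ⟪ p ⟫ _ ≡⟨ ⟪⊗⟫ p (r ⊗ s) w ⟨
    ⟪ p ⊗ (r ⊗ s) ⟫ w ∎

  ⊗-cong : ∀ {p p' r r'} → p ≋ p' → r ≋ r' → p ⊗ r ≋ p' ⊗ r'
  ⊗-cong {p} {p'} {r} {r'} h g = Equiv⇒≋ λ w → begin
    ⟪ p ⊗ r ⟫ w ≡⟨ ⟪⊗⟫ p r w ⟩
    ⟪ p ⟫ _ ≡⟨ ⟪⟫-ext p (λ i j → ≋⇒Equiv g _) ⟩
    ⟪ p ⟫ _ ≡⟨ ≋⇒Equiv h _ ⟩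
    ⟪ p' ⟫ _ ≡⟨ ⟪⊗⟫ p' r' w ⟨
    ⟪ p' ⊗ r' ⟫ w ∎

  ⊗-identityˡ : ∀ p → κ 1ℤ ⊗ p ≋ p
  ⊗-identityˡ p = Equiv⇒≋ λ w → ≡.trans (⟪⊗⟫ (κ 1ℤ) p w) (≡.trans (⟪κ⟫ 1ℤ _) (ℤₚ.*-identityˡ _))

  ⊗-distribˡ-⊕ : ∀ p r s → p ⊗ (r ⊕ s) ≋ (p ⊗ r) ⊕ (p ⊗ s)
  ⊗-distribˡ-⊕ p r s = Equiv⇒≋ λ w → begin
    ⟪ p ⊗ (r ⊕ s) ⟫ w ≡⟨ ⟪⊗⟫ p (r ⊕ s) w ⟩
    ⟪ p ⟫ _ ≡⟨ ⟪⟫-ext p (λ i j → ⟪⊕⟫ r s _) ⟩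
    ⟪ p ⟫ _ ≡⟨ ⟪⟫-+ p _ _ ⟩
    ⟪ p ⟫ _ ℤ.+ ⟪ p ⟫ _ ≡⟨ cong₂ ℤ._+_ (⟪⊗⟫ p r w) (⟪⊗⟫ p s w) ⟨
    ⟪ p ⊗ r ⟫ w ℤ.+ ⟪ p ⊗ s ⟫ w ≡⟨ ⟪⊕⟫ (p ⊗ r) (p ⊗ s) w ⟨
    ⟪ p ⊗ r ⊕ p ⊗ s ⟫ w ∎

  ≋-refl : ∀ {p} → p ≋ p
  ≋-refl = mk λ _ _ → ≡.refl
  ≋-sym : ∀ {p r} → p ≋ r → r ≋ p
  ≋-sym (mk h) = mk λ i j → ≡.sym (h i j)
  ≋-trans : ∀ {p r s} → p ≋ r → r ≋ s → p ≋ s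
  ≋-trans (mk h) (mk g) = mk λ i j → ≡.trans (h i j) (g i j)

  ⊕-cong : ∀ {p p' r r'} → p ≋ p' → r ≋ r' → p ⊕ r ≋ p' ⊕ r'
  ⊕-cong {p} {p'} {r} {r'} h g = Equiv⇒≋ λ w →
    ≡.trans (⟪⊕⟫ p r w) (≡.trans (cong₂ ℤ._+_ (≋⇒Equiv h w) (≋⇒Equiv g w)) (≡.sym (⟪⊕⟫ p' r' w)))

  ⊕-assoc : ∀ p r s → (p ⊕ r) ⊕ s ≋ p ⊕ (r ⊕ s)
  ⊕-assoc p r s = Equiv⇒≋ λ w → begin
    ⟪ (p ⊕ r) ⊕ s ⟫ w ≡⟨ ⟪⊕⟫ (p ⊕ r) s w ⟩
    ⟪ p ⊕ r ⟫ w ℤ.+ ⟪ s ⟫ w ≡⟨ cong (ℤ._+ ⟪ s ⟫ w) (⟪⊕⟫ p r w) ⟩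
    ⟪ p ⟫ w ℤ.+ ⟪ r ⟫ w ℤ.+ ⟪ s ⟫ w ≡⟨ ℤₚ.+-assoc (⟪ p ⟫ w) _ _ ⟩
    ⟪ p ⟫ w ℤ.+ (⟪ r ⟫ w ℤ.+ ⟪ s ⟫ w) ≡⟨ cong (ℤ._+_ (⟪ p ⟫ w)) (⟪⊕⟫ r s w) ⟨
    ⟪ p ⟫ w ℤ.+ ⟪ r ⊕ s ⟫ w ≡⟨ ⟪⊕⟫ p (r ⊕ s) w ⟨
    ⟪ p ⊕ (r ⊕ s) ⟫ w ∎

  ⊕-comm : ∀ p r → p ⊕ r ≋ r ⊕ p
  ⊕-comm p r = Equiv⇒≋ λ w → ≡.trans (⟪⊕⟫ p r w) (≡.trans (ℤₚ.+-comm (⟪ p ⟫ w) _) (≡.sym (⟪⊕⟫ r p w)))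

  ⊕-identityˡ : ∀ p → κ 0ℤ ⊕ p ≋ p
  ⊕-identityˡ p = Equiv⇒≋ λ w → ≡.trans (⟪⊕⟫ (κ 0ℤ) p w) (≡.trans (cong (ℤ._+ ⟪ p ⟫ w) (⟪κ⟫ 0ℤ w)) (ℤₚ.+-identityˡ _))

  ⊖-cong : ∀ {p r} → p ≋ r → ⊖ p ≋ ⊖ r
  ⊖-cong {p} {r} h = Equiv⇒≋ λ w → ≡.trans (⟪⊖⟫ p w) (≡.trans (cong ℤ.-_ (≋⇒Equiv h w)) (≡.sym (⟪⊖⟫ r w)))

  ⊖-inverseˡ : ∀ p → (⊖ p) ⊕ p ≋ κ 0ℤ
  ⊖-inverseˡ p = Equiv⇒≋ λ w → begin
    ⟪ (⊖ p) ⊕ p ⟫ w ≡⟨ ⟪⊕⟫ (⊖ p) p w ⟩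
    ⟪ ⊖ p ⟫ w ℤ.+ ⟪ p ⟫ w ≡⟨ cong (ℤ._+ ⟪ p ⟫ w) (⟪⊖⟫ p w) ⟩
    ℤ.- ⟪ p ⟫ w ℤ.+ ⟪ p ⟫ w ≡⟨ ℤₚ.+-inverseˡ (⟪ p ⟫ w) ⟩
    0ℤ ≡⟨ ⟪κ⟫ 0ℤ w ⟨
    ⟪ κ 0ℤ ⟫ w ∎

polyRing : CommutativeRing 0ℓ 0ℓ
polyRing = record
  { Carrier = Poly ; _≈_ = _≋_ ; _+_ = _⊕_ ; _*_ = _⊗_ ; -_ = ⊖_ ; 0# = κ 0ℤ ; 1# = κ 1ℤ
  ; isCommutativeRing = record
    { isRing = record
      { +-isAbelianGroup = record
        { isGroup = record
          { isMonoid = record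
            { isSemigroup = record
              { isMagma = record
                { isEquivalence = record { refl = ≋-refl ; sym = ≋-sym ; trans = ≋-trans }
                ; ∙-cong = ⊕-cong }
              ; assoc = ⊕-assoc }
            ; identity = ⊕-identityˡ , λ p → ≋-trans (⊕-comm p _) (⊕-identityˡ p) }
          ; inverse = ⊖-inverseˡ , λ p → ≋-trans (⊕-comm p _) (⊖-inverseˡ p)
          ; ⁻¹-cong = ⊖-cong }
        ; comm = ⊕-comm }
      ; *-cong = ⊗-cong
      ; *-assoc = ⊗-assoc
      ; *-identity = ⊗-identityˡ , λ p → ≋-trans (⊗-comm p _) (⊗-identityˡ p)
      ; distrib = ⊗-distribˡ-⊕ , λ p r s → ≋-trans (⊗-comm (r ⊕ s) p) (≋-trans (⊗-distribˡ-⊕ p r s) (⊕-cong (⊗-comm p r) (⊗-comm p s))) }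
    ; *-comm = ⊗-comm } }

κ-+ : ∀ c d → κ (c ℤ.+ d) ≋ κ c ⊕ κ d
κ-+ c d = Equiv⇒≋ λ w → ≡.trans (⟪κ⟫ (c ℤ.+ d) w) (≡.trans (ℤₚ.*-distribʳ-+ (w 0 0) c d)
  (≡.trans (≡.sym (cong₂ ℤ._+_ (⟪κ⟫ c w) (⟪κ⟫ d w))) (≡.sym (⟪⊕⟫ (κ c) (κ d) w))))

κ-* : ∀ c d → κ (c ℤ.* d) ≋ κ c ⊗ κ d
κ-* c d = Equiv⇒≋ λ w → ≡.trans (⟪κ⟫ (c ℤ.* d) w) (≡.trans (ℤₚ.*-assoc c d (w 0 0))
  (≡.trans (≡.sym (cong (c ℤ.*_) (⟪κ⟫ d w))) (≡.sym (≡.trans (⟪⊗⟫ (κ c) (κ d) w) (⟪κ⟫ c _)))))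

κ-neg : ∀ c → κ (ℤ.- c) ≋ ⊖ κ c
κ-neg c = Equiv⇒≋ λ w → ≡.trans (⟪κ⟫ (ℤ.- c) w) (≡.trans (≡.sym (ℤₚ.neg-distribˡ-* c (w 0 0)))
  (≡.sym (≡.trans (⟪⊖⟫ (κ c) w) (cong ℤ.-_ (⟪κ⟫ c w)))))

≟-κ : ∀ c d → Maybe (κ c ≋ κ d)
≟-κ c d with c ℤ.≟ d
... | yes ≡.refl = just ≋-refl
... | no _ = nothing

κ-morphism : ℤ.+-*-rawRing -Raw-AlmostCommutative⟶ fromCommutativeRing polyRing
κ-morphism = record { ⟦_⟧ = κ ; +-homo = κ-+ ; *-homo = κ-* ; -‿homo = κ-neg ; 0-homo = ≋-refl ; 1-homo = ≋-refl }

module Solver = Algebra.Solver.Ring ℤ.+-*-rawRing (fromCommutativeRing polyRing) κ-morphism ≟-κ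

open CommutativeRing polyRing using (_+_; _*_; -_; _-_; 0#; 1#; refl; sym; trans; semiring; setoid; +-cong; +-congˡ; +-congʳ; *-cong; *-congˡ; *-congʳ; -‿cong; *-comm; *-assoc; *-identityˡ; *-identityʳ; zeroˡ; zeroʳ; +-identityˡ; +-identityʳ; reflexive)
open import Algebra.Properties.Semiring.Exp semiring using (_^_; ^-homo-*; ^-assocʳ; ^-congˡ)
open Solver using (solve; _:+_; _:*_; _:-_; _:=_; _:^_; con; :-_)
open import Relation.Binary.Reasoning.Setoid setoid using (begin_; step-≈-⟩; step-≈-⟨; _∎)

-- Integrality and divisibility

record Lead (p : Poly) : Set where
  constructor mkLead
  field
    {lc} : ℤ
    {qdeg adeg} : ℕ
    {rest} : Poly
    lc≢0 : lc ≢ 0ℤ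
    below : Below (qdeg , adeg) rest
    eqn : Equiv ((lc , qdeg , adeg) ∷ rest) p

NZ : Poly → Set
NZ p = ¬ p ≋ 0#

⟪0⟫ : ∀ w → ⟪ 0# ⟫ w ≡ 0ℤ
⟪0⟫ w = ⟪κ⟫ 0ℤ w

leading : ∀ p → p ≋ 0# ⊎ Lead p
leading p with sorted p
... | [] , _ , eq = inj₁ (Equiv⇒≋ λ w → ≡.trans (≡.sym (eq w)) (≡.sym (⟪0⟫ w)))
... | (c , i , j) ∷ r , cons c≢0 b s , eq = inj₂ (mkLead c≢0 b eq)

nz-leading : ∀ {p} → NZ p → Lead p
nz-leading {p} nz with leading p
... | inj₁ z = ⊥-elim (nz z)
... | inj₂ l = l

open Lead using (lc; qdeg; adeg; lc≢0)

-- By `≺-+` every other product of two terms has a strictly smaller exponent. As ℤ has no zero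
-- divisors, neither has ℤ[q, a].
lead-* : ∀ {f g} (F : Lead f) (G : Lead g) →
  ⟪ f * g ⟫ δ (qdeg F ℕ.+ qdeg G) (adeg F ℕ.+ adeg G) ≡ lc F ℤ.* lc G
lead-* {f} {g} F@(mkLead {c} {i} {j} {f'} _ bF eF) G@(mkLead {d} {k} {l} {g'} _ bG eG) =
  ≡.trans (⟪⊗⟫ f g _) (≡.trans (≡.trans (⟪⟫-ext f (λ x y → ≡.sym (eG _))) (≡.sym (eF _)))
  (≡.trans (cong₂ ℤ._+_ (cong (c ℤ.*_) (≡.trans (cong₂ ℤ._+_ (cong (d ℤ.*_) (δ-same (i ℕ.+ k) (j ℕ.+ l))) tail₁)
      (≡.trans (ℤₚ.+-identityʳ _) (ℤₚ.*-identityʳ d)))) tail₂) (ℤₚ.+-identityʳ _)))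
  where
  w = δ (i ℕ.+ k) (j ℕ.+ l)
  off : ∀ {x y} → (x , y) ≺ (i ℕ.+ k , j ℕ.+ l) → w x y ≡ 0ℤ
  off h = δ-diff (i ℕ.+ k) (j ℕ.+ l) _ _ (≺⇒≢ h)
  flip-≺ : ∀ {x y} → (x , y) ≺ (k , l) → (i ℕ.+ x , j ℕ.+ y) ≺ (i ℕ.+ k , j ℕ.+ l)
  flip-≺ {x} {y} h rewrite ℕₚ.+-comm i x | ℕₚ.+-comm j y | ℕₚ.+-comm i k | ℕₚ.+-comm j l = ≺-+ h (inj₁ ≡.refl)
  tail₁ : ⟪ g' ⟫ (λ x y → w (i ℕ.+ x) (j ℕ.+ y)) ≡ 0ℤ
  tail₁ = ⟪⟫-vanish (All.map (λ h → off (flip-≺ h)) bG)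
  tail₂ : ⟪ f' ⟫ (λ x y → ⟪ (d , k , l) ∷ g' ⟫ (λ x' y' → w (x ℕ.+ x') (y ℕ.+ y'))) ≡ 0ℤ
  tail₂ = ⟪⟫-vanish (All.map (λ h → ⟪⟫-vanish {(d , k , l) ∷ g'}
      (off (≺-+ h (inj₁ ≡.refl)) ∷ All.map (λ h' → off (≺-+ h (inj₂ h'))) bG)) bF)

lc*lc≢0 : ∀ {f g} (F : Lead f) (G : Lead g) → lc F ℤ.* lc G ≢ 0ℤ
lc*lc≢0 F G e with ℤₚ.i*j≡0⇒i≡0∨j≡0 (lc F) e
... | inj₁ z = lc≢0 F z
... | inj₂ z = lc≢0 G z

NZ-* : ∀ {f g} → NZ f → NZ g → NZ (f * g)
NZ-* nf ng e = lc*lc≢0 F G (≡.trans (≡.sym (lead-* F G)) (≡.trans (≋⇒Equiv e _) (⟪0⟫ _)))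
  where
  F = nz-leading nf
  G = nz-leading ng

*-cancel-0 : ∀ {f g} → NZ f → f * g ≋ 0# → g ≋ 0#
*-cancel-0 {f} {g} nf e with leading g
... | inj₁ z = z
... | inj₂ G = ⊥-elim (lc*lc≢0 F G (≡.trans (≡.sym (lead-* F G)) (≡.trans (≋⇒Equiv e _) (⟪0⟫ _))))
  where F = nz-leading nf

-≋0 : ∀ {f g} → f - g ≋ 0# → f ≋ g
-≋0 {f} {g} e = begin
  f           ≈⟨ solve 2 (λ x y → x := (x :- y) :+ y) refl f g ⟩
  (f - g) + g ≈⟨ +-congʳ e ⟩
  0# + g      ≈⟨ +-identityˡ g ⟩
  g           ∎

≋⇒-≋0 : ∀ {f g} → f ≋ g → f - g ≋ 0#
≋⇒-≋0 {f} {g} e = trans (+-congʳ e) (solve 1 (λ x → x :- x := con 0ℤ) refl g)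

*-cancel : ∀ {f g h} → NZ f → f * g ≋ f * h → g ≋ h
*-cancel {f} {g} {h} nf e = -≋0 (*-cancel-0 nf (trans (solve 3 (λ x y z → x :* (y :- z) := x :* y :- x :* z) refl f g h) (≋⇒-≋0 e)))

infix 4 _∣_
record _∣_ (f g : Poly) : Set where
  constructor divides
  field
    quotient : Poly
    equality : f * quotient ≋ g

∣-resp : ∀ {f g h} → g ≋ h → f ∣ g → f ∣ h
∣-resp e (divides x d) = divides x (trans d e)
∣-respˡ : ∀ {f g h} → f ≋ g → f ∣ h → g ∣ h
∣-respˡ e (divides x d) = divides x (trans (*-congʳ (sym e)) d)
∣-refl : ∀ {f} → f ∣ f
∣-refl = divides 1# (*-identityʳ _)
∣-trans : ∀ {f g h} → f ∣ g → g ∣ h → f ∣ h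
∣-trans {f} (divides x d) (divides y e) = divides (x * y) (trans (sym (*-assoc f x y)) (trans (*-congʳ d) e))
∣-*ʳ : ∀ {f g} h → f ∣ g → f ∣ g * h
∣-*ʳ {f} h (divides x d) = divides (x * h) (trans (sym (*-assoc f x h)) (*-congʳ d))
∣-*ˡ : ∀ {f g} h → f ∣ g → f ∣ h * g
∣-*ˡ h d = ∣-resp (*-comm _ h) (∣-*ʳ h d)
∣-+ : ∀ {f g h} → f ∣ g → f ∣ h → f ∣ g + h
∣-+ {f} (divides x d) (divides y e) = divides (x + y) (trans (solve 3 (λ f x y → f :* (x :+ y) := f :* x :+ f :* y) refl f x y)
    (+-cong d e))
∣-neg : ∀ {f g} → f ∣ g → f ∣ - g
∣-neg {f} (divides x d) = divides (- x) (trans (solve 2 (λ f x → f :* :- x := :- (f :* x)) refl f x) (-‿cong d))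
∣-- : ∀ {f g h} → f ∣ g → f ∣ h → f ∣ g - h
∣-- d e = ∣-+ d (∣-neg e)
∣-0 : ∀ {f} → f ∣ 0#
∣-0 = divides 0# (zeroʳ _)

NZ-∣ : ∀ {f g} → f ∣ g → NZ g → NZ f
NZ-∣ (divides x d) ng e = ng (trans (sym d) (trans (*-congʳ e) (zeroˡ x)))

NZ-resp : ∀ {f g} → f ≋ g → NZ f → NZ g
NZ-resp e nf z = nf (trans e z)

NZ-κ : ∀ {c} → c ≢ 0ℤ → NZ (κ c)
NZ-κ {c} ne e = ne (≡.trans (≡.sym (≡.trans (⟪κ⟫ c (λ _ _ → 1ℤ)) (ℤₚ.*-identityʳ c))) (≡.trans (≋⇒Equiv e _) (⟪0⟫ (λ _ _ → 1ℤ))))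

*κ-cancel : ∀ {c f g} → c ≢ 0ℤ → κ c * f ≋ κ c * g → f ≋ g
*κ-cancel ne = *-cancel (NZ-κ ne)

-- Supports and truncation

expo : Mono → ℕ × ℕ
expo = proj₂

⟪⟫-ext-All : ∀ {p w w'} → All (λ m → w (proj₁ (expo m)) (proj₂ (expo m)) ≡ w' (proj₁ (expo m)) (proj₂ (expo m))) p → ⟪ p ⟫ w ≡ ⟪ p ⟫ w'
⟪⟫-ext-All [] = ≡.refl
⟪⟫-ext-All {(c , _) ∷ p} (e ∷ es) = cong₂ (λ x y → c ℤ.* x ℤ.+ y) e (⟪⟫-ext-All es)

-- A condition on one representing list rather than on the coefficients: sums and products can then
-- be treated term by term, whatever cancels.
record Supported (P : ℕ × ℕ → Set) (p : Poly) : Set where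
  constructor supported
  field
    {terms} : Poly
    allTerms : All (P ∘ expo) terms
    represents : p ≋ terms

supp-resp : ∀ {P p r} → p ≋ r → Supported P p → Supported P r
supp-resp e (supported s f) = supported s (trans (sym e) f)

opaque
  unfolding κ

  supp-+ : ∀ {P p r} → Supported P p → Supported P r → Supported P (p + r)
  supp-+ (supported s e) (supported t f) = supported (Allₚ.++⁺ s t) (+-cong e f)

  supp-neg : ∀ {P p} → Supported P p → Supported P (- p)
  supp-neg (supported s e) = supported (Allₚ.map⁺ s) (-‿cong e)

  supp-* : ∀ {P Q R : ℕ × ℕ → Set} {p r} → (∀ {i j k l} → P (i , j) → Q (k , l) → R (i ℕ.+ k , j ℕ.+ l)) →
    Supported P p → Supported Q r → Supported R (p * r)
  supp-* {P} {Q} {R} h (supported {x} s e) (supported {y} t f) = supported (go x s) (*-cong e f)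
    where
    go : ∀ x → All (P ∘ expo) x → All (R ∘ expo) (x *ₚ y)
    go [] [] = []
    go (m ∷ x) (u ∷ us) = Allₚ.++⁺ {xs = shift m y} (Allₚ.map⁺ (All.map (h u) t)) (go x us)

  supp-κ : ∀ {P} c → P (0 , 0) → Supported P (κ c)
  supp-κ c u = supported (u ∷ []) refl

  supp-q : ∀ {P} → P (1 , 0) → Supported P q
  supp-q u = supported (u ∷ []) refl

  supp-a : ∀ {P} → P (0 , 1) → Supported P a
  supp-a u = supported (u ∷ []) refl

supp-weaken : ∀ {P Q : ℕ × ℕ → Set} {p} → (∀ {e} → P e → Q e) → Supported P p → Supported Q p
supp-weaken h (supported s e) = supported (All.map h s) e

ADeg : ℕ → Poly → Set
ADeg K = Supported (λ e → proj₂ e ≤ K)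

adeg-* : ∀ {K L p r} → ADeg K p → ADeg L r → ADeg (K ℕ.+ L) (p * r)
adeg-* = supp-* ℕₚ.+-mono-≤

adeg-weaken : ∀ {K L p} → K ≤ L → ADeg K p → ADeg L p
adeg-weaken h = supp-weaken (λ x → ℕₚ.≤-trans x h)

adeg-a : ADeg 1 a
adeg-a = supp-a ℕₚ.≤-refl

AFree : Poly → Set
AFree = ADeg 0

afree-* : ∀ {p r} → AFree p → AFree r → AFree (p * r)
afree-* = adeg-*

afree-κ : ∀ c → AFree (κ c)
afree-κ c = supp-κ c z≤n

afree-q : AFree q
afree-q = supp-q z≤n

afree-^ : ∀ {p} k → AFree p → AFree (p ^ k)
afree-^ zero f = afree-κ 1ℤ
afree-^ (suc k) f = afree-* f (afree-^ k f)

adeg-- : ∀ {K p r} → ADeg K p → ADeg K r → ADeg K (p - r)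
adeg-- f g = supp-+ f (supp-neg g)

supp-coeff : ∀ {P p i j} → Supported P p → ¬ P (i , j) → ⟪ p ⟫ δ i j ≡ 0ℤ
supp-coeff {i = i} {j} (supported s e) ne =
  ≡.trans (≋⇒Equiv e _) (⟪⟫-vanish (All.map (λ {m} u → δ-diff i j (proj₁ (expo m)) (proj₂ (expo m)) (λ { ≡.refl → ne u })) s))

-- The leading exponent of a divisor is bounded by that of the multiple, because leading coefficients multiply.

∣-lead : ∀ {f g} → f ∣ g → NZ g → Σ (Lead f) λ F → Σ (ℕ × ℕ) λ e →
  ∀ (P : ℕ × ℕ → Set) → (∀ e → Dec (P e)) → Supported P g → P (qdeg F ℕ.+ proj₁ e , adeg F ℕ.+ proj₂ e)
∣-lead {f} {g} (divides h d) ng = F , (qdeg H , adeg H) , λ P P? s → decidable-stable (P? _)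
    (λ ne → lc*lc≢0 F H (≡.trans (≡.sym (lead-* F H)) (supp-coeff (supp-resp (sym d) s) ne)))
  where
  F = nz-leading (λ z → ng (trans (sym d) (trans (*-congʳ z) (zeroˡ h))))
  H = nz-leading (λ z → ng (trans (sym d) (trans (*-congˡ z) (zeroʳ f))))

lead-supported : ∀ {f P} (F : Lead f) → P (qdeg F , adeg F) → (∀ {e} → e ≺ (qdeg F , adeg F) → P e) → Supported P f
lead-supported (mkLead {c} {i} {j} {r} _ b e) h g = supported {terms = (c , i , j) ∷ r} (h ∷ All.map g b)
    (≋-sym (Equiv⇒≋ {(c , i , j) ∷ r} e))

-- Serves for Φ and for common divisors, which are known only as divisors of some polynomial in q
-- alone.
∣-afree : ∀ {f g} → f ∣ g → NZ g → AFree g → AFree f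
∣-afree {f} d ng s = lead-supported F j≤0 below-0
  where
  F = proj₁ (∣-lead d ng)
  j≤0 : adeg F ≤ 0
  j≤0 = ℕₚ.m+n≤o⇒m≤o (adeg F) (proj₂ (proj₂ (∣-lead d ng)) (λ e → proj₂ e ≤ 0) (λ e → proj₂ e ℕ.≤? 0) s)
  below-0 : ∀ {e} → e ≺ (qdeg F , adeg F) → proj₂ e ≤ 0
  below-0 (inj₁ x) = ℕₚ.≤-trans (ℕₚ.<⇒≤ x) j≤0
  below-0 (inj₂ (x , _)) = ℕₚ.≤-trans (ℕₚ.≤-reflexive x) j≤0

-- Total degree 0 of the multiple forces total degree 0 of the leading term of f. This is how a
-- Bézout identity with an integer on the right yields `Coprimeₚ`.
∣-const : ∀ {f c} → f ∣ κ c → c ≢ 0ℤ → IsConst f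
∣-const {f} {c} d ne i j ij≢0 = ≡.trans (coeff≡⟪⟫ f i j)
    (supp-coeff {P = λ e → proj₁ e ≡ 0 × proj₂ e ≡ 0} (lead-supported F (i'≡0 , j'≡0) below-0) ij≢0)
  where
  F = proj₁ (∣-lead d (NZ-κ ne))
  k = proj₁ (proj₁ (proj₂ (∣-lead d (NZ-κ ne))))
  l = proj₂ (proj₁ (proj₂ (∣-lead d (NZ-κ ne))))
  total : qdeg F ℕ.+ k ℕ.+ (adeg F ℕ.+ l) ≤ 0
  total = proj₂ (proj₂ (∣-lead d (NZ-κ ne))) (λ e → proj₁ e ℕ.+ proj₂ e ≤ 0) (λ e → proj₁ e ℕ.+ proj₂ e ℕ.≤? 0) (supp-κ c z≤n)
  i'≡0 : qdeg F ≡ 0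
  i'≡0 = ℕₚ.n≤0⇒n≡0 (ℕₚ.m+n≤o⇒m≤o (qdeg F) (ℕₚ.m+n≤o⇒m≤o (qdeg F ℕ.+ k) total))
  j'≡0 : adeg F ≡ 0
  j'≡0 = ℕₚ.n≤0⇒n≡0 (ℕₚ.m+n≤o⇒m≤o (adeg F) (ℕₚ.m+n≤o⇒n≤o (qdeg F ℕ.+ k) total))
  below-0 : ∀ {e} → e ≺ (qdeg F , adeg F) → proj₁ e ≡ 0 × proj₂ e ≡ 0
  below-0 (inj₁ x) = ⊥-elim (ℕₚ.n≮0 (ℕₚ.≤-trans x (ℕₚ.≤-reflexive j'≡0)))
  below-0 (inj₂ (_ , x)) = ⊥-elim (ℕₚ.n≮0 (ℕₚ.≤-trans x (ℕₚ.≤-reflexive i'≡0)))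

-- Two gradings are used: the total degree, to cancel divisors of q^n - 1 modulo an integer, and the
-- degree in a, to cancel 1 - a q^n modulo Φ.
module Weight (wt : ℕ → ℕ → ℕ) (wt-+ : ∀ i j k l → wt (i ℕ.+ k) (j ℕ.+ l) ≡ wt i j ℕ.+ wt k l) where

  cut : ℕ → (ℕ → ℕ → ℤ) → ℕ → ℕ → ℤ
  cut K w i j with wt i j ℕ.<? K
  ... | yes _ = w i j
  ... | no _ = 0ℤ

  low : ℕ → Poly → Poly
  low K [] = []
  low K ((c , i , j) ∷ p) with wt i j ℕ.<? K
  ... | yes _ = (c , i , j) ∷ low K p
  ... | no _ = low K p

  ⟪low⟫ : ∀ K p w → ⟪ low K p ⟫ w ≡ ⟪ p ⟫ (cut K w)
  ⟪low⟫ K [] w = ≡.refl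
  ⟪low⟫ K ((c , i , j) ∷ p) w with wt i j ℕ.<? K
  ... | yes _ = cong (ℤ._+_ (c ℤ.* w i j)) (⟪low⟫ K p w)
  ... | no _ = ≡.trans (⟪low⟫ K p w) (≡.trans (≡.sym (ℤₚ.+-identityˡ _)) (cong (ℤ._+ ⟪ p ⟫ cut K w) (≡.sym (ℤₚ.*-zeroʳ c))))

  cut-< : ∀ {K i j} w → wt i j < K → cut K w i j ≡ w i j
  cut-< {K} {i} {j} w h with wt i j ℕ.<? K
  ... | yes _ = ≡.refl
  ... | no ne = ⊥-elim (ne h)

  cut-≥ : ∀ {K i j} w → K ≤ wt i j → cut K w i j ≡ 0ℤ
  cut-≥ {K} {i} {j} w h with wt i j ℕ.<? K
  ... | yes h' = ⊥-elim (ℕₚ.<⇒≱ h' h)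
  ... | no _ = ≡.refl

  cut-shift : ∀ K w i j k l → wt i j ≡ 0 → cut K w (i ℕ.+ k) (j ℕ.+ l) ≡ cut K (λ x y → w (i ℕ.+ x) (j ℕ.+ y)) k l
  cut-shift K w i j k l z with ℕₚ.<-≤-connex (wt k l) K
  ... | inj₁ h = ≡.trans (cut-< w (subst (_< K) (≡.sym e) h)) (≡.sym (cut-< (λ x y → w (i ℕ.+ x) (j ℕ.+ y)) h))
    where e = ≡.trans (wt-+ i j k l) (cong (ℕ._+ wt k l) z)
  ... | inj₂ h = ≡.trans (cut-≥ w (subst (K ≤_) (≡.sym e) h)) (≡.sym (cut-≥ (λ x y → w (i ℕ.+ x) (j ℕ.+ y)) h))
    where e = ≡.trans (wt-+ i j k l) (cong (ℕ._+ wt k l) z)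

  Hom : Poly → Set
  Hom = Supported (λ e → wt (proj₁ e) (proj₂ e) ≡ 0)

  High : ℕ → Poly → Set
  High K = Supported (λ e → K ≤ wt (proj₁ e) (proj₂ e))

  low-cong : ∀ {K p r} → p ≋ r → low K p ≋ low K r
  low-cong {K} {p} {r} e = Equiv⇒≋ λ w → ≡.trans (⟪low⟫ K p w) (≡.trans (≋⇒Equiv e _) (≡.sym (⟪low⟫ K r w)))

  low-+ : ∀ K p r → low K (p + r) ≋ low K p + low K r
  low-+ K p r = Equiv⇒≋ λ w → ≡.trans (⟪low⟫ K (p + r) w) (≡.trans (⟪⊕⟫ p r _)
    (≡.trans (≡.sym (cong₂ ℤ._+_ (⟪low⟫ K p w) (⟪low⟫ K r w))) (≡.sym (⟪⊕⟫ (low K p) (low K r) w))))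

  low-* : ∀ K {c} p → Hom c → low K (c * p) ≋ c * low K p
  low-* K {c} p (supported {c'} s e) = trans (low-cong (*-congʳ e)) (trans main (*-congʳ (sym e)))
    where
    main : low K (c' * p) ≋ c' * low K p
    main = Equiv⇒≋ λ w → ≡.trans (⟪low⟫ K (c' * p) w) (≡.trans (⟪⊗⟫ c' p _)
      (≡.trans (⟪⟫-ext-All (All.map (λ {m} z → ≡.trans
         (⟪⟫-ext p (λ k l → cut-shift K w (proj₁ (expo m)) (proj₂ (expo m)) k l z))
         (≡.sym (⟪low⟫ K p (λ x y → w (proj₁ (expo m) ℕ.+ x) (proj₂ (expo m) ℕ.+ y))))) s))
        (≡.sym (⟪⊗⟫ c' (low K p) w))))

  low-high : ∀ {K p} r → High K p → low K (p * r) ≋ 0#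
  low-high {K} {p} r (supported {p'} s e) = trans (low-cong (*-congʳ e)) (Equiv⇒≋ λ w →
    ≡.trans (⟪low⟫ K (p' * r) w) (≡.trans (⟪⊗⟫ p' r _) (≡.trans
      (⟪⟫-vanish (All.map (λ {m} z → ≡.trans (⟪⟫-ext r (λ k l → cut-≥ w (ℕₚ.≤-trans z
         (ℕₚ.≤-trans (ℕₚ.m≤m+n _ (wt k l)) (ℕₚ.≤-reflexive (≡.sym (wt-+ (proj₁ (expo m)) (proj₂ (expo m)) k l))))))) (⟪⟫-0 r)) s))
      (≡.sym (⟪0⟫ w)))))

  bound : ∀ p → Σ ℕ λ K → All (λ m → wt (proj₁ (expo m)) (proj₂ (expo m)) < K) p
  bound [] = 0 , []
  bound ((c , i , j) ∷ p) with bound p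
  ... | K , h = suc (wt i j) ℕ.+ K , ℕₚ.m≤m+n _ K ∷ All.map (λ x → ℕₚ.≤-trans x (ℕₚ.m≤n+m K _)) h

  low-all : ∀ p → Σ ℕ λ K → low K p ≋ p
  low-all p with bound p
  ... | K , h = K , Equiv⇒≋ λ w → ≡.trans (⟪low⟫ K p w) (⟪⟫-ext-All (All.map (cut-< w) h))

  high-^ : ∀ {z} K → High 1 z → High K (z ^ K)
  high-^ zero h = supp-κ 1ℤ z≤n
  high-^ (suc K) h = supp-* (λ {i} {j} {k} {l} x y → ℕₚ.≤-trans (ℕₚ.+-mono-≤ x y) (ℕₚ.≤-reflexive (≡.sym (wt-+ i j k l)))) h (high-^ K h)

  iterate : ∀ {c z w} K → c ∣ (1# - z) * w → c ∣ w - z ^ K * w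
  iterate {c} {z} {w} zero d = ∣-resp (sym (trans (+-congˡ (-‿cong (*-identityˡ w))) (≋⇒-≋0 refl))) ∣-0
  iterate {c} {z} {w} (suc K) d = ∣-resp (solve 3 (λ w z y → (w :- y :* w) :+ y :* ((con 1ℤ :- z) :* w) := w :- (z :* y) :* w) refl w z
      (z ^ K))
    (∣-+ (iterate K d) (∣-*ˡ (z ^ K) d))

  -- Modulo c one has w ≡ z w ≡ z² w ≡ …, and truncation below the weight of z^K turns this into w ≡ 0.
  ∣-cancel-1-z : ∀ {c z w} → Hom c → High 1 z → c ∣ (1# - z) * w → c ∣ w
  ∣-cancel-1-z {c} {z} {w} hc hz d with low-all w
  ... | K , e with iterate K d
  ...   | divides h f = divides (low K h) (begin
      c * low K h                         ≈⟨ low-* K h hc ⟨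
      low K (c * h)                       ≈⟨ +-identityʳ _ ⟨
      low K (c * h) + 0#                  ≈⟨ +-congˡ (low-high w (high-^ K hz)) ⟨
      low K (c * h) + low K (z ^ K * w)   ≈⟨ low-+ K (c * h) (z ^ K * w) ⟨
      low K (c * h + z ^ K * w)           ≈⟨ low-cong (trans (+-congʳ f) (solve 2 (λ x y → x :- y :+ y := x) refl w (z ^ K * w))) ⟩
      low K w                             ≈⟨ e ⟩
      w                                   ∎)

-- Nonvanishing of binomials

⟪κ*⟫ : ∀ c p w → ⟪ κ c * p ⟫ w ≡ c ℤ.* ⟪ p ⟫ w
⟪κ*⟫ c p w = ≡.trans (⟪⊗⟫ (κ c) p w) (⟪κ⟫ c _)

⟪1*⟫ : ∀ p w → ⟪ 1# * p ⟫ w ≡ ⟪ p ⟫ w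
⟪1*⟫ p w = ≋⇒Equiv (*-identityˡ p) w

⟪a^⟫ : ∀ j w → ⟪ a ^ j ⟫ w ≡ w 0 j
⟪a^⟫ zero w = ≡.trans (⟪κ⟫ 1ℤ w) (ℤₚ.*-identityˡ _)
⟪a^⟫ (suc j) w = ≡.trans (⟪a⊗⟫ (a ^ j) w) (⟪a^⟫ j (λ k l → w k (suc l)))

⟪q^a^⟫ : ∀ i j w → ⟪ q ^ i * a ^ j ⟫ w ≡ w i j
⟪q^a^⟫ zero j w = ≡.trans (⟪1*⟫ (a ^ j) w) (⟪a^⟫ j w)
⟪q^a^⟫ (suc i) j w = ≡.trans (≋⇒Equiv (*-assoc q (q ^ i) (a ^ j)) w)
  (≡.trans (⟪q⊗⟫ (q ^ i * a ^ j) w) (⟪q^a^⟫ i j (λ k l → w (suc k) l)))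

NZ-binomial : ∀ i j k l → (k , l) ≢ (i , j) → NZ (q ^ i * a ^ j - q ^ k * a ^ l)
NZ-binomial i j k l ne e with ≡.trans (≡.sym (≡.trans (⟪⊕⟫ (q ^ i * a ^ j) _ (δ i j)) (cong₂ ℤ._+_
    (≡.trans (⟪q^a^⟫ i j (δ i j)) (δ-same i j))
    (≡.trans (⟪⊖⟫ (q ^ k * a ^ l) (δ i j)) (cong ℤ.-_ (≡.trans (⟪q^a^⟫ k l (δ i j)) (δ-diff i j k l ne)))))))
    (≡.trans (≋⇒Equiv e (δ i j)) (⟪0⟫ (δ i j)))
... | ()

NZ-q^-q^ : ∀ {i k} → i ≢ k → NZ (q ^ i - q ^ k)
NZ-q^-q^ {i} {k} ne = NZ-resp (solve 2 (λ x y → x :* con 1ℤ :- y :* con 1ℤ := x :- y) refl (q ^ i) (q ^ k))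
  (NZ-binomial i 0 k 0 (λ { ≡.refl → ne ≡.refl }))

NZ-1-q^ : ∀ k → NZ (1# - q ^ suc k)
NZ-1-q^ k = NZ-q^-q^ {0} {suc k} (λ ())

NZ-q : NZ q
NZ-q e with ≡.trans (≡.sym (⟪q^a^⟫ 1 0 (δ 1 0))) (≋⇒Equiv (trans (*-congʳ (*-identityʳ q)) (trans (*-identityʳ q) e)) (δ 1 0))
... | f with ≡.trans f (⟪0⟫ (δ 1 0))
...   | ()

NZ-a : NZ a
NZ-a e with ≡.trans (≡.sym (⟪a^⟫ 1 (δ 0 1))) (≡.trans (≋⇒Equiv (trans (*-identityʳ a) e) (δ 0 1)) (⟪0⟫ (δ 0 1)))
... | ()

NZ-1 : NZ 1#
NZ-1 = NZ-κ (λ ())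

NZ-^ : ∀ {f} k → NZ f → NZ (f ^ k)
NZ-^ zero _ = NZ-1
NZ-^ (suc k) nf = NZ-* nf (NZ-^ k nf)

NZ-1-aq^ : ∀ s → NZ (1# - a * q ^ s)
NZ-1-aq^ s = NZ-resp (solve 2 (λ a x → con 1ℤ :* con 1ℤ :- x :* (a :* con 1ℤ) := con 1ℤ :- a :* x) refl a (q ^ s))
    (NZ-binomial 0 0 s 1 (λ ()))

NZ-a-q^ : ∀ s → NZ (a - q ^ s)
NZ-a-q^ s = NZ-resp (solve 2 (λ a x → con 1ℤ :* (a :* con 1ℤ) :- x :* con 1ℤ := a :- x) refl a (q ^ s)) (NZ-binomial 0 1 s 0 (λ ()))

-- Evaluation at a = r

-- The point r may contain a itself. Evaluation at a is the identity (`ev-a-id`), which lets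
-- `factor` compare p with its value at r term by term.
ev : Poly → Poly → Poly
ev r [] = 0#
ev r ((c , i , j) ∷ p) = κ c * (q ^ i * r ^ j) + ev r p

⟪ev⟫ : ∀ r p w → ⟪ ev r p ⟫ w ≡ ⟪ p ⟫ (λ i j → ⟪ q ^ i * r ^ j ⟫ w)
⟪ev⟫ r [] w = ⟪0⟫ w
⟪ev⟫ r ((c , i , j) ∷ p) w = ≡.trans (⟪⊕⟫ _ (ev r p) w) (cong₂ ℤ._+_ (⟪κ*⟫ c (q ^ i * r ^ j) w) (⟪ev⟫ r p w))

ev-cong : ∀ r {p p'} → p ≋ p' → ev r p ≋ ev r p'
ev-cong r {p} {p'} e = Equiv⇒≋ λ w → ≡.trans (⟪ev⟫ r p w) (≡.trans (≋⇒Equiv e _) (≡.sym (⟪ev⟫ r p' w)))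

ev-+ : ∀ r p s → ev r (p + s) ≋ ev r p + ev r s
ev-+ r p s = Equiv⇒≋ λ w → ≡.trans (⟪ev⟫ r (p + s) w) (≡.trans (⟪⊕⟫ p s _)
  (≡.trans (≡.sym (cong₂ ℤ._+_ (⟪ev⟫ r p w) (⟪ev⟫ r s w))) (≡.sym (⟪⊕⟫ (ev r p) (ev r s) w))))

ev-neg : ∀ r p → ev r (- p) ≋ - ev r p
ev-neg r p = Equiv⇒≋ λ w → ≡.trans (⟪ev⟫ r (- p) w) (≡.trans (⟪⊖⟫ p _)
  (≡.trans (≡.sym (cong ℤ.-_ (⟪ev⟫ r p w))) (≡.sym (⟪⊖⟫ (ev r p) w))))

ev-- : ∀ r p s → ev r (p - s) ≋ ev r p - ev r s
ev-- r p s = trans (ev-+ r p (- s)) (+-congˡ (ev-neg r s))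

ev-* : ∀ r p s → ev r (p * s) ≋ ev r p * ev r s
ev-* r p s = Equiv⇒≋ λ w → ≡.trans (left w) (≡.sym (right w))
  where
  mid : (ℕ → ℕ → ℤ) → ℤ
  mid w = ⟪ p ⟫ (λ i j → ⟪ s ⟫ (λ k l → ⟪ q ^ (i ℕ.+ k) * r ^ (j ℕ.+ l) ⟫ w))
  left : ∀ w → ⟪ ev r (p * s) ⟫ w ≡ mid w
  left w = ≡.trans (⟪ev⟫ r (p * s) w) (⟪⊗⟫ p s _)
  mono-* : ∀ i j k l → q ^ (i ℕ.+ k) * r ^ (j ℕ.+ l) ≋ (q ^ i * r ^ j) * (q ^ k * r ^ l)
  mono-* i j k l = trans (*-cong (^-homo-* q i k) (^-homo-* r j l))
    (solve 4 (λ x y z t → (x :* y) :* (z :* t) := (x :* z) :* (y :* t)) refl (q ^ i) (q ^ k) (r ^ j) (r ^ l))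
  right : ∀ w → ⟪ ev r p * ev r s ⟫ w ≡ mid w
  right w = ≡.trans (⟪⊗⟫ (ev r p) (ev r s) w) (≡.trans (⟪ev⟫ r p _) (⟪⟫-ext p (λ i j →
    ≡.trans (⟪⟫-ext (q ^ i * r ^ j) (λ x y → ⟪ev⟫ r s _))
    (≡.trans (⟪⟫-swap (q ^ i * r ^ j) s _)
    (⟪⟫-ext s (λ k l → ≡.trans (≡.sym (⟪⊗⟫ (q ^ i * r ^ j) (q ^ k * r ^ l) w)) (≡.sym (≋⇒Equiv (mono-* i j k l) w))))))))

ev-a-id : ∀ p → ev a p ≋ p
ev-a-id p = Equiv⇒≋ λ w → ≡.trans (⟪ev⟫ a p w) (⟪⟫-ext p (λ i j → ⟪q^a^⟫ i j w))

ev-afree : ∀ r {p} → AFree p → ev r p ≋ p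
ev-afree r {p} (supported {p'} s e) = trans (ev-cong r e) (trans (go p' s) (trans (ev-a-id p') (sym e)))
  where
  go : ∀ p → All (λ m → proj₂ (expo m) ≤ 0) p → ev r p ≋ ev a p
  go [] [] = refl
  go ((c , i , .0) ∷ p) (z≤n ∷ h) = +-congˡ (go p h)

afree-ev : ∀ {r} p → AFree r → AFree (ev r p)
afree-ev [] f = afree-κ 0ℤ
afree-ev ((c , i , j) ∷ p) f = supp-+ (afree-* (afree-κ c) (afree-* (afree-^ i afree-q) (afree-^ j f))) (afree-ev p f)

ev-κ : ∀ r c → ev r (κ c) ≋ κ c
ev-κ r c = ev-afree r (afree-κ c)

ev-a : ∀ r → ev r a ≋ r
ev-a r = Equiv⇒≋ λ w → ≡.trans (⟪ev⟫ r a w) (≡.trans (≡.sym (≋⇒Equiv (trans (*-identityʳ a) refl) _))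
  (≡.trans (⟪a^⟫ 1 (λ i j → ⟪ q ^ i * r ^ j ⟫ w)) (≋⇒Equiv (trans (*-identityˡ _) (*-identityʳ r)) w)))

^-diff : ∀ r j → AFree r → Σ Poly λ h → ADeg j h × a ^ suc j - r ^ suc j ≋ (a - r) * h
^-diff r zero f = 1# , afree-κ 1ℤ , solve 2 (λ x y → x :* con 1ℤ :- y :* con 1ℤ := (x :- y) :* con 1ℤ) refl a r
^-diff r (suc j) f with ^-diff r j f
... | h , d , e = a ^ suc j + r * h
  , supp-+ (adeg-^ (suc j)) (adeg-weaken (ℕₚ.n≤1+n j) (adeg-* f d))
  , trans (solve 4 (λ x y u v → x :* u :- y :* v := (x :- y) :* u :+ y :* (u :- v)) refl a r (a ^ suc j) (r ^ suc j))
    (trans (+-congˡ (*-congˡ e)) (solve 4 (λ x y u h → (x :- y) :* u :+ y :* ((x :- y) :* h) := (x :- y) :* (u :+ y :* h)) refl a r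
        (a ^ suc j) h))
  where
  adeg-^ : ∀ j → ADeg j (a ^ j)
  adeg-^ zero = afree-κ 1ℤ
  adeg-^ (suc j) = adeg-* adeg-a (adeg-^ j)

-- Division by a - r, which is monic in a. The degree bound on the quotient is what lets `roots⇒∣`
-- count roots.
factor : ∀ {r p} K → AFree r → ADeg (suc K) p → Σ Poly λ h → ADeg K h × p ≋ ev r p + (a - r) * h
factor {r} {p} K f (supported {p'} s e) with go p' s
  where
  go : ∀ p → All (λ m → proj₂ (expo m) ≤ suc K) p → Σ Poly λ h → ADeg K h × ev a p ≋ ev r p + (a - r) * h
  go [] [] = 0# , adeg-weaken z≤n (afree-κ 0ℤ) , solve 1 (λ x → con 0ℤ := con 0ℤ :+ x :* con 0ℤ) refl (a - r)
  go ((c , i , zero) ∷ p) (_ ∷ us) with go p us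
  ... | h , d , eq = h , d , trans (+-congˡ eq) (solve 3 (λ x y z → x :+ (y :+ z) := (x :+ y) :+ z) refl (κ c * (q ^ i * 1#)) (ev r p)
      ((a - r) * h))
  go ((c , i , suc j) ∷ p) (s≤s u ∷ us) with go p us | ^-diff r j f
  ... | h , d , eq | h' , d' , eq' = κ c * q ^ i * h' + h
    , supp-+ (adeg-weaken u (adeg-* (afree-* (afree-κ c) (afree-^ i afree-q)) d')) d
    , trans (+-cong (*-congˡ (*-congˡ step)) eq)
      (solve 7 (λ c x r j y h h' → c :* (x :* (j :+ r :* h')) :+ (y :+ r :* h) := c :* (x :* j) :+ y :+ r :* (c :* x :* h' :+ h)) refl
        (κ c) (q ^ i) (a - r) (r ^ suc j) (ev r p) h h')
    where
    step : a ^ suc j ≋ r ^ suc j + (a - r) * h'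
    step = trans (solve 2 (λ x y → x := y :+ (x :- y)) refl (a ^ suc j) (r ^ suc j)) (+-congˡ eq')
... | h , d , eq = h , d , trans e (trans (sym (ev-a-id p')) (trans eq (+-congʳ (ev-cong r (sym e)))))

adeg-bound : ∀ p → Σ ℕ λ K → ADeg (suc K) p
adeg-bound p with Weight.bound (λ _ j → j) (λ _ _ _ _ → ≡.refl) p
... | K , h = K , supported (All.map (λ x → ℕₚ.m≤n⇒m≤1+n (ℕₚ.<⇒≤ x)) h) refl

root⇒∣ : ∀ {r p} → AFree r → ev r p ≋ 0# → a - r ∣ p
root⇒∣ {r} {p} f e with adeg-bound p
... | K , d with factor K f d
...   | h , _ , eq = divides h (trans (sym (+-identityˡ _)) (trans (+-congʳ (sym e)) (sym eq)))

-- Not a zero divisor modulo Φ; over ℤ this takes the place of invertibility over ℚ.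
Regular : Poly → Poly → Set
Regular Φ f = ∀ {w} → Φ ∣ f * w → Φ ∣ w

-- Induction on the degree. Split off the last point R: at another point r i the values of p at r i
-- and at R differ by (r i - R) times the value of the quotient, so the quotient inherits the
-- remaining K + 1 roots modulo Φ.
roots⇒∣ : ∀ {Φ} (r : ℕ → Poly) → (∀ i → AFree (r i)) → AFree Φ → ∀ K p → ADeg K p →
  (∀ {i j} → i < j → j ≤ K → Regular Φ (r i - r j)) → (∀ i → i ≤ K → Φ ∣ ev (r i) p) → Φ ∣ p
roots⇒∣ r fr fΦ zero p d reg z = ∣-resp (ev-afree (r 0) d) (z 0 z≤n)
roots⇒∣ {Φ} r fr fΦ (suc K) p d reg z with factor K (fr (suc K)) d
... | h , dh , eq = ∣-resp (sym eq) (∣-+ (z (suc K) ℕₚ.≤-refl) (∣-*ˡ (a - r (suc K))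
    (roots⇒∣ r fr fΦ K h dh (λ x y → reg x (ℕₚ.m≤n⇒m≤1+n y)) roots-h)))
  where
  R = r (suc K)
  roots-h : ∀ i → i ≤ K → Φ ∣ ev (r i) h
  roots-h i le = reg (s≤s le) ℕₚ.≤-refl (∣-resp diff (∣-- (z i (ℕₚ.m≤n⇒m≤1+n le)) (z (suc K) ℕₚ.≤-refl)))
    where
    eval : ev (r i) p ≋ ev R p + (r i - R) * ev (r i) h
    eval = trans (ev-cong (r i) eq) (trans (ev-+ (r i) _ _) (+-cong (ev-afree (r i) (afree-ev p (fr (suc K))))
      (trans (ev-* (r i) _ h) (*-congʳ (trans (ev-- (r i) a R) (+-cong (ev-a (r i)) (-‿cong (ev-afree (r i) (fr (suc K))))))))))
    diff : ev (r i) p - ev R p ≋ (r i - R) * ev (r i) h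
    diff = trans (+-congʳ eval) (solve 2 (λ x y → x :+ y :- x := y) refl (ev R p) _)

-- Fractions

open Frac

-- Gives an unreduced fraction a manageable form x / y. The nonvanishing of `den F` is carried along
-- because inversion and `≐-unique` rely on it.
record _≐_∕_ (F : Frac) (x y : Poly) : Set where
  constructor rep
  field
    cross : num F * y ≋ x * den F
    den≢0 : NZ (den F)
open _≐_∕_

opaque
  unfolding κ

  ≐-poly : ∀ p → poly→frac p ≐ p ∕ 1#
  ≐-poly p = rep refl NZ-1

  ≐-1 : 1F ≐ 1# ∕ 1#
  ≐-1 = ≐-poly 1#

  ≐-q : qF ≐ q ∕ 1#
  ≐-q = ≐-poly q

  ≐-a : aF ≐ a ∕ 1#
  ≐-a = ≐-poly a

  0ₚ≋0 : 0ₚ ≋ 0#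
  0ₚ≋0 = Equiv⇒≋ λ w → ≡.sym (⟪0⟫ w)

  ≐-0 : 0F ≐ 0# ∕ 1#
  ≐-0 = rep (*-congʳ {1#} {0ₚ} {0#} 0ₚ≋0) NZ-1

  ≐-+ : ∀ {F G x y z t} → F ≐ x ∕ y → G ≐ z ∕ t → (F +F G) ≐ x * t + z * y ∕ (y * t)
  ≐-+ {F} {G} {x} {y} {z} {t} (rep e n) (rep e' n') = rep (begin
    (num F * den G + num G * den F) * (y * t)
      ≈⟨ solve 6 (λ a b c d y t → (a :* d :+ c :* b) :* (y :* t) := (a :* y) :* (d :* t) :+ (c :* t) :* (b :* y)) refl (num F) (den F)
          (num G) (den G) y t ⟩
    (num F * y) * (den G * t) + (num G * t) * (den F * y)
      ≈⟨ +-cong (*-congʳ e) (*-congʳ e') ⟩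
    (x * den F) * (den G * t) + (z * den G) * (den F * y)
      ≈⟨ solve 6 (λ x b z d y t → (x :* b) :* (d :* t) :+ (z :* d) :* (b :* y) := (x :* t :+ z :* y) :* (b :* d)) refl x (den F) z
          (den G) y t ⟩
    (x * t + z * y) * (den F * den G) ∎) (NZ-* n n')

  ≐-- : ∀ {F G x y z t} → F ≐ x ∕ y → G ≐ z ∕ t → (F -F G) ≐ x * t - z * y ∕ (y * t)
  ≐-- {F} {G} {x} {y} {z} {t} (rep e n) (rep e' n') = rep (begin
    (num F * den G - num G * den F) * (y * t)
      ≈⟨ solve 6 (λ a b c d y t → (a :* d :- c :* b) :* (y :* t) := (a :* y) :* (d :* t) :- (c :* t) :* (b :* y)) refl (num F) (den F)
          (num G) (den G) y t ⟩
    (num F * y) * (den G * t) - (num G * t) * (den F * y)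
      ≈⟨ +-cong (*-congʳ e) (-‿cong (*-congʳ e')) ⟩
    (x * den F) * (den G * t) - (z * den G) * (den F * y)
      ≈⟨ solve 6 (λ x b z d y t → (x :* b) :* (d :* t) :- (z :* d) :* (b :* y) := (x :* t :- z :* y) :* (b :* d)) refl x (den F) z
          (den G) y t ⟩
    (x * t - z * y) * (den F * den G) ∎) (NZ-* n n')

  ≐-* : ∀ {F G x y z t} → F ≐ x ∕ y → G ≐ z ∕ t → (F *F G) ≐ x * z ∕ (y * t)
  ≐-* {F} {G} {x} {y} {z} {t} (rep e n) (rep e' n') = rep (begin
    (num F * num G) * (y * t)
      ≈⟨ solve 4 (λ a c y t → (a :* c) :* (y :* t) := (a :* y) :* (c :* t)) refl (num F) (num G) y t ⟩
    (num F * y) * (num G * t) ≈⟨ *-cong e e' ⟩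
    (x * den F) * (z * den G)
      ≈⟨ solve 4 (λ a c y t → (a :* c) :* (y :* t) := (a :* y) :* (c :* t)) refl x (den F) z (den G) ⟩
    (x * z) * (den F * den G) ∎) (NZ-* n n')

  ≈F⇒≋ : ∀ {Φ F} → poly→frac Φ ≈F F → Φ * den F ≋ num F
  ≈F⇒≋ {Φ} {F} h = trans (mk h) (*-identityʳ (num F))

≐-inv : ∀ {F x y} → F ≐ x ∕ y → NZ x → NZ y → invF F ≐ y ∕ x
≐-inv {F} {x} {y} (rep e n) nx ny = rep (trans (*-comm (den F) x) (trans (sym e) (*-comm (num F) y)))
  (λ z → NZ-* nx n (trans (sym e) (trans (*-congʳ z) (zeroˡ y))))

≐-÷ : ∀ {F G x y z t} → F ≐ x ∕ y → G ≐ z ∕ t → NZ z → NZ t → (F ÷F G) ≐ x * t ∕ (y * z)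
≐-÷ r s nz nt = ≐-* r (≐-inv s nz nt)

≐-resp : ∀ {F x y x' y'} → x ≋ x' → y ≋ y' → F ≐ x ∕ y → F ≐ x' ∕ y'
≐-resp e f (rep c n) = rep (trans (*-congˡ (sym f)) (trans c (*-congʳ e))) n

≐-cancel : ∀ {F x y} c → NZ c → F ≐ c * x ∕ (c * y) → F ≐ x ∕ y
≐-cancel {F} {x} {y} c nc (rep e n) = rep (*-cancel nc (begin
  c * (num F * y) ≈⟨ solve 3 (λ c f y → c :* (f :* y) := f :* (c :* y)) refl c (num F) y ⟩
  num F * (c * y) ≈⟨ e ⟩
  c * x * den F   ≈⟨ *-assoc c x (den F) ⟩
  c * (x * den F) ∎)) n

≐-*₁ : ∀ {F G x z} → F ≐ x ∕ 1# → G ≐ z ∕ 1# → (F *F G) ≐ x * z ∕ 1#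
≐-*₁ r s = ≐-resp refl (*-identityˡ 1#) (≐-* r s)

≐--₁ : ∀ {F G x z} → F ≐ x ∕ 1# → G ≐ z ∕ 1# → (F -F G) ≐ x - z ∕ 1#
≐--₁ r s = ≐-resp (+-cong (*-identityʳ _) (-‿cong (*-identityʳ _))) (*-identityˡ 1#) (≐-- r s)

≐-÷₁ : ∀ {F G x z} → F ≐ x ∕ 1# → G ≐ z ∕ 1# → NZ z → (F ÷F G) ≐ x ∕ z
≐-÷₁ r s nz = ≐-resp (*-identityʳ _) (*-identityˡ _) (≐-÷ r s nz NZ-1)

≐-pow : ∀ {F x} k → F ≐ x ∕ 1# → powF F k ≐ x ^ k ∕ 1#
≐-pow zero r = ≐-1
≐-pow {x = x} (suc k) r = ≐-resp (*-comm (x ^ k) x) refl (≐-*₁ (≐-pow k r) r)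

≐-q^ : ∀ k → powF qF k ≐ q ^ k ∕ 1#
≐-q^ k = ≐-pow k ≐-q

≐-unique : ∀ {F x} → F ≐ x ∕ 1# → ∀ {Φ} → poly→frac Φ ≈F F → Φ ≋ x
≐-unique {F} {x} (rep e n) {Φ} h = *-cancel n (begin
  den F * Φ  ≈⟨ *-comm (den F) Φ ⟩
  Φ * den F  ≈⟨ ≈F⇒≋ h ⟩
  num F      ≈⟨ *-identityʳ (num F) ⟨
  num F * 1# ≈⟨ e ⟩
  x * den F  ≈⟨ *-comm x (den F) ⟩
  den F * x  ∎)

∏ : ℕ → (ℕ → Poly) → Poly
∏ zero f = 1#
∏ (suc k) f = ∏ k f * f k

∏-cong : ∀ k {f g : ℕ → Poly} → (∀ i → f i ≋ g i) → ∏ k f ≋ ∏ k g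
∏-cong zero h = refl
∏-cong (suc k) h = *-cong (∏-cong k h) (h k)

NZ-∏ : ∀ k {f : ℕ → Poly} → (∀ i → NZ (f i)) → NZ (∏ k f)
NZ-∏ zero h = NZ-1
NZ-∏ (suc k) h = NZ-* (NZ-∏ k h) (h k)

≐-∏ : ∀ k {f : ℕ → Frac} {x y : ℕ → Poly} → (∀ i → f i ≐ x i ∕ y i) → prodF k f ≐ ∏ k x ∕ ∏ k y
≐-∏ zero h = ≐-1
≐-∏ (suc k) h = ≐-* (≐-∏ k h) (h k)

-- Cyclotomic polynomials

-- Comaximality over ℚ.
infix 4 _⊥ₚ_
record _⊥ₚ_ (f g : Poly) : Set where
  constructor comax
  field
    {c} : ℤ
    x y : Poly
    c≢0 : c ≢ 0ℤ
    bezout : x * f + y * g ≋ κ c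

⊥-sym : ∀ {f g} → f ⊥ₚ g → g ⊥ₚ f
⊥-sym {f} {g} (comax x y c≢0 e) = comax y x c≢0 (trans (⊕-comm (y * g) (x * f)) e)

≢0-* : ∀ {c d} → c ≢ 0ℤ → d ≢ 0ℤ → c ℤ.* d ≢ 0ℤ
≢0-* {c} cn dn e with ℤₚ.i*j≡0⇒i≡0∨j≡0 c e
... | inj₁ z = cn z
... | inj₂ z = dn z

⊥-* : ∀ {f g h} → f ⊥ₚ g → f ⊥ₚ h → f ⊥ₚ g * h
⊥-* {f} {g} {h} (comax {c} x y c≢0 e) (comax {d} z t d≢0 e') = comax (x * z * f + x * t * h + y * z * g) (y * t) (≢0-* c≢0 d≢0)
  (trans (solve 7 (λ f g h x y z t → (x :* z :* f :+ x :* t :* h :+ y :* z :* g) :* f :+ y :* t :* (g :* h)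
      := (x :* f :+ y :* g) :* (z :* f :+ t :* h)) refl f g h x y z t)
    (trans (*-cong e e') (sym (κ-* c d))))

⊥-∣ : ∀ {f g h} → f ⊥ₚ g → h ∣ g → f ⊥ₚ h
⊥-∣ {f} {g} {h} (comax x y c≢0 e) (divides k d) = comax x (y * k) c≢0
  (trans (+-congˡ (trans (solve 3 (λ y k h → (y :* k) :* h := y :* (h :* k)) refl y k h) (*-congˡ d))) e)

⊥-1 : ∀ {f} → f ⊥ₚ 1#
⊥-1 {f} = comax 0# 1# (λ ()) (solve 1 (λ f → con 0ℤ :* f :+ con 1ℤ :* con 1ℤ := con 1ℤ) refl f)

⊥-^ : ∀ {f g} k → f ⊥ₚ g → f ⊥ₚ g ^ k
⊥-^ zero _ = ⊥-1
⊥-^ (suc k) h = ⊥-* h (⊥-^ k h)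

Q : ℕ → Poly
Q m = q ^ m - 1#

geo : Poly → ℕ → Poly
geo x zero = 0#
geo x (suc k) = 1# + x * geo x k

geo-sum : ∀ x k → (x - 1#) * geo x k ≋ x ^ k - 1#
geo-sum x zero = solve 1 (λ x → (x :- con 1ℤ) :* con 0ℤ := con 1ℤ :- con 1ℤ) refl x
geo-sum x (suc k) = trans (solve 2 (λ x g → (x :- con 1ℤ) :* (con 1ℤ :+ x :* g) := (x :- con 1ℤ) :+ x :* ((x :- con 1ℤ) :* g)) refl x
    (geo x k))
  (trans (+-congˡ (*-congˡ (geo-sum x k))) (solve 2 (λ x y → (x :- con 1ℤ) :+ x :* (y :- con 1ℤ) := x :* y :- con 1ℤ) refl x (x ^ k)))

geo-mod : ∀ x k → Σ Poly λ h → geo x k ≋ κ (ℤ.+ k) + (x - 1#) * h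
geo-mod x zero = 0# , solve 1 (λ x → con 0ℤ := con 0ℤ :+ (x :- con 1ℤ) :* con 0ℤ) refl x
geo-mod x (suc k) with geo-mod x k
... | h , e = geo x k + h , trans (solve 2 (λ x g → con 1ℤ :+ x :* g := con 1ℤ :+ (g :+ (x :- con 1ℤ) :* g)) refl x (geo x k))
  (trans (+-congˡ (+-congʳ e)) (trans
    (solve 4 (λ c x g h → con 1ℤ :+ (c :+ (x :- con 1ℤ) :* h :+ (x :- con 1ℤ) :* g) := (con 1ℤ :+ c) :+ (x :- con 1ℤ) :* (g :+ h)) refl
        (κ (ℤ.+ k)) x (geo x k) h)
    (+-congʳ (sym (κ-+ 1ℤ (ℤ.+ k))))))

Q-* : ∀ k d → Q d * geo (q ^ d) k ≋ Q (k ℕ.* d)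
Q-* k d = trans (geo-sum (q ^ d) k) (+-congʳ (trans (^-assocʳ q d k) (reflexive (cong (q ^_) (ℕₚ.*-comm d k)))))

Q-∣ : ∀ {d n} → d ∣ℕ n → Q d ∣ Q n
Q-∣ {d} (ND.divides k ≡.refl) = divides (geo (q ^ d) k) (Q-* k d)

NZ-Q : ∀ {m} → 1 ≤ m → NZ (Q m)
NZ-Q (s≤s {n = m} _) = NZ-q^-q^ {suc m} {0} (λ ())

Q-+ : ∀ g s → Q (g ℕ.+ s) - q ^ g * Q s ≋ Q g
Q-+ g s = trans (+-congʳ (+-congʳ (^-homo-* q g s))) (solve 2 (λ x y → (x :* y :- con 1ℤ) :- x :* (y :- con 1ℤ) := x :- con 1ℤ) refl
    (q ^ g) (q ^ s))

-- If g + y m = x j, then q^g - 1 = (q^(xj) - 1) - q^g (q^(ym) - 1). With natural numbers as Bézout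
-- coefficients either side may be the larger one, hence two cases.
Q-gcd : ∀ j m → Σ Poly λ X → Σ Poly λ Y → X * Q j + Y * Q m ≋ Q (gcd j m)
Q-gcd j m with Bézout.identity (gcd-GCD j m)
... | Bézout.+- x y eq = geo (q ^ j) x , - (q ^ gcd j m * geo (q ^ m) y)
    , trans (solve 5 (λ u j v g m → u :* j :+ :- (g :* v) :* m := j :* u :- g :* (m :* v)) refl (geo (q ^ j) x) (Q j) (geo (q ^ m) y)
        (q ^ gcd j m) (Q m))
      (trans (+-cong (trans (Q-* x j) (reflexive (cong Q (≡.sym eq)))) (-‿cong (*-congˡ (Q-* y m)))) (Q-+ (gcd j m) (y ℕ.* m)))
... | Bézout.-+ x y eq = - (q ^ gcd j m * geo (q ^ j) x) , geo (q ^ m) y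
    , trans (solve 5 (λ u j v g m → :- (g :* u) :* j :+ v :* m := m :* v :- g :* (j :* u)) refl (geo (q ^ j) x) (Q j) (geo (q ^ m) y)
        (q ^ gcd j m) (Q m))
      (trans (+-cong (trans (Q-* y m) (reflexive (cong Q (≡.sym eq)))) (-‿cong (*-congˡ (Q-* x j)))) (Q-+ (gcd j m) (x ℕ.* j)))

-- All that is used about Φ_m.
record CyclotomicLike (m : ℕ) (f : Poly) : Set where
  constructor cyclotomicLike
  field
    ∣Q : f ∣ Q m
    ⊥Q : ∀ {j} → ¬ m ∣ℕ j → f ⊥ₚ Q j
open CyclotomicLike

-- For m ∤ j the gcd g of j and m is a proper divisor of m, and q^g - 1 is a combination of q^j - 1
-- and q^m - 1, the latter being a multiple of f.
cyclotomicLike-from-proper : ∀ {m f} → 1 ≤ m → f ∣ Q m → (∀ {g} → g ∣ℕ m → 1 ≤ g → g < m → f ⊥ₚ Q g) → CyclotomicLike m f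
cyclotomicLike-from-proper {m} {f} 1≤m d@(divides h fh) prop = cyclotomicLike d λ {j} m∤j → step j m∤j (Q-gcd j m)
    (prop (gcd[m,n]∣n j m)
      (ℕₚ.n≢0⇒n>0 (λ z → ℕₚ.<-irrefl (≡.sym (ND.0∣⇒≡0 (subst (_∣ℕ m) z (gcd[m,n]∣n j m)))) 1≤m))
      (ℕₚ.≤∧≢⇒< (ND.∣⇒≤ ⦃ ℕ.>-nonZero 1≤m ⦄ (gcd[m,n]∣n j m)) (λ e → m∤j (subst (_∣ℕ j) e (gcd[m,n]∣m j m)))))
  where
  step : ∀ j → ¬ m ∣ℕ j → (Σ Poly λ X → Σ Poly λ Y → X * Q j + Y * Q m ≋ Q (gcd j m)) → f ⊥ₚ Q (gcd j m) → f ⊥ₚ Q j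
  step j m∤j (X , Y , e) (comax x y c≢0 b) = comax (x + y * Y * h) (y * X) c≢0
    (trans (solve 7 (λ x y Y h f X j → (x :+ y :* Y :* h) :* f :+ y :* X :* j := x :* f :+ y :* (X :* j :+ Y :* (f :* h))) refl x y Y h f X
        (Q j))
      (trans (+-congˡ (*-congˡ (trans (+-congˡ (*-congˡ fh)) e))) b))

IntRegular : Poly → Set
IntRegular f = ∀ {c g} → κ c ∣ f * g → κ c ∣ g

total-degree-+ : ∀ i j k l → i ℕ.+ k ℕ.+ (j ℕ.+ l) ≡ i ℕ.+ j ℕ.+ (k ℕ.+ l)
total-degree-+ = NatSolver.solve-∀

module Total = Weight (λ i j → i ℕ.+ j) total-degree-+

-- Multiplying by the cofactor of f replaces f by 1 - q^n up to sign, and this is cancelled by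
-- truncation in total degree. It does the work of Gauss's lemma on contents.
intRegular : ∀ {f n} → 1 ≤ n → f ∣ Q n → IntRegular f
intRegular {f} {suc n} _ (divides h e) {c} {g} d = Total.∣-cancel-1-z {z = q ^ suc n} (supp-κ c ≡.refl) high
    (∣-resp (trans (solve 3 (λ f g h → :- (h :* (f :* g)) := :- (f :* h) :* g) refl f g h)
      (trans (*-congʳ (-‿cong e)) (solve 2 (λ x g → :- (x :- con 1ℤ) :* g := (con 1ℤ :- x) :* g) refl (q ^ suc n) g)))
      (∣-neg (∣-*ˡ h d)))
  where
  high : Total.High 1 (q ^ suc n)
  high = supp-* (λ {i} {j} {k} {l} x _ → ℕₚ.≤-trans x (ℕₚ.+-mono-≤ (ℕₚ.m≤m+n i k) (ℕₚ.m≤m+n j l)))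
    (supp-q {λ e → 1 ≤ proj₁ e ℕ.+ proj₂ e} (s≤s z≤n)) (Total.high-^ {q} n (supp-q (s≤s z≤n)))

-- The Bézout identity gives c w = Φ (x w + y g). The integer c then divides the second factor by
-- `intRegular` and can be cancelled.
⊥⇒regular : ∀ {Φ f n} → 1 ≤ n → Φ ∣ Q n → Φ ⊥ₚ f → Regular Φ f
⊥⇒regular {Φ} {f} 1≤n d (comax {c} x y c≢0 e) {w} (divides g eg) = finish (intRegular 1≤n d (divides w eqn))
  where
  eqn : κ c * w ≋ Φ * (x * w + y * g)
  eqn = trans (*-congʳ (sym e)) (trans (solve 5 (λ x Φ y f w → (x :* Φ :+ y :* f) :* w := Φ :* (x :* w) :+ y :* (f :* w)) refl x Φ y f w)
    (trans (+-congˡ (*-congˡ (sym eg))) (solve 4 (λ Φ u y g → Φ :* u :+ y :* (Φ :* g) := Φ :* (u :+ y :* g)) refl Φ (x * w) y g)))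
  finish : κ c ∣ x * w + y * g → Φ ∣ w
  finish (divides g' eg') = divides g' (*κ-cancel c≢0 (begin
    κ c * (Φ * g')      ≈⟨ solve 3 (λ c Φ g → c :* (Φ :* g) := Φ :* (c :* g)) refl (κ c) Φ g' ⟩
    Φ * (κ c * g')      ≈⟨ *-congˡ eg' ⟩
    Φ * (x * w + y * g) ≈⟨ eqn ⟨
    κ c * w             ∎))

-- Existence of the cyclotomic polynomials

pick : ∀ {P : Set} → Dec P → Poly → Poly
pick (yes _) f = f
pick (no _) f = 1#

pick-cong : ∀ {P : Set} (d : Dec P) {f g} → f ≋ g → pick d f ≋ pick d g
pick-cong (yes _) e = e
pick-cong (no _) e = refl

-- The cutoff m is separate from n, so that one can induct on it and so that m = n - 1 leaves
-- exactly the proper divisors.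
divProd : (ℕ → Poly) → ℕ → ℕ → Poly
divProd φ n zero = 1#
divProd φ n (suc m) = divProd φ n m * pick (suc m ∣ℕ? n) (φ (suc m))

divProd-cong : ∀ {φ ψ} n m → (∀ i → i ≤ m → φ i ≋ ψ i) → divProd φ n m ≋ divProd ψ n m
divProd-cong n zero h = refl
divProd-cong n (suc m) h = *-cong (divProd-cong n m (λ i le → h i (ℕₚ.m≤n⇒m≤1+n le))) (pick-cong (suc m ∣ℕ? n) (h (suc m) ℕₚ.≤-refl))

divProd-sub : ∀ φ {g n} m → g ∣ℕ n → divProd φ g m ∣ divProd φ n m
divProd-sub φ zero d = ∣-refl
divProd-sub φ {g} {n} (suc m) d with divProd-sub φ {g} {n} m d | suc m ∣ℕ? g | suc m ∣ℕ? n
... | divides r e | yes _ | yes _ = divides r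
    (trans (solve 3 (λ x y z → (x :* y) :* z := (x :* z) :* y) refl (divProd φ g m) (φ (suc m)) r) (*-congʳ e))
... | divides r e | yes x | no y = ⊥-elim (y (ND.∣-trans x d))
... | divides r e | no _ | yes _ = divides (r * φ (suc m))
    (trans (solve 3 (λ x y z → (x :* con 1ℤ) :* (y :* z) := (x :* y) :* z) refl (divProd φ g m) r (φ (suc m))) (*-congʳ e))
... | divides r e | no _ | no _ = divides r (trans (solve 2 (λ x y → (x :* con 1ℤ) :* y := (x :* y) :* con 1ℤ) refl (divProd φ g m) r)
    (*-congʳ e))

divProd-stable : ∀ φ g k → 1 ≤ g → divProd φ g (k ℕ.+ g) ≋ divProd φ g g
divProd-stable φ g zero _ = refl
divProd-stable φ g (suc k) 1≤g with suc (k ℕ.+ g) ∣ℕ? g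
... | yes d = ⊥-elim (ℕₚ.<-irrefl ≡.refl (ℕₚ.≤-trans (s≤s (ℕₚ.m≤n+m g k)) (ND.∣⇒≤ ⦃ ℕ.>-nonZero 1≤g ⦄ d)))
... | no _ = trans (*-identityʳ _) (divProd-stable φ g k 1≤g)

divProd-last : ∀ φ m → divProd φ (suc m) (suc m) ≋ divProd φ (suc m) m * φ (suc m)
divProd-last φ m with suc m ∣ℕ? suc m
... | yes _ = refl
... | no d = ⊥-elim (d ND.∣-refl)

-- These equations force φ 1, ..., φ B to be the cyclotomic polynomials. The bound is there because
-- they are constructed one after the other.
Family : ℕ → (ℕ → Poly) → Set
Family B φ = ∀ m → 1 ≤ m → m ≤ B → divProd φ m m ≋ Q m

family-weaken : ∀ {B C φ} → B ≤ C → Family C φ → Family B φ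
family-weaken h F m x y = F m x (ℕₚ.≤-trans y h)

-- If g ∣ m properly, then f divides (q^m - 1) / (q^g - 1) = 1 + q^g + … ≡ m / g modulo q^g - 1.
quotient-cyclotomicLike : ∀ {φ f} m → Family m φ → divProd φ (suc m) m * f ≋ Q (suc m) → CyclotomicLike (suc m) f
quotient-cyclotomicLike {φ} {f} m F e = cyclotomicLike-from-proper (s≤s z≤n) (divides (divProd φ (suc m) m) (trans (*-comm f _) e)) proper
  where
  proper : ∀ {g} → g ∣ℕ suc m → 1 ≤ g → g < suc m → f ⊥ₚ Q g
  proper {g} g∣m@(ND.divides k eqk) 1≤g (s≤s g≤m) = build (divProd-sub φ m g∣m) (geo-mod (q ^ g) k)
    where
    -- No divisor of g exceeds g, so raising the cutoff from g to m changes nothing.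
    P≋Q : divProd φ g m ≋ Q g
    P≋Q = trans (reflexive (cong (divProd φ g) (≡.sym (ℕₚ.m∸n+n≡m g≤m)))) (trans (divProd-stable φ g (m ∸ g) 1≤g) (F g 1≤g g≤m))
    k≢0 : ℤ.+ k ≢ 0ℤ
    k≢0 ≡.refl = ℕₚ.1+n≢0 eqk
    build : divProd φ g m ∣ divProd φ (suc m) m → (Σ Poly λ h → geo (q ^ g) k ≋ κ (ℤ.+ k) + (q ^ g - 1#) * h) → f ⊥ₚ Q g
    build (divides r er) (h , eh) = comax r (- h) k≢0 (begin
        r * f + - h * Q g                       ≈⟨ +-congʳ (*-cancel (NZ-Q 1≤g) rf) ⟩
        geo (q ^ g) k + - h * Q g               ≈⟨ +-congʳ eh ⟩
        κ (ℤ.+ k) + Q g * h + - h * Q g         ≈⟨ solve 3 (λ c x h → c :+ x :* h :+ :- h :* x := c) refl (κ (ℤ.+ k)) (Q g) h ⟩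
        κ (ℤ.+ k)                               ∎)
      where
      rf : Q g * (r * f) ≋ Q g * geo (q ^ g) k
      rf = begin
        Q g * (r * f)            ≈⟨ *-assoc (Q g) r f ⟨
        Q g * r * f              ≈⟨ *-congʳ (*-congʳ P≋Q) ⟨
        divProd φ g m * r * f    ≈⟨ *-congʳ er ⟩
        divProd φ (suc m) m * f  ≈⟨ e ⟩
        Q (suc m)                ≈⟨ reflexive (cong Q eqk) ⟩
        Q (k ℕ.* g)              ≈⟨ Q-* k g ⟨
        Q g * geo (q ^ g) k      ∎

family-cyclotomicLike : ∀ {φ B} m → suc m ≤ B → Family B φ → CyclotomicLike (suc m) (φ (suc m))
family-cyclotomicLike {φ} m le F = quotient-cyclotomicLike m (family-weaken (ℕₚ.<⇒≤ le) F)
    (trans (sym (divProd-last φ m)) (F (suc m) (s≤s z≤n) le))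

family-⊥ : ∀ {φ B} i j → i < j → suc j ≤ B → Family B φ → φ (suc j) ⊥ₚ φ (suc i)
family-⊥ i j i<j le F = ⊥-∣ (⊥Q (family-cyclotomicLike j le F) (λ d → ℕₚ.<⇒≱ (s≤s i<j) (ND.∣⇒≤ d)))
    (∣Q (family-cyclotomicLike i (ℕₚ.≤-trans (s≤s (ℕₚ.<⇒≤ i<j)) le) F))

divProd-⊥ : ∀ {φ f} n k → (∀ i → i < k → f ⊥ₚ φ (suc i)) → f ⊥ₚ divProd φ n k
divProd-⊥ n zero h = ⊥-1
divProd-⊥ {φ} n (suc k) h with suc k ∣ℕ? n
... | yes _ = ⊥-* (divProd-⊥ n k (λ i lt → h i (ℕₚ.m≤n⇒m≤1+n lt))) (h k ℕₚ.≤-refl)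
... | no _ = ⊥-* (divProd-⊥ n k (λ i lt → h i (ℕₚ.m≤n⇒m≤1+n lt))) ⊥-1

divProd-intRegular : ∀ {φ B} n k → k ≤ B → Family B φ → IntRegular (divProd φ n k)
divProd-intRegular n zero le F d = ∣-resp (*-identityˡ _) d
divProd-intRegular {φ} n (suc k) le F d with suc k ∣ℕ? n
... | yes _ = intRegular {n = suc k} (s≤s z≤n) (∣Q (family-cyclotomicLike k le F))
    (divProd-intRegular n k (ℕₚ.<⇒≤ le) F (∣-resp (*-assoc (divProd φ n k) (φ (suc k)) _) d))
... | no _ = divProd-intRegular n k (ℕₚ.<⇒≤ le) F (∣-resp (*-congʳ (*-identityʳ _)) d)

-- All that comaximality over ℚ can deliver for a product; the integer is removed once, in
-- `divProd-∣`.
∣-κ : Poly → Poly → Set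
∣-κ f g = Σ ℤ λ c → c ≢ 0ℤ × f ∣ κ c * g

⊥-*-∣ : ∀ {f g X} → f ⊥ₚ g → f ∣ X → ∣-κ g X → ∣-κ (g * f) X
⊥-*-∣ {f} {g} {X} (comax {c} x y c≢0 e) (divides v ev) (d , d≢0 , divides u eu) = c ℤ.* d , ≢0-* c≢0 d≢0 , divides (x * u + y * κ d * v)
    (begin
  g * f * (x * u + y * κ d * v)           ≈⟨ solve 7 (λ f g x u y d v → g :* f :* (x :* u :+ y :* d :* v) := x :* f :*
      (g :* u) :+ y :* g :* (d :* (f :* v))) refl f g x u y (κ d) v ⟩
  x * f * (g * u) + y * g * (κ d * (f * v)) ≈⟨ +-cong (*-congˡ eu) (*-congˡ (*-congˡ ev)) ⟩
  x * f * (κ d * X) + y * g * (κ d * X)   ≈⟨ solve 6 (λ f g x y d X → x :* f :* (d :* X) :+ y :* g :* (d :* X) := (x :* f :+ y :* g) :*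
      (d :* X)) refl f g x y (κ d) X ⟩
  (x * f + y * g) * (κ d * X)             ≈⟨ *-congʳ e ⟩
  κ c * (κ d * X)                         ≈⟨ *-assoc (κ c) (κ d) X ⟨
  κ c * κ d * X                           ≈⟨ *-congʳ (κ-* c d) ⟨
  κ (c ℤ.* d) * X                         ∎)

divProd-∣-κ : ∀ {φ B} n k → k ≤ B → Family B φ → ∣-κ (divProd φ n k) (Q n)
divProd-∣-κ n zero le F = 1ℤ , (λ ()) , divides (κ 1ℤ * Q n) (*-identityˡ _)
divProd-∣-κ {φ} n (suc k) le F with suc k ∣ℕ? n
... | yes d = ⊥-*-∣ (divProd-⊥ n k (λ i lt → family-⊥ i k lt le F)) (∣-trans (∣Q (family-cyclotomicLike k le F)) (Q-∣ d))
    (divProd-∣-κ n k (ℕₚ.<⇒≤ le) F)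
... | no _ with divProd-∣-κ {φ} n k (ℕₚ.<⇒≤ le) F
...   | c , c≢0 , d = c , c≢0 , ∣-respˡ (sym (*-identityʳ _)) d

-- The φ (d) are pairwise comaximal over ℚ and each divides q^n - 1. For k = n - 1 this makes the
-- division that defines Φ_n exact over ℤ.
divProd-∣ : ∀ {φ B} n k → k ≤ B → Family B φ → divProd φ n k ∣ Q n
divProd-∣ {φ} n k le F = remove (divProd-∣-κ {φ} n k le F)
  where
  remove : ∣-κ (divProd φ n k) (Q n) → divProd φ n k ∣ Q n
  remove (c , c≢0 , divides u eu) = finish (divProd-intRegular n k le F (divides (Q n) (sym eu)))
    where
    finish : κ c ∣ u → divProd φ n k ∣ Q n
    finish (divides u' e') = divides u'
        (*κ-cancel c≢0 (trans (solve 3 (λ c x u → c :* (x :* u) := x :* (c :* u)) refl (κ c) (divProd φ n k) u') (trans (*-congˡ e') eu)))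

update : (ℕ → Poly) → ℕ → Poly → ℕ → Poly
update φ m f i with i ℕ.≟ m
... | yes _ = f
... | no _ = φ i

update-same : ∀ φ m f → update φ m f m ≡ f
update-same φ m f with m ℕ.≟ m
... | yes _ = ≡.refl
... | no ne = ⊥-elim (ne ≡.refl)

update-other : ∀ φ {m} f {i} → i ≢ m → update φ m f i ≡ φ i
update-other φ {m} f {i} ne with i ℕ.≟ m
... | yes e = ⊥-elim (ne e)
... | no _ = ≡.refl

cyclotomicFamily : ∀ B → Σ (ℕ → Poly) (Family B)
cyclotomicFamily zero = (λ _ → 1#) , λ m 1≤m m≤0 → ⊥-elim (ℕₚ.<-irrefl ≡.refl (ℕₚ.≤-trans 1≤m m≤0))
cyclotomicFamily (suc B) with cyclotomicFamily B
... | φ , F = extend (divProd-∣ (suc B) B ℕₚ.≤-refl F)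
  where
  extend : divProd φ (suc B) B ∣ Q (suc B) → Σ (ℕ → Poly) (Family (suc B))
  extend (divides f e) = φ' , F'
    where
    φ' = update φ (suc B) f
    agree : ∀ n m → m ≤ B → divProd φ' n m ≋ divProd φ n m
    agree n m le = divProd-cong n m (λ i i≤m → reflexive (update-other φ f (ℕₚ.<⇒≢ (s≤s (ℕₚ.≤-trans i≤m le)))))
    F' : Family (suc B) φ'
    F' m 1≤m le with ℕₚ.m≤n⇒m<n∨m≡n le
    ... | inj₁ (s≤s m≤B) = trans (agree m m m≤B) (F m 1≤m m≤B)
    ... | inj₂ ≡.refl = trans (divProd-last φ' B) (trans (*-cong (agree (suc B) B ℕₚ.≤-refl) (reflexive (update-same φ (suc B) f))) e)

-- Agreement with the recursive definition of Φ_n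

prodP : List Poly → Poly
prodP = foldr _*_ 1#

prodP-++ : ∀ fs gs → prodP (fs ++ gs) ≋ prodP fs * prodP gs
prodP-++ [] gs = sym (*-identityˡ _)
prodP-++ (f ∷ fs) gs = trans (*-congˡ (prodP-++ fs gs)) (sym (*-assoc f _ _))

divisors : ℕ → ℕ → List ℕ
divisors n k = filter (_∣ℕ? n) (map suc (upTo k))

divisors-suc : ∀ n k → divisors n (suc k) ≡ divisors n k ++ filter (_∣ℕ? n) (suc k ∷ [])
divisors-suc n k = ≡.trans (cong (λ l → filter (_∣ℕ? n) (map suc l)) (≡.sym (Listₚ.upTo-∷ʳ k)))
  (≡.trans (cong (filter (_∣ℕ? n)) (Listₚ.map-++ suc (upTo k) (k ∷ []))) (Listₚ.filter-++ (_∣ℕ? n) (map suc (upTo k)) (suc k ∷ [])))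

prodP-divisors : ∀ φ n k → prodP (map φ (divisors n k)) ≋ divProd φ n k
prodP-divisors φ n zero = refl
prodP-divisors φ n (suc k) = trans (reflexive (cong (λ l → prodP (map φ l)) (divisors-suc n k)))
  (trans (reflexive (cong prodP (Listₚ.map-++ φ (divisors n k) _)))
  (trans (prodP-++ (map φ (divisors n k)) _) (*-cong (prodP-divisors φ n k) (single (suc k ∣ℕ? n)))))
  where
  single : (d : Dec (suc k ∣ℕ n)) → prodP (map φ (filter (_∣ℕ? n) (suc k ∷ []))) ≋ pick d (φ (suc k))
  single (yes d) = trans (reflexive (cong (λ l → prodP (map φ l)) (Listₚ.filter-accept (_∣ℕ? n) d))) (*-identityʳ _)
  single (no d) = reflexive (cong (λ l → prodP (map φ l)) (Listₚ.filter-reject (_∣ℕ? n) d))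

divisors-range : ∀ n k → All (λ d → 1 ≤ d × d ≤ k) (divisors n k)
divisors-range n zero = []
divisors-range n (suc k) = subst (All _) (≡.sym (divisors-suc n k))
  (Allₚ.++⁺ (All.map (λ { (x , y) → x , ℕₚ.m≤n⇒m≤1+n y }) (divisors-range n k)) (Allₚ.filter⁺ (_∣ℕ? n) ((s≤s z≤n , ℕₚ.≤-refl) ∷ [])))

≐-prodList : ∀ {f : ℕ → Frac} {φ} ds → All (λ d → f d ≐ φ d ∕ 1#) ds → prodList (map f ds) ≐ prodP (map φ ds) ∕ 1#
≐-prodList [] [] = ≐-1
≐-prodList (d ∷ ds) (r ∷ rs) = ≐-*₁ r (≐-prodList ds rs)

divProd-NZ : ∀ {φ} m → Family m φ → NZ (divProd φ (suc m) m)
divProd-NZ m F = NZ-∣ (divProd-∣ (suc m) m ℕₚ.≤-refl F) (NZ-Q {suc m} (s≤s z≤n))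

-- Numerator q^m - 1 and denominator share the product over the proper divisors of m, and φ m
-- remains. The recursive calls go to proper divisors, so fuel m is enough.
≐-cycAux : ∀ {φ B} fuel m → Family B φ → 1 ≤ m → m ≤ fuel → m ≤ B → cycAux fuel m ≐ φ m ∕ 1#
≐-cycAux zero m F 1≤m m≤0 _ = ⊥-elim (ℕₚ.<-irrefl ≡.refl (ℕₚ.≤-trans 1≤m m≤0))
≐-cycAux {φ} {B} (suc fuel) (suc m) F _ (s≤s m≤fuel) m≤B =
    ≐-cancel (divProd φ (suc m) m) nz (≐-resp (trans (sym (F (suc m) (s≤s z≤n) m≤B)) (divProd-last φ m))
        (trans (prodP-divisors φ (suc m) m) (sym (*-identityʳ _)))
      (≐-÷₁ (≐--₁ (≐-q^ (suc m)) ≐-1) (≐-prodList (divisors (suc m) m) (All.map rec (divisors-range (suc m) m)))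
        (NZ-resp (sym (prodP-divisors φ (suc m) m)) nz)))
  where
  nz : NZ (divProd φ (suc m) m)
  nz = divProd-NZ m (family-weaken (ℕₚ.<⇒≤ m≤B) F)
  rec : ∀ {d} → 1 ≤ d × d ≤ m → cycAux fuel d ≐ φ d ∕ 1#
  rec {d} (x , y) = ≐-cycAux fuel d F x (ℕₚ.≤-trans y m≤fuel) (ℕₚ.≤-trans y (ℕₚ.<⇒≤ m≤B))

cyclotomicLike-resp : ∀ {m f g} → f ≋ g → CyclotomicLike m f → CyclotomicLike m g
cyclotomicLike-resp e (cyclotomicLike d h) = cyclotomicLike (∣-respˡ e d)
    (λ ne → ⊥-sym (⊥-∣ (⊥-sym (h ne)) (divides 1# (trans (*-identityʳ _) (sym e)))))

cyclotomic-cyclotomicLike : ∀ n Φ → 1 ≤ n → IsCyclotomic n Φ → CyclotomicLike n Φ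
cyclotomic-cyclotomicLike (suc n) Φ 1≤n h = cyclotomicLike-resp (sym (≐-unique (≐-cycAux (suc n) (suc n) F 1≤n ℕₚ.≤-refl ℕₚ.≤-refl) h))
    (family-cyclotomicLike n ℕₚ.≤-refl F)
  where
  F = proj₂ (cyclotomicFamily (suc n))

-- The partial sums S/D and their q-WZ recurrence

-- w and d are the factors by which the Pochhammer products in the numerator and the denominator of the
-- summand grow, both multiplied by α; S α M / D α M is the sum over k ≤ M with a replaced by α.
d w w₀ : Poly → Poly → Poly
d α x = (1# - x ^ 2) * (1# - x ^ 4) * (1# - α * x ^ 4) * (α - x ^ 4)
w₀ α x = (1# - q * x ^ 4) * (1# - q * x ^ 2) * (1# - α * q * x ^ 2)
w α x = w₀ α x * (α - q * x ^ 2)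

-- `D` starts with 1 - q, the denominator of every q-integer, and `S` with the numerator 1 - q of
-- the term k = 0. Each step adds 2 to the degree in α, so that `S α M` has degree at most 2M.
W N S D : Poly → ℕ → Poly
W α zero = 1#
W α (suc k) = W α k * w α (q ^ k)
N α k = (1# - q * (q ^ k) ^ 6) * q ^ (k ℕ.* k ℕ.+ k) * W α k
S α zero = 1# - q
S α (suc k) = S α k * d α (q ^ suc k) + N α (suc k)
D α zero = 1# - q
D α (suc k) = D α k * d α (q ^ suc k)

-- Under α ↦ α q⁴ the factors 1 - α q^(4k) move up one place and the factors α - q^(4k) move down
-- one place, up to powers of q. In the quotient only the end factors survive.
D-shift : ∀ α M → D (α * q ^ 4) M * ((1# - α * q ^ 4) * (α - (q ^ M) ^ 4)) ≋ D α M *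
    ((q ^ M) ^ 4 * (1# - α * q ^ 4 * (q ^ M) ^ 4) * (α - 1#))
D-shift α zero = solve 2 (λ q α → (con 1ℤ :- q) :* ((con 1ℤ :- α :* q :^ 4) :* (α :- con 1ℤ :^ 4))
  := (con 1ℤ :- q) :* (con 1ℤ :^ 4 :* (con 1ℤ :- α :* q :^ 4 :* con 1ℤ :^ 4) :* (α :- con 1ℤ))) refl q α
D-shift α (suc M) = trans (solve 4 (λ q α X D →
    D :* ((con 1ℤ :- (q :* X) :^ 2) :* (con 1ℤ :- (q :* X) :^ 4) :* (con 1ℤ :- α :* q :^ 4 :* (q :* X) :^ 4) :*
        (α :* q :^ 4 :- (q :* X) :^ 4)) :* ((con 1ℤ :- α :* q :^ 4) :* (α :- (q :* X) :^ 4))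
    := D :* ((con 1ℤ :- α :* q :^ 4) :* (α :- X :^ 4)) :* (q :^ 4 :* (con 1ℤ :- (q :* X) :^ 2) :* (con 1ℤ :- (q :* X) :^ 4) :*
        (con 1ℤ :- α :* q :^ 4 :* (q :* X) :^ 4) :* (α :- (q :* X) :^ 4)))
    refl q α (q ^ M) (D (α * q ^ 4) M))
  (trans (*-congʳ (D-shift α M)) (solve 4 (λ q α X D →
    D :* (X :^ 4 :* (con 1ℤ :- α :* q :^ 4 :* X :^ 4) :* (α :- con 1ℤ)) :*
        (q :^ 4 :* (con 1ℤ :- (q :* X) :^ 2) :* (con 1ℤ :- (q :* X) :^ 4) :* (con 1ℤ :- α :* q :^ 4 :* (q :* X) :^ 4) :*
        (α :- (q :* X) :^ 4))
    := D :* ((con 1ℤ :- (q :* X) :^ 2) :* (con 1ℤ :- (q :* X) :^ 4) :* (con 1ℤ :- α :* (q :* X) :^ 4) :* (α :- (q :* X) :^ 4)) :*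
        ((q :* X) :^ 4 :* (con 1ℤ :- α :* q :^ 4 :* (q :* X) :^ 4) :* (α :- con 1ℤ)))
    refl q α (q ^ M) (D α M)))

-- Up to a few factors, Z α m is what W α (m + 2) and W (α q⁴) (m + 2) have in common.
Z : Poly → ℕ → Poly
Z α zero = (1# - q) * (1# - q) * (1# - α * q)
Z α (suc m) = Z α m * w₀ α (q ^ suc m) * (α - q * (q ^ m) ^ 2)

W-Z : ∀ α m → W α (suc (suc m)) ≋ Z α m * w₀ α (q ^ suc m) * (α - q * (q ^ m) ^ 2) * (α - q * (q ^ suc m) ^ 2)
W-Z α zero = solve 2 (λ q α → let 1' = con 1ℤ ; w₀ = λ x → (1' :- q :* x :^ 4) :* (1' :- q :* x :^ 2) :* (1' :- α :* q :* x :^ 2) in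
  1' :* (w₀ 1' :* (α :- q :* 1' :^ 2)) :* (w₀ (q :* 1') :* (α :- q :* (q :* 1') :^ 2))
  := (1' :- q) :* (1' :- q) :* (1' :- α :* q) :* w₀ (q :* 1') :* (α :- q :* 1' :^ 2) :* (α :- q :* (q :* 1') :^ 2)) refl q α
W-Z α (suc m) = trans (*-congʳ (W-Z α m)) (solve 4 (λ x y z t → x :* y :* (z :* t) := x :* z :* y :* t) refl
  (Z α m * w₀ α (q ^ suc m) * (α - q * (q ^ m) ^ 2)) (α - q * (q ^ suc m) ^ 2) (w₀ α (q ^ suc (suc m))) (α - q * (q ^ suc (suc m)) ^ 2))

-- The products in `W` that involve α have base q², so α ↦ α q⁴ moves their factors by two places.
-- This is why the index is m + 2 and why two boundary factors appear here and in `W-Z`.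
W-shift-Z : ∀ α m → W (α * q ^ 4) (suc (suc m)) ≋ Z α m * w₀ α (q ^ suc m) *
    ((1# - α * q ^ 3 * (q ^ suc m) ^ 2) * (1# - α * q ^ 5 * (q ^ suc m) ^ 2) * (q ^ suc m) ^ 4)
W-shift-Z α zero = solve 2 (λ q α → let 1' = con 1ℤ ; w₀ = λ α x → (1' :- q :* x :^ 4) :* (1' :- q :* x :^ 2) :* (1' :- α :* q :* x :^ 2) ; α' = α :* q :^ 4 in
  1' :* (w₀ α' 1' :* (α' :- q :* 1' :^ 2)) :* (w₀ α' (q :* 1') :* (α' :- q :* (q :* 1') :^ 2))
  := (1' :- q) :* (1' :- q) :* (1' :- α :* q) :* w₀ α (q :* 1') :*
      ((1' :- α :* q :^ 3 :* (q :* 1') :^ 2) :* (1' :- α :* q :^ 5 :* (q :* 1') :^ 2) :* (q :* 1') :^ 4)) refl q α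
W-shift-Z α (suc m) = trans (*-congʳ (W-shift-Z α m)) (solve 4 (λ q α y Z → let 1' = con 1ℤ ; w₀ = λ α x → (1' :- q :* x :^ 4) :* (1' :- q :* x :^ 2) :* (1' :- α :* q :* x :^ 2) ; α' = α :* q :^ 4 ; X = q :* y ; X' = q :* X in
  Z :* ((1' :- α :* q :^ 3 :* X :^ 2) :* (1' :- α :* q :^ 5 :* X :^ 2) :* X :^ 4) :* (w₀ α' X' :* (α' :- q :* X' :^ 2))
  := Z :* (α :- q :* y :^ 2) :* w₀ α X' :* ((1' :- α :* q :^ 3 :* X' :^ 2) :* (1' :- α :* q :^ 5 :* X' :^ 2) :* X' :^ 4)) refl q α (q ^ m)
      (Z α m * w₀ α (q ^ suc m)))

-- This is k² + k - 3 at k = m + 2, the power of q in the boundary term of the WZ identity.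
exponent : ℕ → ℕ
exponent m = m ℕ.* m ℕ.+ 5 ℕ.* m ℕ.+ 3

E-exponent : ∀ m → q ^ (suc (suc m) ℕ.* suc (suc m) ℕ.+ suc (suc m)) ≋ q ^ 3 * q ^ exponent m
E-exponent m = trans (reflexive (cong (q ^_) (lem m))) (^-homo-* q 3 (exponent m))
  where
  lem : ∀ m → suc (suc m) ℕ.* suc (suc m) ℕ.+ suc (suc m) ≡ 3 ℕ.+ (m ℕ.* m ℕ.+ 5 ℕ.* m ℕ.+ 3)
  lem = NatSolver.solve-∀

exponent-suc : ∀ m → q ^ exponent (suc m) ≋ q ^ exponent m * (q ^ 4 * (q ^ suc m) ^ 2)
exponent-suc m = trans (reflexive (cong (q ^_) (lem m))) (trans (^-homo-* q (exponent m) (4 ℕ.+ suc m ℕ.* 2))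
    (*-congˡ (trans (^-homo-* q 4 (suc m ℕ.* 2)) (*-congˡ (sym (^-assocʳ q (suc m) 2))))))
  where
  lem : ∀ m → suc m ℕ.* suc m ℕ.+ 5 ℕ.* suc m ℕ.+ 3 ≡ m ℕ.* m ℕ.+ 5 ℕ.* m ℕ.+ 3 ℕ.+ (4 ℕ.+ suc m ℕ.* 2)
  lem = NatSolver.solve-∀

-- The q-WZ pair for the shift α ↦ α q⁴, summed over k ≤ M = m + 1 and cleared of denominators.
WZ : ∀ α m → let X = q ^ suc m in
  - (q * (1# - α * q ^ 3) * (α - X ^ 4) * S (α * q ^ 4) (suc m)) - X ^ 4 * (1# - α * q) * (1# - α * q ^ 4 * X ^ 4) * S α (suc m)
  ≋ X ^ 4 * (1# - α ^ 2 * q ^ 4) * (q ^ exponent m * w₀ α X * Z α m)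
WZ α zero = solve 2 (λ q α → let
    1' = con 1ℤ ; X = q :* 1'
    d = λ α x → (1' :- x :^ 2) :* (1' :- x :^ 4) :* (1' :- α :* x :^ 4) :* (α :- x :^ 4)
    w₀ = λ α x → (1' :- q :* x :^ 4) :* (1' :- q :* x :^ 2) :* (1' :- α :* q :* x :^ 2)
    S = λ α → (1' :- q) :* d α X :+ (1' :- q :* X :^ 6) :* q :^ 2 :* (1' :* (w₀ α 1' :* (α :- q :* 1' :^ 2))) in
  :- (q :* (1' :- α :* q :^ 3) :* (α :- X :^ 4) :* S (α :* q :^ 4)) :- X :^ 4 :* (1' :- α :* q) :* (1' :- α :* q :^ 4 :* X :^ 4) :* S α
  := X :^ 4 :* (1' :- α :^ 2 :* q :^ 4) :* (q :^ 3 :* w₀ α X :* ((1' :- q) :* (1' :- q) :* (1' :- α :* q)))) refl q α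
WZ α (suc m) = begin
    - (q * (1# - α * q ^ 3) * (α - X' ^ 4) * (S' * d (α * q ^ 4) X' + n')) - X' ^ 4 * (1# - α * q) * (1# - α * q ^ 4 * X' ^ 4) *
        (S₀ * d α X' + n)
      ≈⟨ split q α X S' S₀ n' n ⟩
    c * L - q * (1# - α * q ^ 3) * (α - X' ^ 4) * n' - X' ^ 4 * (1# - α * q) * (1# - α * q ^ 4 * X' ^ 4) * n
      ≈⟨ +-cong (+-cong (*-congˡ (WZ α m)) (-‿cong (*-congˡ n'-eq))) (-‿cong (*-congˡ n-eq)) ⟩
    c * (X ^ 4 * (1# - α ^ 2 * q ^ 4) * V) - q * (1# - α * q ^ 3) * (α - X' ^ 4) *
        ((1# - q * X' ^ 6) * q ^ 3 * ((1# - α * q ^ 3 * X ^ 2) * (1# - α * q ^ 5 * X ^ 2) * X ^ 4) * V)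
      - X' ^ 4 * (1# - α * q) * (1# - α * q ^ 4 * X' ^ 4) * ((1# - q * X' ^ 6) * q ^ 3 * ((α - q * y ^ 2) * (α - q * X ^ 2)) * V)
      ≈⟨ final q α y V ⟩
    X' ^ 4 * (1# - α ^ 2 * q ^ 4) * (q ^ 4 * X ^ 2 * w₀ α X' * (α - q * y ^ 2) * V)
      ≈⟨ *-congˡ (trans (solve 6 (λ u v t e z w → u :* v :* t :* (e :* w :* z) := e :* u :* v :* (z :* w :* t)) refl (q ^ 4 * X ^ 2)
          (w₀ α X') (α - q * y ^ 2) (q ^ exponent m) (Z α m) (w₀ α X))
          (*-congʳ (*-congʳ (sym (exponent-suc m))))) ⟩
    X' ^ 4 * (1# - α ^ 2 * q ^ 4) * (q ^ exponent (suc m) * w₀ α X' * Z α (suc m)) ∎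
  where
  y = q ^ m
  X = q ^ suc m
  X' = q ^ suc (suc m)
  S' = S (α * q ^ 4) (suc m)
  S₀ = S α (suc m)
  n' = N (α * q ^ 4) (suc (suc m))
  n = N α (suc (suc m))
  V = q ^ exponent m * w₀ α X * Z α m
  -- Common factor of both old parts: α q⁴ - X'⁴ = q⁴ (α - X⁴) in the shifted `d` and 1 - α X'⁴ = 1
  -- - α q⁴ X⁴ in the other one restore the coefficients belonging to m.
  c = (1# - X' ^ 2) * (1# - X' ^ 4) * (α - X' ^ 4) * (1# - α * q ^ 4 * X' ^ 4) * q ^ 4
  L = - (q * (1# - α * q ^ 3) * (α - X ^ 4) * S') - X ^ 4 * (1# - α * q) * (1# - α * q ^ 4 * X ^ 4) * S₀
  n'-eq : n' ≋ (1# - q * X' ^ 6) * q ^ 3 * ((1# - α * q ^ 3 * X ^ 2) * (1# - α * q ^ 5 * X ^ 2) * X ^ 4) * V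
  n'-eq = trans (*-cong (*-congˡ (E-exponent m)) (W-shift-Z α m))
      (solve 6 (λ u v e z w r → u :* (v :* e) :* (z :* w :* r) := u :* v :* r :* (e :* w :* z)) refl
    (1# - q * X' ^ 6) (q ^ 3) (q ^ exponent m) (Z α m) (w₀ α X) ((1# - α * q ^ 3 * X ^ 2) * (1# - α * q ^ 5 * X ^ 2) * X ^ 4))
  n-eq : n ≋ (1# - q * X' ^ 6) * q ^ 3 * ((α - q * y ^ 2) * (α - q * X ^ 2)) * V
  n-eq = trans (*-cong (*-congˡ (E-exponent m)) (W-Z α m))
      (solve 7 (λ u v e z w r s → u :* (v :* e) :* (z :* w :* r :* s) := u :* v :* (r :* s) :* (e :* w :* z)) refl
    (1# - q * X' ^ 6) (q ^ 3) (q ^ exponent m) (Z α m) (w₀ α X) (α - q * y ^ 2) (α - q * X ^ 2))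
  split : ∀ q α X S' S n' n → let X' = q * X in
    - (q * (1# - α * q ^ 3) * (α - X' ^ 4) * (S' * d (α * q ^ 4) X' + n')) - X' ^ 4 * (1# - α * q) * (1# - α * q ^ 4 * X' ^ 4) *
        (S * d α X' + n)
    ≋ (1# - X' ^ 2) * (1# - X' ^ 4) * (α - X' ^ 4) * (1# - α * q ^ 4 * X' ^ 4) * q ^ 4 *
      (- (q * (1# - α * q ^ 3) * (α - X ^ 4) * S') - X ^ 4 * (1# - α * q) * (1# - α * q ^ 4 * X ^ 4) * S)
      - q * (1# - α * q ^ 3) * (α - X' ^ 4) * n' - X' ^ 4 * (1# - α * q) * (1# - α * q ^ 4 * X' ^ 4) * n
  split = solve 7 (λ q α X S' S n' n → let
      1' = con 1ℤ ; X' = q :* X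
      d = λ α x → (1' :- x :^ 2) :* (1' :- x :^ 4) :* (1' :- α :* x :^ 4) :* (α :- x :^ 4) in
    :- (q :* (1' :- α :* q :^ 3) :* (α :- X' :^ 4) :* (S' :* d (α :* q :^ 4) X' :+ n')) :- X' :^ 4 :* (1' :- α :* q) :*
        (1' :- α :* q :^ 4 :* X' :^ 4) :* (S :* d α X' :+ n)
    := (1' :- X' :^ 2) :* (1' :- X' :^ 4) :* (α :- X' :^ 4) :* (1' :- α :* q :^ 4 :* X' :^ 4) :* q :^ 4 :*
      (:- (q :* (1' :- α :* q :^ 3) :* (α :- X :^ 4) :* S') :- X :^ 4 :* (1' :- α :* q) :* (1' :- α :* q :^ 4 :* X :^ 4) :* S)
      :- q :* (1' :- α :* q :^ 3) :* (α :- X' :^ 4) :* n' :- X' :^ 4 :* (1' :- α :* q) :* (1' :- α :* q :^ 4 :* X' :^ 4) :* n) refl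
  -- With V factored out, what remains is the WZ equation proper, a polynomial identity in q, α and
  -- y = q^m.
  final : ∀ q α y V → let X = q * y ; X' = q * X in
    (1# - X' ^ 2) * (1# - X' ^ 4) * (α - X' ^ 4) * (1# - α * q ^ 4 * X' ^ 4) * q ^ 4 * (X ^ 4 * (1# - α ^ 2 * q ^ 4) * V)
      - q * (1# - α * q ^ 3) * (α - X' ^ 4) *
          ((1# - q * X' ^ 6) * q ^ 3 * ((1# - α * q ^ 3 * X ^ 2) * (1# - α * q ^ 5 * X ^ 2) * X ^ 4) * V)
      - X' ^ 4 * (1# - α * q) * (1# - α * q ^ 4 * X' ^ 4) * ((1# - q * X' ^ 6) * q ^ 3 * ((α - q * y ^ 2) * (α - q * X ^ 2)) * V)
    ≋ X' ^ 4 * (1# - α ^ 2 * q ^ 4) * (q ^ 4 * X ^ 2 * ((1# - q * X' ^ 4) * (1# - q * X' ^ 2) * (1# - α * q * X' ^ 2)) *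
        (α - q * y ^ 2) * V)
  final = solve 4 (λ q α y V → let 1' = con 1ℤ ; X = q :* y ; X' = q :* X in
    (1' :- X' :^ 2) :* (1' :- X' :^ 4) :* (α :- X' :^ 4) :* (1' :- α :* q :^ 4 :* X' :^ 4) :* q :^ 4 :*
        (X :^ 4 :* (1' :- α :^ 2 :* q :^ 4) :* V)
      :- q :* (1' :- α :* q :^ 3) :* (α :- X' :^ 4) :*
          ((1' :- q :* X' :^ 6) :* q :^ 3 :* ((1' :- α :* q :^ 3 :* X :^ 2) :* (1' :- α :* q :^ 5 :* X :^ 2) :* X :^ 4) :* V)
      :- X' :^ 4 :* (1' :- α :* q) :* (1' :- α :* q :^ 4 :* X' :^ 4) :*
          ((1' :- q :* X' :^ 6) :* q :^ 3 :* ((α :- q :* y :^ 2) :* (α :- q :* X :^ 2)) :* V)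
    := X' :^ 4 :* (1' :- α :^ 2 :* q :^ 4) :*
        (q :^ 4 :* X :^ 2 :* ((1' :- q :* X' :^ 4) :* (1' :- q :* X' :^ 2) :* (1' :- α :* q :* X' :^ 2)) :* (α :- q :* y :^ 2) :* V)) refl

-cong : ∀ {x y z t} → x ≋ y → z ≋ t → x - z ≋ y - t
-cong e f = +-cong e (-‿cong f)

d-cong : ∀ {α β} x → α ≋ β → d α x ≋ d β x
d-cong x e = *-cong (*-congˡ (-cong refl (*-congʳ e))) (-cong e refl)

w-cong : ∀ {α β} x → α ≋ β → w α x ≋ w β x
w-cong x e = *-cong (*-congˡ (-cong refl (*-congʳ (*-congʳ e)))) (-cong e refl)

W-cong : ∀ {α β} k → α ≋ β → W α k ≋ W β k
W-cong zero e = refl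
W-cong (suc k) e = *-cong (W-cong k e) (w-cong (q ^ k) e)

S-cong : ∀ {α β} k → α ≋ β → S α k ≋ S β k
S-cong zero e = refl
S-cong (suc k) e = +-cong (*-cong (S-cong k e) (d-cong (q ^ suc k) e)) (*-congˡ (W-cong (suc k) e))

D-cong : ∀ {α β} k → α ≋ β → D α k ≋ D β k
D-cong zero e = refl
D-cong (suc k) e = *-cong (D-cong k e) (d-cong (q ^ suc k) e)

-- Exact values of the sum at odd powers of q

*-vanishˡ : ∀ {x} y → x ≋ 0# → x * y ≋ 0#
*-vanishˡ y e = trans (*-congʳ e) (zeroˡ y)

*-vanishʳ : ∀ x {y} → y ≋ 0# → x * y ≋ 0#
*-vanishʳ x e = trans (*-congˡ e) (zeroʳ x)

-- The factor α - q^(2j+1) enters `W α k` as soon as k > j, so the sum terminates at α = q^(2j+1).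
W-vanish : ∀ {α j k} → α ≋ q * (q ^ j) ^ 2 → j < k → W α k ≋ 0#
W-vanish {α} {j} {suc k} e (s≤s j≤k) with ℕₚ.m≤n⇒m<n∨m≡n j≤k
... | inj₁ j<k = *-vanishˡ _ (W-vanish e j<k)
... | inj₂ ≡.refl = *-vanishʳ (W α k) (*-vanishʳ (w₀ α (q ^ k)) (≋⇒-≋0 e))

Z-vanish : ∀ {α j k} → α ≋ q * (q ^ j) ^ 2 → j < k → Z α k ≋ 0#
Z-vanish {α} {j} {suc k} e (s≤s j≤k) with ℕₚ.m≤n⇒m<n∨m≡n j≤k
... | inj₁ j<k = *-vanishˡ _ (*-vanishˡ (w₀ α (q ^ suc k)) (Z-vanish e j<k))
... | inj₂ ≡.refl = *-vanishʳ (Z α k * w₀ α (q ^ suc k)) (≋⇒-≋0 e)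

S-suc : ∀ {α j} k → α ≋ q * (q ^ j) ^ 2 → j ≤ k → S α (suc k) ≋ S α k * d α (q ^ suc k)
S-suc {α} k e j≤k = trans (+-congˡ (*-vanishʳ _ (W-vanish e (s≤s j≤k)))) (+-identityʳ _)

-- At α = q^{2j+1} the boundary term of the WZ identity vanishes.
recurrence : ∀ {α j M} → α ≋ q * (q ^ j) ^ 2 → suc j < M →
  q * (1# - α * q ^ 3) * (α - (q ^ M) ^ 4) * S (α * q ^ 4) M ≋ - ((q ^ M) ^ 4 * (1# - α * q) * (1# - α * q ^ 4 * (q ^ M) ^ 4) * S α M)
recurrence {α} {j} {suc m} e (s≤s j<m) = begin
  x              ≈⟨ solve 2 (λ x y → x := :- (:- x :- y) :- y) refl x y ⟩
  - (- x - y) - y ≈⟨ +-congʳ (-‿cong (trans (WZ α m) (*-vanishʳ _ (*-vanishʳ _ (Z-vanish e j<m))))) ⟩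
  - 0# - y       ≈⟨ solve 1 (λ y → :- con 0ℤ :- y := :- y) refl y ⟩
  - y            ∎
  where
  x = q * (1# - α * q ^ 3) * (α - (q ^ suc m) ^ 4) * S (α * q ^ 4) (suc m)
  y = (q ^ suc m) ^ 4 * (1# - α * q) * (1# - α * q ^ 4 * (q ^ suc m) ^ 4) * S α (suc m)

q^4 : ∀ r m → q ^ r * (q ^ m) ^ 4 ≋ q ^ (r ℕ.+ m ℕ.* 4)
q^4 r m = trans (*-congˡ (^-assocʳ q m 4)) (sym (^-homo-* q r (m ℕ.* 4)))

4∤ : ∀ r m M → suc r ℕ.+ m ℕ.* 4 ≡ M ℕ.* 4 → 3 ≤ r
4∤ r zero (suc M) e = ℕₚ.≤-trans (ℕₚ.m≤m+n 3 (M ℕ.* 4))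
    (ℕₚ.≤-reflexive (≡.sym (ℕₚ.suc-injective (≡.trans (cong suc (≡.sym (ℕₚ.+-identityʳ r))) e))))
4∤ r (suc m) zero e = ⊥-elim (ℕₚ.1+n≢0 e)
4∤ r (suc m) (suc M) e = 4∤ r m M (ℕₚ.+-cancelˡ-≡ 4 _ _ (≡.trans (lem r (m ℕ.* 4)) e))
  where
  lem : ∀ r m → 4 ℕ.+ (suc r ℕ.+ m) ≡ suc r ℕ.+ (4 ℕ.+ m)
  lem = NatSolver.solve-∀

-- 4m + r + 1 with r < 3 is never a multiple of 4. The recurrence is divided by this difference.
NZ-diff : ∀ {r} m M → r < 3 → NZ (q ^ suc r * (q ^ m) ^ 4 - (q ^ M) ^ 4)
NZ-diff {r} m M r<3 = NZ-resp (-cong (sym (q^4 (suc r) m)) (sym (^-assocʳ q M 4)))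
  (NZ-q^-q^ {suc r ℕ.+ m ℕ.* 4} {M ℕ.* 4} (λ e → ℕₚ.<⇒≱ r<3 (4∤ r m M e)))

-- `α₁ m` and `α₃ m` are q^(4m+1) and q^(4m+3), written in terms of q^m to suit the ring solver;
-- `P₂ m` and `P₄ m` are (q²;q⁴)_m and (q⁴;q⁴)_m.
α₁ α₃ P₂ P₄ : ℕ → Poly
α₁ m = q ^ 1 * (q ^ m) ^ 4
α₃ m = q ^ 3 * (q ^ m) ^ 4
P₂ m = ∏ m (λ j → 1# - q ^ 2 * (q ^ j) ^ 4)
P₄ m = ∏ m (λ j → 1# - q ^ 4 * (q ^ j) ^ 4)

rhs-num rhs-den : ℕ → Poly
rhs-num m = P₂ m * (1# - α₁ m)
rhs-den m = P₄ m * q ^ m * (1# - q)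

α₁-j : ∀ m → α₁ m ≋ q * (q ^ (m ℕ.+ m)) ^ 2
α₁-j m = trans (solve 2 (λ q y → q :^ 1 :* y :^ 4 := q :* (y :* y) :^ 2) refl q (q ^ m)) (*-congˡ (^-congˡ 2 (sym (^-homo-* q m m))))

α₃-j : ∀ m → α₃ m ≋ q * (q ^ suc (m ℕ.+ m)) ^ 2
α₃-j m = trans (solve 2 (λ q y → q :^ 3 :* y :^ 4 := q :* (q :* (y :* y)) :^ 2) refl q (q ^ m))
    (*-congˡ (^-congˡ 2 (*-congˡ (sym (^-homo-* q m m)))))

α-suc : ∀ r m → q ^ r * (q ^ suc m) ^ 4 ≋ q ^ r * (q ^ m) ^ 4 * q ^ 4
α-suc r m = solve 3 (λ u q y → u :* (q :* y) :^ 4 := u :* y :^ 4 :* q :^ 4) refl (q ^ r) q (q ^ m)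

-- At α = q only the term k = 0 survives, and it equals 1.
S₀≋D : ∀ M → S (α₁ 0) M ≋ D (α₁ 0) M
S₀≋D zero = refl
S₀≋D (suc M) = trans (S-suc M (α₁-j 0) z≤n) (*-congʳ (S₀≋D M))

-- `recurrence` and `D-shift` together multiply the sum by (1 - αq)(1 - αq⁴) / (q (1 - αq³)(1 - α))
-- under α ↦ α q⁴; the dependence on M cancels. At α = q^(4m+1) this contributes the next factors of
-- `P₂` and `P₄`, one more q in the denominator, and a telescoping (1 - αq⁴) / (1 - α).
S-at-α₁ : ∀ m M → m ℕ.+ m ≤ M → S (α₁ m) M * rhs-den m ≋ rhs-num m * D (α₁ m) M
S-at-α₁ zero M _ = trans (*-congʳ (S₀≋D M))
    (solve 2 (λ q D → D :* (con 1ℤ :* con 1ℤ :* (con 1ℤ :- q)) := con 1ℤ :* (con 1ℤ :- q :^ 1 :* con 1ℤ :^ 4) :* D) refl q (D (α₁ 0) M))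
S-at-α₁ (suc m) M le = *-cancel (NZ-diff m M (s≤s z≤n)) (begin
    (α - X ^ 4) * (S (α₁ (suc m)) M * (P₄ m * (1# - q ^ 4 * y ^ 4) * (q * y) * (1# - q)))
      ≈⟨ *-congˡ (*-congʳ (S-cong M (α-suc 1 m))) ⟩
    (α - X ^ 4) * (S' * (P₄ m * (1# - q ^ 4 * y ^ 4) * (q * y) * (1# - q)))
      ≈⟨ solve 5 (λ q y A S P → let 1' = con 1ℤ in A :* (S :* (P :* (1' :- q :^ 4 :* y :^ 4) :* (q :* y) :* (1' :- q)))
           := q :* (1' :- q :^ 1 :* y :^ 4 :* q :^ 3) :* A :* S :* (P :* y :* (1' :- q))) refl q y (α - X ^ 4) S' (P₄ m) ⟩
    q * (1# - α * q ^ 3) * (α - X ^ 4) * S' * (P₄ m * y * (1# - q))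
      ≈⟨ *-congʳ (recurrence (α₁-j m) lt) ⟩
    - (X ^ 4 * (1# - α * q) * (1# - α * q ^ 4 * X ^ 4) * S α M) * (P₄ m * y * (1# - q))
      ≈⟨ solve 3 (λ x S p → :- (x :* S) :* p := :- x :* (S :* p)) refl (X ^ 4 * (1# - α * q) * (1# - α * q ^ 4 * X ^ 4)) (S α M)
          (P₄ m * y * (1# - q)) ⟩
    - (X ^ 4 * (1# - α * q) * (1# - α * q ^ 4 * X ^ 4)) * (S α M * (P₄ m * y * (1# - q)))
      ≈⟨ *-congˡ (S-at-α₁ m M (ℕₚ.<⇒≤ (ℕₚ.<⇒≤ lt))) ⟩
    - (X ^ 4 * (1# - α * q) * (1# - α * q ^ 4 * X ^ 4)) * (P₂ m * (1# - α) * D α M)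
      ≈⟨ solve 6 (λ x u v P α D → let 1' = con 1ℤ in :- (x :* u :* v) :* (P :* (1' :- α) :* D) := P :* u :* (D :* (x :* v :* (α :- 1')))) refl
           (X ^ 4) (1# - α * q) (1# - α * q ^ 4 * X ^ 4) (P₂ m) α (D α M) ⟩
    P₂ m * (1# - α * q) * (D α M * (X ^ 4 * (1# - α * q ^ 4 * X ^ 4) * (α - 1#)))
      ≈⟨ *-congˡ (D-shift α M) ⟨
    P₂ m * (1# - α * q) * (D (α * q ^ 4) M * ((1# - α * q ^ 4) * (α - X ^ 4)))
      ≈⟨ solve 5 (λ q y A P D → let 1' = con 1ℤ ; α = q :^ 1 :* y :^ 4 in P :* (1' :- α :* q) :* (D :* ((1' :- α :* q :^ 4) :* A))
           := A :* (P :* (1' :- q :^ 2 :* y :^ 4) :* (1' :- q :^ 1 :* (q :* y) :^ 4) :* D)) refl q y (α - X ^ 4) (P₂ m) (D (α * q ^ 4) M) ⟩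
    (α - X ^ 4) * (rhs-num (suc m) * D (α * q ^ 4) M)
      ≈⟨ *-congˡ (*-congˡ (D-cong M (α-suc 1 m))) ⟨
    (α - X ^ 4) * (rhs-num (suc m) * D (α₁ (suc m)) M) ∎)
  where
  y = q ^ m
  X = q ^ M
  α = α₁ m
  S' = S (α * q ^ 4) M
  lt : suc (m ℕ.+ m) < M
  lt = ℕₚ.≤-trans (s≤s (ℕₚ.≤-reflexive (≡.sym (ℕₚ.+-suc m m)))) le

-- At α = q³ the sum consists of two terms, which cancel. The recurrence is homogeneous there, so
-- the zero is passed on along α ↦ α q⁴.
S-at-α₃ : ∀ m M → suc (m ℕ.+ m) ≤ M → S (α₃ m) M ≋ 0#
S-at-α₃ zero (suc zero) _ = solve 1 (λ q → let
    1' = con 1ℤ ; X = q :* 1' ; α = q :^ 3 :* 1' :^ 4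
    d = λ α x → (1' :- x :^ 2) :* (1' :- x :^ 4) :* (1' :- α :* x :^ 4) :* (α :- x :^ 4)
    w₀ = λ α x → (1' :- q :* x :^ 4) :* (1' :- q :* x :^ 2) :* (1' :- α :* q :* x :^ 2) in
  (1' :- q) :* d α X :+ (1' :- q :* X :^ 6) :* q :^ 2 :* (1' :* (w₀ α 1' :* (α :- q :* 1' :^ 2))) := con 0ℤ) refl q
S-at-α₃ zero (suc (suc M)) _ = trans (S-suc (suc M) (α₃-j 0) (s≤s z≤n)) (*-vanishˡ _ (S-at-α₃ zero (suc M) (s≤s z≤n)))
S-at-α₃ (suc m) M le = trans (S-cong M (α-suc 3 m))
    (*-cancel-0 nz (trans (recurrence (α₃-j m) lt) (trans (-‿cong (*-vanishʳ _ (S-at-α₃ m M (ℕₚ.<⇒≤ (ℕₚ.<⇒≤ lt)))))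
    (solve 0 (:- con 0ℤ := con 0ℤ) refl))))
  where
  lt : suc (suc (m ℕ.+ m)) < M
  lt = ℕₚ.≤-trans (s≤s (s≤s (ℕₚ.≤-reflexive (≡.sym (ℕₚ.+-suc m m))))) le
  nz : NZ (q * (1# - α₃ m * q ^ 3) * (α₃ m - (q ^ M) ^ 4))
  nz = NZ-* (NZ-* NZ-q (NZ-resp (-cong refl
      (trans (sym (q^4 6 m)) (solve 2 (λ q y → q :^ 6 :* y :^ 4 := q :^ 3 :* y :^ 4 :* q :^ 3) refl q (q ^ m)))) (NZ-1-q^ (5 ℕ.+ m ℕ.* 4))))
    (NZ-diff m M (s≤s (s≤s (s≤s z≤n))))

-- Congruences and the reversal α ↦ 1/α

mod-refl : ∀ {f x y} → x ≋ y → f ∣ x - y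
mod-refl e = ∣-resp (sym (≋⇒-≋0 e)) ∣-0

mod-+ : ∀ {f x y z t} → f ∣ x - y → f ∣ z - t → f ∣ (x + z) - (y + t)
mod-+ {f} {x} {y} {z} {t} h g = ∣-resp (solve 4 (λ x y z t → (x :- y) :+ (z :- t) := (x :+ z) :- (y :+ t)) refl x y z t) (∣-+ h g)

mod-* : ∀ {f x y z t} → f ∣ x - y → f ∣ z - t → f ∣ x * z - y * t
mod-* {f} {x} {y} {z} {t} h g = ∣-resp (solve 4 (λ x y z t → (x :- y) :* z :+ y :* (z :- t) := x :* z :- y :* t) refl x y z t)
    (∣-+ (∣-*ʳ z h) (∣-*ˡ y g))

mod-0 : ∀ {f x y} → f ∣ x - y → f ∣ y → f ∣ x
mod-0 {f} {x} {y} h g = ∣-resp (solve 2 (λ x y → (x :- y) :+ y := x) refl x y) (∣-+ h g)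

mod-respʳ : ∀ {f x y z} → y ≋ z → f ∣ x - y → f ∣ x - z
mod-respʳ e = ∣-resp (-cong refl e)

-- Modulo f with α b ≡ 1, each term is homogeneous under α ↦ b = 1/α.
module Reversal {f α b : Poly} (αb≡1 : f ∣ 1# - α * b) where

  -- With αb ≡ 1 the two factors change places: 1 - αu ≡ α (b - u) and α - u ≡ α (1 - bu).
  pair : ∀ u → f ∣ (1# - α * u) * (α - u) - α ^ 2 * ((1# - b * u) * (b - u))
  pair u = ∣-resp (solve 3 (λ α b u → let 1' = con 1ℤ in (1' :- α :* b) :* ((α :- u) :- α :* (b :- u) :* u)
      := (1' :- α :* u) :* (α :- u) :- α :^ 2 :* ((1' :- b :* u) :* (b :- u))) refl α b u)
    (∣-*ʳ _ αb≡1)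

  pair-* : ∀ v u → f ∣ v * (1# - α * u) * (α - u) - α ^ 2 * (v * (1# - b * u) * (b - u))
  pair-* v u = ∣-resp (solve 4 (λ α b u v → let 1' = con 1ℤ in v :* ((1' :- α :* u) :* (α :- u) :- α :^ 2 :* ((1' :- b :* u) :* (b :- u)))
      := v :* (1' :- α :* u) :* (α :- u) :- α :^ 2 :* (v :* (1' :- b :* u) :* (b :- u))) refl α b u v)
    (∣-*ˡ v (pair u))

  d-rev : ∀ x → f ∣ d α x - α ^ 2 * d b x
  d-rev x = pair-* ((1# - x ^ 2) * (1# - x ^ 4)) (x ^ 4)

  w-rev : ∀ x → f ∣ w α x - α ^ 2 * w b x
  w-rev x = ∣-resp (-cong (*-congʳ (*-congˡ (-cong refl (sym (*-assoc α q (x ^ 2))))))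
      (*-congˡ (*-congʳ (*-congˡ (-cong refl (sym (*-assoc b q (x ^ 2))))))))
    (pair-* ((1# - q * x ^ 4) * (1# - q * x ^ 2)) (q * x ^ 2))

  regroup : ∀ x y z t → (x * y) * (z * t) ≋ (z * x) * (y * t)
  regroup = solve 4 (λ x y z t → (x :* y) :* (z :* t) := (z :* x) :* (y :* t)) refl

  W-rev : ∀ k → f ∣ W α k - (α ^ 2) ^ k * W b k
  W-rev zero = mod-refl (sym (*-identityʳ 1#))
  W-rev (suc k) = mod-respʳ (regroup ((α ^ 2) ^ k) (W b k) (α ^ 2) (w b (q ^ k))) (mod-* (W-rev k) (w-rev (q ^ k)))

  N-rev : ∀ k → f ∣ N α k - (α ^ 2) ^ k * N b k
  N-rev k = mod-respʳ (solve 3 (λ x y z → x :* (y :* z) := y :* (x :* z)) refl _ ((α ^ 2) ^ k) (W b k))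
    (mod-* {x = (1# - q * (q ^ k) ^ 6) * q ^ (k ℕ.* k ℕ.+ k)} (mod-refl refl) (W-rev k))

  -- Applied twice: modulo Φ with α an even power of q and b an odd one, and modulo 1 - a q^n with α
  -- = a and b = q^n.
  S-rev : ∀ k → f ∣ S α k - (α ^ 2) ^ k * S b k
  S-rev zero = mod-refl (sym (*-identityˡ _))
  S-rev (suc k) = mod-respʳ (trans (+-congʳ (regroup ((α ^ 2) ^ k) (S b k) (α ^ 2) (d b (q ^ suc k))))
      (solve 3 (λ x y z → x :* y :+ x :* z := x :* (y :+ z)) refl ((α ^ 2) ^ suc k) (S b k * d b (q ^ suc k)) (N b (suc k))))
    (mod-+ (mod-* (S-rev k) (d-rev (q ^ suc k))) (N-rev (suc k)))

  D-rev : ∀ k → f ∣ D α k - (α ^ 2) ^ k * D b k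
  D-rev zero = mod-refl (sym (*-identityˡ _))
  D-rev (suc k) = mod-respʳ (regroup ((α ^ 2) ^ k) (D b k) (α ^ 2) (d b (q ^ suc k))) (mod-* (D-rev k) (d-rev (q ^ suc k)))

-- The sum as a polynomial in a

afree-q^ : ∀ k → AFree (q ^ k)
afree-q^ k = afree-^ k afree-q

afree-1- : ∀ {x} → AFree x → AFree (1# - x)
afree-1- = adeg-- (afree-κ 1ℤ)

adeg-1-a : ∀ {x} → AFree x → ADeg 1 (1# - a * x)
adeg-1-a f = adeg-- (adeg-weaken z≤n (afree-κ 1ℤ)) (adeg-* adeg-a f)

adeg-a- : ∀ {x} → AFree x → ADeg 1 (a - x)
adeg-a- f = adeg-- adeg-a (adeg-weaken z≤n f)

adeg-d : ∀ {x} → AFree x → ADeg 2 (d a x)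
adeg-d f = adeg-* (adeg-* (afree-* (afree-1- (afree-^ 2 f)) (afree-1- (afree-^ 4 f))) (adeg-1-a (afree-^ 4 f))) (adeg-a- (afree-^ 4 f))

adeg-w : ∀ {x} → AFree x → ADeg 2 (w a x)
adeg-w {x} f = adeg-* (adeg-* (afree-* (afree-1- (afree-* afree-q (afree-^ 4 f))) (afree-1- (afree-* afree-q (afree-^ 2 f))))
    (supp-resp (-cong refl (sym (*-assoc a q (x ^ 2)))) (adeg-1-a (afree-* afree-q (afree-^ 2 f)))))
        (adeg-a- (afree-* afree-q (afree-^ 2 f)))

double-suc : ∀ k → k ℕ.+ k ℕ.+ 2 ≤ suc k ℕ.+ suc k
double-suc k = ℕₚ.≤-reflexive (lem k)
  where
  lem : ∀ k → k ℕ.+ k ℕ.+ 2 ≡ suc k ℕ.+ suc k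
  lem = NatSolver.solve-∀

adeg-W : ∀ k → ADeg (k ℕ.+ k) (W a k)
adeg-W zero = afree-κ 1ℤ
adeg-W (suc k) = adeg-weaken (double-suc k) (adeg-* (adeg-W k) (adeg-w (afree-q^ k)))

adeg-N : ∀ k → ADeg (k ℕ.+ k) (N a k)
adeg-N k = adeg-* (afree-* (afree-1- (afree-* afree-q (afree-^ 6 (afree-q^ k)))) (afree-q^ (k ℕ.* k ℕ.+ k))) (adeg-W k)

adeg-S : ∀ k → ADeg (k ℕ.+ k) (S a k)
adeg-S zero = afree-1- afree-q
adeg-S (suc k) = supp-+ (adeg-weaken (double-suc k) (adeg-* (adeg-S k) (adeg-d (afree-q^ (suc k))))) (adeg-N (suc k))

module Evaluation (r : Poly) where

  ev-1-a : ∀ {x} → AFree x → ev r (1# - a * x) ≋ 1# - r * x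
  ev-1-a {x} f = trans (ev-- r 1# (a * x)) (-cong (ev-κ r 1ℤ) (trans (ev-* r a x) (*-cong (ev-a r) (ev-afree r f))))

  ev-a- : ∀ {x} → AFree x → ev r (a - x) ≋ r - x
  ev-a- {x} f = trans (ev-- r a x) (-cong (ev-a r) (ev-afree r f))

  ev-*-cong : ∀ {x y x' y'} → ev r x ≋ x' → ev r y ≋ y' → ev r (x * y) ≋ x' * y'
  ev-*-cong {x} {y} e f = trans (ev-* r x y) (*-cong e f)

  ev-d : ∀ {x} → AFree x → ev r (d a x) ≋ d r x
  ev-d f = ev-*-cong (ev-*-cong (ev-afree r (afree-* (afree-1- (afree-^ 2 f)) (afree-1- (afree-^ 4 f)))) (ev-1-a (afree-^ 4 f)))
      (ev-a- (afree-^ 4 f))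

  ev-w : ∀ {x} → AFree x → ev r (w a x) ≋ w r x
  ev-w {x} f = ev-*-cong (ev-*-cong
      (ev-afree r (afree-* (afree-1- (afree-* afree-q (afree-^ 4 f))) (afree-1- (afree-* afree-q (afree-^ 2 f)))))
      (trans (ev-cong r (-cong refl (*-assoc a q (x ^ 2))))
          (trans (ev-1-a (afree-* afree-q (afree-^ 2 f))) (-cong refl (sym (*-assoc r q (x ^ 2)))))))
    (ev-a- (afree-* afree-q (afree-^ 2 f)))

  ev-W : ∀ k → ev r (W a k) ≋ W r k
  ev-W zero = ev-κ r 1ℤ
  ev-W (suc k) = ev-*-cong (ev-W k) (ev-w (afree-q^ k))

  ev-N : ∀ k → ev r (N a k) ≋ N r k
  ev-N k = ev-*-cong (ev-afree r (afree-* (afree-1- (afree-* afree-q (afree-^ 6 (afree-q^ k)))) (afree-q^ (k ℕ.* k ℕ.+ k)))) (ev-W k)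

  ev-S : ∀ k → ev r (S a k) ≋ S r k
  ev-S zero = ev-afree r (afree-1- afree-q)
  ev-S (suc k) = trans (ev-+ r _ _) (+-cong (ev-*-cong (ev-S k) (ev-d (afree-q^ (suc k)))) (ev-N (suc k)))

  ev-D : ∀ k → ev r (D a k) ≋ D r k
  ev-D zero = ev-afree r (afree-1- afree-q)
  ev-D (suc k) = ev-*-cong (ev-D k) (ev-d (afree-q^ (suc k)))

-- Divisibility by Φ

parity : ∀ n → (Σ ℕ λ i → n ≡ i ℕ.+ i) ⊎ (Σ ℕ λ i → n ≡ suc (i ℕ.+ i))
parity zero = inj₁ (0 , ≡.refl)
parity (suc n) with parity n
... | inj₁ (i , e) = inj₂ (i , cong suc e)
... | inj₂ (i , e) = inj₁ (suc i , cong suc (≡.trans e (≡.sym (ℕₚ.+-suc i i))))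

double-inj-≤ : ∀ {i j} → i ℕ.+ i ≤ j ℕ.+ j → i ≤ j
double-inj-≤ {i} {j} h with ℕₚ.<-≤-connex j i
... | inj₂ i≤j = i≤j
... | inj₁ j<i = ⊥-elim (ℕₚ.<⇒≱ (ℕₚ.+-mono-< j<i j<i) h)

even≢odd : ∀ i j → i ℕ.+ i ≢ suc (j ℕ.+ j)
even≢odd (suc i) zero e = ℕₚ.1+n≢0 (≡.trans (≡.sym (ℕₚ.+-suc i i)) (ℕₚ.suc-injective e))
even≢odd (suc i) (suc j) e = even≢odd i j
    (ℕₚ.suc-injective (ℕₚ.suc-injective (≡.trans (cong suc (≡.sym (ℕₚ.+-suc i i))) (≡.trans e (cong (λ k → suc (suc k)) (ℕₚ.+-suc j j))))))

∣-D : ∀ {f α j} M → f ∣ d α (q ^ suc j) → j < M → f ∣ D α M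
∣-D {f} {α} {j} (suc M) h (s≤s j≤M) with ℕₚ.m≤n⇒m<n∨m≡n j≤M
... | inj₁ j<M = ∣-*ʳ _ (∣-D M h j<M)
... | inj₂ ≡.refl = ∣-*ˡ (D α M) h

⊥-neg : ∀ {f g} → f ⊥ₚ g → f ⊥ₚ - g
⊥-neg {f} {g} (comax x y c≢0 e) = comax x (- y) c≢0 (trans (+-congˡ (solve 2 (λ y g → :- y :* :- g := y :* g) refl y g)) e)

⊥-resp : ∀ {f g h} → g ≋ h → f ⊥ₚ g → f ⊥ₚ h
⊥-resp e (comax x y c≢0 b) = comax x y c≢0 (trans (+-congˡ (*-congˡ (sym e))) b)

module Modulo {Φ : Poly} (M : ℕ) (1≤M : 1 ≤ M) (G : CyclotomicLike (suc (M ℕ.+ M)) Φ) where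

  n : ℕ
  n = suc (M ℕ.+ M)

  Φ∣1-q^n : Φ ∣ 1# - q ^ n
  Φ∣1-q^n = ∣-resp (solve 1 (λ x → :- (x :- con 1ℤ) := con 1ℤ :- x) refl (q ^ n)) (∣-neg (∣Q G))

  Φ-afree : AFree Φ
  Φ-afree = ∣-afree (∣Q G) (NZ-Q {n} (s≤s z≤n)) (adeg-- (afree-q^ n) (afree-κ 1ℤ))

  Φ⊥1-q^ : ∀ {j} → ¬ n ∣ℕ j → Φ ⊥ₚ 1# - q ^ j
  Φ⊥1-q^ {j} h = ⊥-resp (solve 1 (λ x → :- (x :- con 1ℤ) := con 1ℤ :- x) refl (q ^ j)) (⊥-neg (⊥Q G h))

  n∤small : ∀ {j} → j < M ℕ.+ M → ¬ n ∣ℕ suc j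
  n∤small j<2M h = ℕₚ.<⇒≱ j<2M (ℕₚ.≤-pred (ND.∣⇒≤ h))

  -- Since 0 < 4 (j + 1) ≤ 4M < 2n, the only candidate multiple is n itself, which is odd.
  n∤4* : ∀ {j} → j < M → ¬ n ∣ℕ suc j ℕ.* 4
  n∤4* {j} j<M (ND.divides zero e) = ℕₚ.1+n≢0 e
  n∤4* {j} j<M (ND.divides (suc zero) e) = even≢odd (suc j ℕ.* 2) M (≡.trans (lem (suc j)) (≡.trans e (ℕₚ.*-identityˡ n)))
    where
    lem : ∀ k → k ℕ.* 2 ℕ.+ k ℕ.* 2 ≡ k ℕ.* 4
    lem = NatSolver.solve-∀
  n∤4* {j} j<M (ND.divides (suc (suc c)) e) = ℕₚ.<-irrefl e (begin-strict
      suc j ℕ.* 4              ≤⟨ ℕₚ.*-monoˡ-≤ 4 j<M ⟩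
      M ℕ.* 4                  <⟨ ℕₚ.n<1+n _ ⟩
      suc (M ℕ.* 4)            ≤⟨ ℕₚ.n≤1+n _ ⟩
      suc (suc (M ℕ.* 4))      ≡⟨ lem M ⟩
      n ℕ.+ n                  ≤⟨ ℕₚ.+-monoʳ-≤ n (ℕₚ.m≤m+n n (c ℕ.* n)) ⟩
      suc (suc c) ℕ.* n        ∎′)
    where
    open ℕₚ.≤-Reasoning using (begin-strict_; step-≤; step-<; step-≡-⟩) renaming (_∎ to _∎′)
    lem : ∀ M → suc (suc (M ℕ.* 4)) ≡ suc (M ℕ.+ M) ℕ.+ suc (M ℕ.+ M)
    lem = NatSolver.solve-∀

  Φ⊥1-q : Φ ⊥ₚ 1# - q
  Φ⊥1-q = ⊥-resp (-cong refl (*-identityʳ q)) (Φ⊥1-q^ {1} (n∤small (ℕₚ.≤-trans 1≤M (ℕₚ.m≤m+n M M))))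

  Φ⊥1-x² : ∀ {j} → j < M → Φ ⊥ₚ 1# - (q ^ suc j) ^ 2
  Φ⊥1-x² {j} j<M = ⊥-resp (-cong refl (sym (^-assocʳ q (suc j) 2)))
      (Φ⊥1-q^ {suc j ℕ.* 2} (n∤small (ℕₚ.≤-trans (ℕₚ.≤-reflexive (lem j)) (ℕₚ.+-mono-≤ j<M j<M))))
    where
    lem : ∀ j → suc (suc (j ℕ.* 2)) ≡ suc j ℕ.+ suc j
    lem = NatSolver.solve-∀

  Φ⊥1-x⁴ : ∀ {j} → j < M → Φ ⊥ₚ 1# - (q ^ suc j) ^ 4
  Φ⊥1-x⁴ {j} j<M = ⊥-resp (-cong refl (sym (^-assocʳ q (suc j) 4))) (Φ⊥1-q^ {suc j ℕ.* 4} (n∤4* j<M))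

  Φ⊥q : Φ ⊥ₚ q
  Φ⊥q with ∣Q G
  ... | divides h e = comax (- h) (q ^ (M ℕ.+ M)) (λ ()) (trans (+-congʳ (solve 2 (λ h f → :- h :* f := :- (f :* h)) refl h Φ))
    (trans (+-congʳ (-‿cong e)) (solve 2 (λ q x → :- (q :* x :- con 1ℤ) :+ x :* q := con 1ℤ) refl q (q ^ (M ℕ.+ M)))))

  Φ⊥P₄ : ∀ m → m ≤ M → Φ ⊥ₚ P₄ m
  Φ⊥P₄ zero _ = ⊥-1
  Φ⊥P₄ (suc m) m<M = ⊥-* (Φ⊥P₄ m (ℕₚ.<⇒≤ m<M))
      (⊥-resp (solve 2 (λ q y → con 1ℤ :- (q :* y) :^ 4 := con 1ℤ :- q :^ 4 :* y :^ 4) refl q (q ^ m)) (Φ⊥1-x⁴ m<M))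

  Φ⊥rhs-den : ∀ m → m ≤ M → Φ ⊥ₚ rhs-den m
  Φ⊥rhs-den m m≤M = ⊥-* (⊥-* (Φ⊥P₄ m m≤M) (⊥-^ m Φ⊥q)) Φ⊥1-q

  regular : ∀ {f} → Φ ⊥ₚ f → Regular Φ f
  regular = ⊥⇒regular {n = n} (s≤s z≤n) (∣Q G)

  -- Among the factors 1 - q^{e+4j} and q^e - q^{4j} of D, one is divisible by 1 - q^n unless e = n.
  Φ∣num*D : ∀ m → m ℕ.+ m ≤ M → Φ ∣ rhs-num m * D (α₁ m) M
  Φ∣num*D m 2m≤M with parity M
  ... | inj₁ (s , M≡2s) = even-case (ℕₚ.m≤n⇒m<n∨m≡n (double-inj-≤ (subst (m ℕ.+ m ≤_) M≡2s 2m≤M)))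
    where
    power : ∀ {k} → k ≡ n → Φ ∣ 1# - q ^ k
    power ≡.refl = Φ∣1-q^n
    even-case : m < s ⊎ m ≡ s → Φ ∣ rhs-num m * D (α₁ m) M
    even-case (inj₂ ≡.refl) = ∣-*ʳ (D (α₁ m) M) (∣-*ˡ (P₂ m) (∣-resp (-cong refl (sym (q^4 1 m))) (power exps)))
      where
      lem : ∀ m → 1 ℕ.+ m ℕ.* 4 ≡ suc (m ℕ.+ m ℕ.+ (m ℕ.+ m))
      lem = NatSolver.solve-∀
      exps : 1 ℕ.+ m ℕ.* 4 ≡ n
      exps = ≡.trans (lem m) (cong (λ k → suc (k ℕ.+ k)) (≡.sym M≡2s))
    -- Here n = 4s + 1, and j + 1 = s - m makes 4m + 1 + 4 (j + 1) equal to n.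
    even-case (inj₁ m<s) with ℕₚ.m≤n⇒∃[o]m+o≡n m<s
    ... | j , m+j≡s = ∣-*ˡ (rhs-num m) (∣-D M (∣-*ʳ _ (∣-*ˡ _ (∣-resp (-cong refl eqn) (power exps)))) j<M)
      where
      lem : ∀ m j → 1 ℕ.+ m ℕ.* 4 ℕ.+ suc j ℕ.* 4 ≡ suc ((suc m ℕ.+ j) ℕ.+ (suc m ℕ.+ j) ℕ.+ ((suc m ℕ.+ j) ℕ.+ (suc m ℕ.+ j)))
      lem = NatSolver.solve-∀
      exps : 1 ℕ.+ m ℕ.* 4 ℕ.+ suc j ℕ.* 4 ≡ n
      exps = ≡.trans (lem m j) (≡.trans (cong (λ s → suc (s ℕ.+ s ℕ.+ (s ℕ.+ s))) m+j≡s) (cong (λ k → suc (k ℕ.+ k)) (≡.sym M≡2s)))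
      eqn : q ^ (1 ℕ.+ m ℕ.* 4 ℕ.+ suc j ℕ.* 4) ≋ α₁ m * (q ^ suc j) ^ 4
      eqn = trans (^-homo-* q (1 ℕ.+ m ℕ.* 4) (suc j ℕ.* 4)) (*-cong (sym (q^4 1 m)) (sym (^-assocʳ q (suc j) 4)))
      j<M : j < M
      j<M = ℕₚ.≤-trans (ℕₚ.≤-trans (s≤s (ℕₚ.m≤n+m j m)) (ℕₚ.≤-reflexive m+j≡s)) (ℕₚ.≤-trans (ℕₚ.m≤m+n s s) (ℕₚ.≤-reflexive (≡.sym M≡2s)))
  -- Here n = 4s + 3 and 4 (m + s + 1) = (4m + 1) + n, so the factor of `D` at index m + s + 1
  -- contains q^(4m+1) (1 - q^n).
  ... | inj₂ (s , M≡2s+1) = ∣-*ˡ (rhs-num m) (∣-D M (∣-*ˡ _ (∣-resp eqn (∣-*ˡ (α₁ m) Φ∣1-q^n))) j<M)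
    where
    m≤s : m ≤ s
    m≤s with ℕₚ.<-≤-connex s m
    ... | inj₂ h = h
    ... | inj₁ s<m = ⊥-elim (ℕₚ.<⇒≱ (s≤s (ℕₚ.+-mono-≤-< (ℕₚ.≤-refl {s}) s<m))
        (ℕₚ.≤-trans (ℕₚ.+-monoˡ-≤ m s<m) (ℕₚ.≤-trans 2m≤M (ℕₚ.≤-reflexive M≡2s+1))))
    j<M : m ℕ.+ s < M
    j<M = ℕₚ.≤-trans (s≤s (ℕₚ.+-monoˡ-≤ s m≤s)) (ℕₚ.≤-reflexive (≡.sym M≡2s+1))
    lem : ∀ m s → suc (m ℕ.+ s) ℕ.* 4 ≡ 1 ℕ.+ m ℕ.* 4 ℕ.+ suc (suc (s ℕ.+ s) ℕ.+ suc (s ℕ.+ s))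
    lem = NatSolver.solve-∀
    x⁴ : (q ^ suc (m ℕ.+ s)) ^ 4 ≋ α₁ m * q ^ n
    x⁴ = trans (^-assocʳ q (suc (m ℕ.+ s)) 4)
        (trans (reflexive (cong (q ^_) (≡.trans (lem m s) (cong (λ k → 1 ℕ.+ m ℕ.* 4 ℕ.+ suc (k ℕ.+ k)) (≡.sym M≡2s+1)))))
      (trans (^-homo-* q (1 ℕ.+ m ℕ.* 4) n) (*-congʳ (sym (q^4 1 m)))))
    eqn : α₁ m * (1# - q ^ n) ≋ α₁ m - (q ^ suc (m ℕ.+ s)) ^ 4
    eqn = trans (solve 2 (λ x y → x :* (con 1ℤ :- y) := x :- x :* y) refl (α₁ m) (q ^ n)) (-cong refl (sym x⁴))

  odd-power : ∀ j → q ^ suc (j ℕ.+ j) ≋ q * (q ^ j) ^ 2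
  odd-power j = *-congˡ (trans (^-homo-* q j j) (*-congˡ (sym (*-identityʳ (q ^ j)))))

  -- The cross-multiplied evaluation gives Φ ∣ `rhs-den m` * S for j = 2m, and `rhs-den m` is
  -- regular modulo Φ. For odd j the value of S is 0 outright.
  odd-root : ∀ j → j ≤ M → Φ ∣ S (q ^ suc (j ℕ.+ j)) M
  odd-root j j≤M with parity j
  ... | inj₁ (m , ≡.refl) = ∣-resp (S-cong M (trans (α₁-j m) (sym (odd-power j)))) (regular (Φ⊥rhs-den m (ℕₚ.≤-trans (ℕₚ.m≤m+n m m) j≤M))
      (∣-resp (*-comm (S (α₁ m) M) (rhs-den m)) (∣-resp (sym (S-at-α₁ m M j≤M)) (Φ∣num*D m j≤M))))
  ... | inj₂ (m , ≡.refl) = ∣-resp (trans (sym (S-at-α₃ m M j≤M)) (S-cong M (trans (α₃-j m) (sym (odd-power j))))) ∣-0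

  -- n is odd, so the inverse q^(n-2j) of q^(2j) modulo Φ is an odd power q^(2(M-j)+1), to which
  -- `odd-root` applies; j = 0 uses the exponent n.
  even-root : ∀ j → j ≤ M → Φ ∣ S (q ^ (j ℕ.+ j)) M
  even-root j j≤M = mod-0 (Reversal.S-rev inverse M) (∣-*ˡ _ (odd-root (M ∸ j) (ℕₚ.m∸n≤m M j)))
    where
    lem : ∀ i j → suc (j ℕ.+ i ℕ.+ (j ℕ.+ i)) ≡ j ℕ.+ j ℕ.+ suc (i ℕ.+ i)
    lem = NatSolver.solve-∀
    inverse : Φ ∣ 1# - q ^ (j ℕ.+ j) * q ^ suc ((M ∸ j) ℕ.+ (M ∸ j))
    inverse = ∣-resp (-cong refl (trans
        (reflexive (cong (q ^_) (≡.trans (cong (λ k → suc (k ℕ.+ k)) (≡.sym (ℕₚ.m+[n∸m]≡n j≤M))) (lem (M ∸ j) j))))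
      (^-homo-* q (j ℕ.+ j) _))) Φ∣1-q^n

  root : ∀ e → e ≤ M ℕ.+ M → Φ ∣ ev (q ^ e) (S a M)
  root e e≤2M = ∣-resp (sym (Evaluation.ev-S (q ^ e) M)) (by-parity (parity e))
    where
    by-parity : (Σ ℕ λ i → e ≡ i ℕ.+ i) ⊎ (Σ ℕ λ i → e ≡ suc (i ℕ.+ i)) → Φ ∣ S (q ^ e) M
    by-parity (inj₁ (i , ≡.refl)) = even-root i (double-inj-≤ e≤2M)
    by-parity (inj₂ (i , ≡.refl)) = odd-root i (double-inj-≤ (ℕₚ.<⇒≤ e≤2M))

  -- q^i - q^j = q^i (1 - q^(j-i)) with 0 < j - i < n, and both factors are comaximal with Φ over ℚ.
  differences : ∀ {i j} → i < j → j ≤ M ℕ.+ M → Regular Φ (q ^ i - q ^ j)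
  differences {i} {j} i<j j≤2M with ℕₚ.m≤n⇒∃[o]m+o≡n i<j
  ... | k , ≡.refl = regular (⊥-resp eqn (⊥-* (⊥-^ i Φ⊥q) (Φ⊥1-q^ {suc k} (n∤small (ℕₚ.≤-trans (s≤s (ℕₚ.m≤n+m k i)) j≤2M)))))
    where
    eqn : q ^ i * (1# - q ^ suc k) ≋ q ^ i - q ^ (suc i ℕ.+ k)
    eqn = trans (solve 2 (λ x y → x :* (con 1ℤ :- y) := x :- x :* y) refl (q ^ i) (q ^ suc k))
      (-cong refl (trans (sym (^-homo-* q i (suc k))) (reflexive (cong (q ^_) (ℕₚ.+-suc i k)))))

  Φ∣S : Φ ∣ S a M
  Φ∣S = roots⇒∣ (q ^_) afree-q^ Φ-afree (M ℕ.+ M) (S a M) (adeg-S M) differences root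

module ADegree = Weight (λ _ j → j) (λ _ _ _ _ → ≡.refl)

-- The divisibility of the difference and the coprimality of its denominator

-- A nonzero element of ℤ[q] in the ideal (f, g), as a resultant with respect to a would supply. It
-- forces every common divisor to be free of a.
record Elim (f g : Poly) : Set where
  constructor elim
  field
    x y r : Poly
    combination : x * f + y * g ≋ r
    afree : AFree r
    nonzero : NZ r

elim-sym : ∀ {f g} → Elim f g → Elim g f
elim-sym {f} {g} (elim x y r e fr nr) = elim y x r (trans (⊕-comm (y * g) (x * f)) e) fr nr

elim-* : ∀ {f g h} → Elim f g → Elim f h → Elim f (g * h)
elim-* {f} {g} {h} (elim x y r e fr nr) (elim z t s e' fs ns) = elim (x * z * f + x * t * h + y * z * g) (y * t) (r * s)
  (trans (solve 7 (λ f g h x y z t → (x :* z :* f :+ x :* t :* h :+ y :* z :* g) :* f :+ y :* t :* (g :* h)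
      := (x :* f :+ y :* g) :* (z :* f :+ t :* h)) refl f g h x y z t) (*-cong e e')) (afree-* fr fs) (NZ-* nr ns)

elim-afree : ∀ {f g} → AFree g → NZ g → Elim f g
elim-afree {f} {g} fg ng = elim 0# 1# g (solve 2 (λ f g → con 0ℤ :* f :+ con 1ℤ :* g := g) refl f g) fg ng

elim-∣ : ∀ {f g h} → Elim f g → h ∣ f → h ∣ g → AFree h
elim-∣ (elim x y r e fr nr) hf hg = ∣-afree (∣-resp e (∣-+ (∣-*ˡ x hf) (∣-*ˡ y hg))) nr fr

x⁴-exponent : ∀ j → (q ^ j) ^ 4 ≋ q ^ (j ℕ.* 4)
x⁴-exponent j = ^-assocʳ q j 4

-- In a, the modulus has roots q^n and q^(-n), and `D` has roots q^(4j) and q^(-4j). Eliminating a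
-- from a pair of linear factors leaves q^n - q^(4j) or 1 - q^(n+4j); the first is nonzero because n
-- is no multiple of 4.
module Linear (n : ℕ) (n≢4* : ∀ j → n ≢ j ℕ.* 4) where

  private
    NZ-n-4 : ∀ j → NZ (q ^ n - (q ^ j) ^ 4)
    NZ-n-4 j = NZ-resp (-cong refl (sym (x⁴-exponent j))) (NZ-q^-q^ (n≢4* j))

    NZ-n+4 : ∀ j → 1 ≤ j → NZ (1# - q ^ n * (q ^ j) ^ 4)
    NZ-n+4 (suc j) _ = NZ-resp (-cong refl (trans (^-homo-* q n (suc j ℕ.* 4)) (*-congˡ (sym (x⁴-exponent (suc j))))))
        (NZ-q^-q^ {0} {n ℕ.+ suc j ℕ.* 4} (λ e → ℕₚ.1+n≢0 (≡.sym (≡.trans e (ℕₚ.+-suc n _)))))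

    af : ∀ j → AFree ((q ^ j) ^ 4)
    af j = afree-^ 4 (afree-q^ j)

  elim₁ : ∀ j → Elim (1# - a * q ^ n) (1# - a * (q ^ j) ^ 4)
  elim₁ j = elim (- (q ^ j) ^ 4) (q ^ n) _ (solve 3 (λ a u v → let 1' = con 1ℤ in :- v :* (1' :- a :* u) :+ u :* (1' :- a :* v) := u :- v) refl a (q ^ n) ((q ^ j) ^ 4))
    (adeg-- (afree-q^ n) (af j)) (NZ-n-4 j)

  elim₂ : ∀ j → 1 ≤ j → Elim (1# - a * q ^ n) (a - (q ^ j) ^ 4)
  elim₂ j 1≤j = elim 1# (q ^ n) _ (solve 3 (λ a u v → let 1' = con 1ℤ in 1' :* (1' :- a :* u) :+ u :* (a :- v) := 1' :- u :* v) refl a (q ^ n) ((q ^ j) ^ 4))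
    (afree-1- (afree-* (afree-q^ n) (af j))) (NZ-n+4 j 1≤j)

  elim₃ : ∀ j → 1 ≤ j → Elim (a - q ^ n) (1# - a * (q ^ j) ^ 4)
  elim₃ j 1≤j = elim ((q ^ j) ^ 4) 1# _ (solve 3 (λ a u v → let 1' = con 1ℤ in v :* (a :- u) :+ 1' :* (1' :- a :* v) := 1' :- u :* v) refl a (q ^ n) ((q ^ j) ^ 4))
    (afree-1- (afree-* (afree-q^ n) (af j))) (NZ-n+4 j 1≤j)

  elim₄ : ∀ j → Elim (a - q ^ n) (a - (q ^ j) ^ 4)
  elim₄ j = elim (- 1#) 1# _ (solve 3 (λ a u v → let 1' = con 1ℤ in :- 1' :* (a :- u) :+ 1' :* (a :- v) := u :- v) refl a (q ^ n) ((q ^ j) ^ 4))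
    (adeg-- (afree-q^ n) (af j)) (NZ-n-4 j)

NZ-1-x^ : ∀ j k → NZ (1# - (q ^ suc j) ^ suc k)
NZ-1-x^ j k = NZ-resp (-cong refl (sym (^-assocʳ q (suc j) (suc k)))) (NZ-1-q^ (k ℕ.+ j ℕ.* suc k))

NZ-1-q : NZ (1# - q)
NZ-1-q = NZ-resp (-cong refl (*-identityʳ q)) (NZ-1-q^ 0)

elim-D : ∀ {f} M → (∀ j → 1 ≤ j → Elim f (1# - a * (q ^ j) ^ 4)) → (∀ j → 1 ≤ j → Elim f (a - (q ^ j) ^ 4)) → Elim f (D a M)
elim-D zero h g = elim-afree (afree-1- afree-q) NZ-1-q
elim-D (suc k) h g = elim-* (elim-D k h g) (elim-* (elim-* (elim-afree
    (afree-* (afree-1- (afree-^ 2 (afree-q^ (suc k)))) (afree-1- (afree-^ 4 (afree-q^ (suc k))))) (NZ-* (NZ-1-x^ k 1) (NZ-1-x^ k 3)))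
    (h (suc k) (s≤s z≤n))) (g (suc k) (s≤s z≤n)))

NZ-D : ∀ k → NZ (D a k)
NZ-D zero = NZ-1-q
NZ-D (suc k) = NZ-* (NZ-D k) (NZ-* (NZ-* (NZ-* (NZ-1-x^ k 1) (NZ-1-x^ k 3))
  (NZ-resp (-cong refl (*-congˡ (sym (x⁴-exponent (suc k))))) (NZ-1-aq^ (suc k ℕ.* 4))))
      (NZ-resp (-cong refl (sym (x⁴-exponent (suc k)))) (NZ-a-q^ (suc k ℕ.* 4))))

odd≢4* : ∀ M j → suc (M ℕ.+ M) ≢ j ℕ.* 4
odd≢4* M j e = even≢odd (j ℕ.* 2) M (≡.trans (lem j) (≡.sym e))
  where
  lem : ∀ k → k ℕ.* 2 ℕ.+ k ℕ.* 2 ≡ k ℕ.* 4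
  lem = NatSolver.solve-∀

-- The right-hand side is an abstract fraction n' / d' free of a, so that both residue classes of n
-- modulo 4 are served: the product formula and 0 / 1.
module Difference {Φ : Poly} (M : ℕ) (1≤M : 1 ≤ M) (G : CyclotomicLike (suc (M ℕ.+ M)) Φ)
  (n' d' : Poly) (afree-n' : AFree n') (afree-d' : AFree d')
  (exact : S (q ^ suc (M ℕ.+ M)) M * d' ≋ n' * D (q ^ suc (M ℕ.+ M)) M)
  (Φ∣n' : Φ ∣ n') (NZ-d' : NZ d') (Φ⊥d' : Φ ⊥ₚ d') where

  open Modulo M 1≤M G

  p modulus' : Poly
  p = S a M * d' - n' * D a M
  modulus' = Φ * (1# - a * q ^ n) * (a - q ^ n)

  exact-0 : S (q ^ n) M * d' - n' * D (q ^ n) M ≋ 0#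
  exact-0 = ≋⇒-≋0 exact

  -- Reversal modulo 1 - a q^n itself, with α = a and b = q^n: p is congruent to a^(2M) times its
  -- value at a = q^n, which is 0.
  1-aq^n∣p : 1# - a * q ^ n ∣ p
  1-aq^n∣p = mod-0 {y = x * (s * d' - n' * t)}
      (∣-resp (solve 7 (λ S D c e s t x → (S :- x :* s) :* e :- c :* (D :- x :* t) := (S :* e :- c :* D) :- x :* (s :* e :- c :* t)) refl
          (S a M) (D a M) n' d' s t x)
        (∣-- (∣-*ʳ d' (Reversal.S-rev ∣-refl M)) (∣-*ˡ n' (Reversal.D-rev ∣-refl M))))
      (∣-resp (sym (*-vanishʳ x exact-0)) ∣-0)
    where
    x = (a ^ 2) ^ M
    s = S (q ^ n) M
    t = D (q ^ n) M

  open Evaluation (q ^ n)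

  ev-p : ev (q ^ n) p ≋ 0#
  ev-p = trans (ev-- (q ^ n) _ _)
      (trans (-cong (ev-*-cong (ev-S M) (ev-afree (q ^ n) afree-d')) (ev-*-cong (ev-afree (q ^ n) afree-n') (ev-D M))) exact-0)

  -- At a = q^n the cofactor of 1 - a q^n is multiplied by 1 - q^(2n), which is nonzero; hence the
  -- cofactor vanishes there too.
  both∣p : (1# - a * q ^ n) * (a - q ^ n) ∣ p
  both∣p = combine 1-aq^n∣p
    where
    combine : 1# - a * q ^ n ∣ p → (1# - a * q ^ n) * (a - q ^ n) ∣ p
    combine (divides u e) = finish (root⇒∣ (afree-q^ n)
        (*-cancel-0 nz (trans (sym (ev-*-cong (ev-1-a (afree-q^ n)) refl)) (trans (ev-cong (q ^ n) e) ev-p))))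
      where
      nz : NZ (1# - q ^ n * q ^ n)
      nz = NZ-resp (-cong refl (^-homo-* q n n)) (NZ-1-q^ (M ℕ.+ M ℕ.+ n))
      finish : a - q ^ n ∣ u → (1# - a * q ^ n) * (a - q ^ n) ∣ p
      finish (divides v f) = divides v (trans (*-assoc _ (a - q ^ n) v) (trans (*-congˡ f) e))

  Φ-homogeneous : ADegree.Hom Φ
  Φ-homogeneous = supp-weaken ℕₚ.n≤0⇒n≡0 Φ-afree

  Φ-cancel₁ : ∀ {w} → Φ ∣ (1# - a * q ^ n) * w → Φ ∣ w
  Φ-cancel₁ = ADegree.∣-cancel-1-z Φ-homogeneous (supp-* {P = λ e → 1 ≤ proj₂ e} {Q = λ e → 0 ≤ proj₂ e} ℕₚ.+-mono-≤ (supp-a ℕₚ.≤-refl)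
      (supp-weaken (λ _ → z≤n) (afree-q^ n)))

  -- 1 - a q^n ≡ -q^n (a - q^n) modulo Φ because q^n ≡ 1, which reduces the claim to `Φ-cancel₁`.
  Φ-cancel₂ : ∀ {w} → Φ ∣ (a - q ^ n) * w → Φ ∣ w
  Φ-cancel₂ {w} h = Φ-cancel₁ (∣-resp (solve 3 (λ a x w → let 1' = con 1ℤ in (1' :- x) :* ((1' :+ x) :* w) :- x :* ((a :- x) :* w) := (1' :- a :* x) :* w) refl a (q ^ n) w)
    (∣-- (∣-*ʳ ((1# + q ^ n) * w) Φ∣1-q^n) (∣-*ˡ (q ^ n) h)))

  modulus∣p : modulus' ∣ p
  modulus∣p = combine both∣p
    where
    combine : (1# - a * q ^ n) * (a - q ^ n) ∣ p → modulus' ∣ p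
    combine (divides w e) = finish (Φ-cancel₂
        (Φ-cancel₁ (∣-resp (trans (sym e) (*-assoc _ (a - q ^ n) w)) (∣-- (∣-*ʳ d' Φ∣S) (∣-*ʳ (D a M) Φ∣n')))))
      where
      finish : Φ ∣ w → modulus' ∣ p
      finish (divides g f) = divides g
          (trans (solve 4 (λ Φ x y g → Φ :* x :* y :* g := x :* y :* (Φ :* g)) refl Φ (1# - a * q ^ n) (a - q ^ n) g) (trans (*-congˡ f) e))

  open Linear n (odd≢4* M)

  elim-modulus : Elim (D a M * d') modulus'
  elim-modulus = elim-* (elim-* (elim-afree Φ-afree (NZ-∣ (∣Q G) (NZ-Q {n} (s≤s z≤n))))
      (elim-sym (elim-* (elim-D M (λ j _ → elim₁ j) elim₂) (elim-afree afree-d' NZ-d'))))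
    (elim-sym (elim-* (elim-D M elim₃ (λ j _ → elim₄ j)) (elim-afree afree-d' NZ-d')))

  -- Being free of a, h divides the values of the modulus at a = 1 and a = 0. With x = q^n these are
  -- Φ (1 - x)² and -Φ x, and (1 - x)² + (2 - x) x = 1.
  afree-∣-modulus : ∀ {h} → AFree h → h ∣ modulus' → h ∣ Φ
  afree-∣-modulus {h} fh hm = ∣-resp (solve 2 (λ Φ x → let 1' = con 1ℤ in Φ :* (1' :- 1' :* x) :* (1' :- x) :- (con (ℤ.+ 2) :- x) :* (Φ :* (1' :- con 0ℤ :* x) :* (con 0ℤ :- x)) := Φ) refl Φ (q ^ n))
      (∣-- (at 1#) (∣-*ˡ _ (at 0#)))
    where
    at : ∀ r → h ∣ Φ * (1# - r * q ^ n) * (r - q ^ n)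
    at r = ev-∣ hm
      where
      module E = Evaluation r
      ev-∣ : h ∣ modulus' → h ∣ Φ * (1# - r * q ^ n) * (r - q ^ n)
      ev-∣ (divides g e) = divides (ev r g) (trans (sym (E.ev-*-cong (ev-afree r fh) refl)) (trans (ev-cong r e)
        (E.ev-*-cong (E.ev-*-cong (ev-afree r Φ-afree) (E.ev-1-a (afree-q^ n))) (E.ev-a- (afree-q^ n)))))

  -- At a = 0 the two factors involving a become 1 and a power of q up to sign, so nothing divisible
  -- by 1 - q^n can arise.
  Φ⊥D₀ : ∀ k → k ≤ M → Φ ⊥ₚ D 0# k
  Φ⊥D₀ zero _ = Φ⊥1-q
  Φ⊥D₀ (suc k) k<M = ⊥-* (Φ⊥D₀ k (ℕₚ.<⇒≤ k<M)) (⊥-* (⊥-* (⊥-* (Φ⊥1-x² k<M) (Φ⊥1-x⁴ k<M))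
    (⊥-resp (solve 1 (λ x → con 1ℤ := con 1ℤ :- con 0ℤ :* x) refl ((q ^ suc k) ^ 4)) ⊥-1))
    (⊥-resp (solve 1 (λ x → :- x := con 0ℤ :- x) refl ((q ^ suc k) ^ 4)) (⊥-neg (⊥-^ 4 (⊥-^ (suc k) Φ⊥q)))))

  -- A common divisor is free of a by `elim-modulus`, so it divides both Φ and the value of the
  -- denominator at a = 0. These are comaximal over ℚ, hence it divides a nonzero integer.
  coprime : ∀ {h} → h ∣ D a M * d' → h ∣ modulus' → IsConst h
  coprime {h} hv hm = const (⊥-* (Φ⊥D₀ M ℕₚ.≤-refl) Φ⊥d')
    where
    fh : AFree h
    fh = elim-∣ elim-modulus hv hm
    h∣D₀d' : h ∣ D a M * d' → h ∣ D 0# M * d'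
    h∣D₀d' (divides g e) = divides (ev 0# g)
        (trans (sym (E.ev-*-cong (ev-afree 0# fh) refl)) (trans (ev-cong 0# e) (E.ev-*-cong (E.ev-D M) (ev-afree 0# afree-d'))))
      where module E = Evaluation 0#
    const : Φ ⊥ₚ D 0# M * d' → IsConst h
    const (comax x y c≢0 e) = ∣-const (∣-resp e (∣-+ (∣-*ˡ x (afree-∣-modulus fh hm)) (∣-*ˡ y (h∣D₀d' hv)))) c≢0

-- The two sides of the congruence

≐-∏₁ : ∀ k {f : ℕ → Frac} {x : ℕ → Poly} → (∀ i → f i ≐ x i ∕ 1#) → prodF k f ≐ ∏ k x ∕ 1#
≐-∏₁ zero h = ≐-1
≐-∏₁ (suc k) h = ≐-*₁ (≐-∏₁ k h) (h k)

≐-poch : ∀ {X B x b} k → X ≐ x ∕ 1# → B ≐ b ∕ 1# → poch X B k ≐ ∏ k (λ j → 1# - x * b ^ j) ∕ 1#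
≐-poch k r s = ≐-∏₁ k (λ j → ≐--₁ ≐-1 (≐-*₁ r (≐-pow j s)))

-- Each factor brings a denominator a. The same power of a arises above and below in the summand and
-- cancels in `≐-summand`.
≐-poch-÷ : ∀ {X B x b} k → X ≐ x ∕ a → B ≐ b ∕ 1# → poch X B k ≐ ∏ k (λ j → a - x * b ^ j) ∕ ∏ k (λ _ → a)
≐-poch-÷ {x = x} {b} k r s = ≐-∏ k (λ j → ≐-resp
  (solve 2 (λ a y → con 1ℤ :* (a :* con 1ℤ) :- y :* con 1ℤ := a :- y) refl a (x * b ^ j))
  (solve 1 (λ a → con 1ℤ :* (a :* con 1ℤ) := a) refl a) (≐-- ≐-1 (≐-* r (≐-pow j s))))

≐-qint : ∀ m → qint m ≐ 1# - q ^ m ∕ (1# - q)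
≐-qint m = ≐-÷₁ (≐--₁ ≐-1 (≐-q^ m)) (≐--₁ ≐-1 ≐-q) NZ-1-q

^-swap : ∀ r j → (q ^ r) ^ j ≋ (q ^ j) ^ r
^-swap r j = trans (^-assocʳ q r j) (trans (reflexive (cong (q ^_) (ℕₚ.*-comm r j))) (sym (^-assocʳ q j r)))

-- The products of `W a` and `D a` grouped by Pochhammer symbol, as in `summand`, instead of by
-- step; the initial factor 1 - q of `D` is left out.
W-∏ D-∏ : ℕ → Poly
W-∏ k = ∏ k (λ j → 1# - q * (q ^ 4) ^ j) * ∏ k (λ j → 1# - q * (q ^ 2) ^ j) * ∏ k (λ j → 1# - a * q * (q ^ 2) ^ j) * ∏ k
    (λ j → a - q * (q ^ 2) ^ j)
D-∏ k = ∏ k (λ j → 1# - q ^ 2 * (q ^ 2) ^ j) * ∏ k (λ j → 1# - q ^ 4 * (q ^ 4) ^ j) * ∏ k (λ j → 1# - a * q ^ 4 * (q ^ 4) ^ j) * ∏ k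
    (λ j → a - q ^ 4 * (q ^ 4) ^ j)

interleave : ∀ x y z t x' y' z' t' → (x * x') * (y * y') * (z * z') * (t * t') ≋ (x * y * z * t) * (x' * y' * z' * t')
interleave = solve 8 (λ x y z t x' y' z' t' → (x :* x') :* (y :* y') :* (z :* z') :* (t :* t') := (x :* y :* z :* t) :*
    (x' :* y' :* z' :* t')) refl

W-∏≋W : ∀ k → W-∏ k ≋ W a k
W-∏≋W zero = solve 0 (con 1ℤ :* con 1ℤ :* con 1ℤ :* con 1ℤ := con 1ℤ) refl
W-∏≋W (suc k) = trans (interleave _ _ _ _ _ _ _ _) (*-cong (W-∏≋W k) (*-cong (*-cong (*-cong
  (-cong refl (*-congˡ (^-swap 4 k))) (-cong refl (*-congˡ (^-swap 2 k)))) (-cong refl (*-congˡ (^-swap 2 k))))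
      (-cong refl (*-congˡ (^-swap 2 k)))))

D-∏≋D : ∀ k → (1# - q) * D-∏ k ≋ D a k
D-∏≋D zero = solve 1 (λ q → (con 1ℤ :- q) :* (con 1ℤ :* con 1ℤ :* con 1ℤ :* con 1ℤ) := con 1ℤ :- q) refl q
D-∏≋D (suc k) = trans (*-congˡ (interleave _ _ _ _ _ _ _ _))
    (trans (sym (*-assoc (1# - q) (D-∏ k) _)) (*-cong (D-∏≋D k) (*-cong (*-cong (*-cong
    (-cong refl x²) (-cong refl x⁴)) (-cong refl (trans (*-assoc a (q ^ 4) _) (*-congˡ x⁴)))) (-cong refl x⁴))))
  where
  x² : q ^ 2 * (q ^ 2) ^ k ≋ (q ^ suc k) ^ 2
  x² = ^-swap 2 (suc k)
  x⁴ : q ^ 4 * (q ^ 4) ^ k ≋ (q ^ suc k) ^ 4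
  x⁴ = ^-swap 4 (suc k)

NZ-D-∏ : ∀ k → NZ (D-∏ k)
NZ-D-∏ k e = NZ-D k (trans (sym (D-∏≋D k)) (*-vanishʳ _ e))

≐-summand : ∀ k → summand k ≐ N a k ∕ D a k
≐-summand k = ≐-resp numerator (trans (*-identityʳ _) (D-∏≋D k)) (≐-* (≐-* (≐-qint (6 ℕ.* k ℕ.+ 1)) ratio) (≐-q^ (k ℕ.* k ℕ.+ k)))
  where
  a^k = ∏ k (λ _ → a)
  1*1*1* : 1# * 1# * 1# * a^k ≋ a^k
  1*1*1* = solve 1 (λ x → con 1ℤ :* con 1ℤ :* con 1ℤ :* x := x) refl a^k
  top : _ ≐ W-∏ k ∕ a^k
  top = ≐-resp refl 1*1*1* (≐-* (≐-* (≐-* (≐-poch k ≐-q (≐-q^ 4)) (≐-poch k ≐-q (≐-q^ 2))) (≐-poch k (≐-*₁ ≐-a ≐-q) (≐-q^ 2)))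
      (≐-poch-÷ k (≐-÷₁ ≐-q ≐-a NZ-a) (≐-q^ 2)))
  bottom : _ ≐ D-∏ k ∕ a^k
  bottom = ≐-resp refl 1*1*1* (≐-* (≐-* (≐-* (≐-poch k (≐-q^ 2) (≐-q^ 2)) (≐-poch k (≐-q^ 4) (≐-q^ 4)))
      (≐-poch k (≐-*₁ ≐-a (≐-q^ 4)) (≐-q^ 4))) (≐-poch-÷ k (≐-÷₁ (≐-q^ 4) ≐-a NZ-a) (≐-q^ 4)))
  ratio : _ ≐ W-∏ k ∕ D-∏ k
  ratio = ≐-cancel a^k (NZ-∏ k (λ _ → NZ-a)) (≐-resp (*-comm (W-∏ k) a^k) refl (≐-÷ top bottom (NZ-D-∏ k) (NZ-∏ k (λ _ → NZ-a))))
  power : q ^ (6 ℕ.* k ℕ.+ 1) ≋ q * (q ^ k) ^ 6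
  power = trans (reflexive (cong (q ^_) (≡.trans (ℕₚ.+-comm (6 ℕ.* k) 1) (cong suc (ℕₚ.*-comm 6 k))))) (*-congˡ (sym (^-assocʳ q k 6)))
  numerator : (1# - q ^ (6 ℕ.* k ℕ.+ 1)) * W-∏ k * q ^ (k ℕ.* k ℕ.+ k) ≋ N a k
  numerator = trans (*-congʳ (*-cong (-cong refl power) (W-∏≋W k))) (solve 3 (λ x y z → x :* y :* z := x :* z :* y) refl _ (W a k) _)

≐-sum : ∀ (f : ℕ → Frac) → (∀ k → f k ≐ N a k ∕ D a k) → ∀ k → sumF (suc k) f ≐ S a k ∕ D a k
≐-sum f h zero = ≐-resp (solve 2 (λ q d → con 0ℤ :* d :+ (con 1ℤ :- q :* con 1ℤ :^ 6) :* con 1ℤ :* con 1ℤ :* con 1ℤ := con 1ℤ :- q) refl q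
    (1# - q))
  (*-identityˡ _) (≐-+ {0F} {f 0} ≐-0 (h 0))
≐-sum f h (suc k) = ≐-cancel (D a k) (NZ-D k) (≐-resp
  (solve 4 (λ s d e n → s :* (d :* e) :+ n :* d := d :* (s :* e :+ n)) refl (S a k) (D a k) (d a (q ^ suc k)) (N a (suc k))) refl
  (≐-+ {sumF (suc k) f} {f (suc k)} (≐-sum f h k) (h (suc k))))

NZ-P₄ : ∀ m → NZ (P₄ m)
NZ-P₄ m = NZ-∏ m (λ j → NZ-resp (-cong refl (sym (q^4 4 j))) (NZ-1-q^ (3 ℕ.+ j ℕ.* 4)))

NZ-rhs-den : ∀ m → NZ (rhs-den m)
NZ-rhs-den m = NZ-* (NZ-* (NZ-P₄ m) (NZ-^ m NZ-q)) NZ-1-q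

afree-∏ : ∀ k {f : ℕ → Poly} → (∀ i → AFree (f i)) → AFree (∏ k f)
afree-∏ zero h = afree-κ 1ℤ
afree-∏ (suc k) h = afree-* (afree-∏ k h) (h k)

afree-rhs-num : ∀ m → AFree (rhs-num m)
afree-rhs-num m = afree-* (afree-∏ m (λ j → afree-1- (afree-* (afree-q^ 2) (afree-^ 4 (afree-q^ j)))))
    (afree-1- (afree-* (afree-q^ 1) (afree-^ 4 (afree-q^ m))))

afree-rhs-den : ∀ m → AFree (rhs-den m)
afree-rhs-den m = afree-* (afree-* (afree-∏ m (λ j → afree-1- (afree-* (afree-q^ 4) (afree-^ 4 (afree-q^ j))))) (afree-q^ m))
    (afree-1- afree-q)

≐-rhs : ∀ m n → n ≡ 1 ℕ.+ m ℕ.* 4 →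
  ((poch (powF qF 2) (powF qF 4) m ÷F poch (powF qF 4) (powF qF 4) m) *F qint n *F invF (powF qF m)) ≐ rhs-num m ∕ rhs-den m
≐-rhs m n ≡.refl = ≐-resp (trans (*-identityʳ _) (*-congˡ (-cong refl (sym (q^4 1 m)))))
    (solve 3 (λ x y z → x :* z :* y := x :* y :* z) refl (P₄ m) (q ^ m) (1# - q))
    (≐-* (≐-* (≐-÷₁ (≐-resp (∏-cong m (λ j → -cong refl (*-congˡ (^-swap 4 j)))) refl (≐-poch m (≐-q^ 2) (≐-q^ 4)))
      (≐-resp (∏-cong m (λ j → -cong refl (*-congˡ (^-swap 4 j)))) refl (≐-poch m (≐-q^ 4) (≐-q^ 4))) (NZ-P₄ m)) (≐-qint n))
      (≐-inv (≐-q^ m) (NZ-^ m NZ-q) NZ-1))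

-- Assembly of the congruence

mono≋ : ∀ i j → mono i j ≋ q ^ i * a ^ j
mono≋ i j = Equiv⇒≋ λ w → ≡.trans (≡.trans (ℤₚ.+-identityʳ _) (ℤₚ.*-identityˡ _)) (≡.sym (⟪q^a^⟫ i j w))

opaque
  unfolding κ

  modulus≡ : ∀ Φ n → modulus Φ n ≡ Φ * (1# - mono n 1) * (a - mono n 0)
  modulus≡ Φ n = ≡.refl

  ∣ₚ⇒∣ : ∀ {f g} → f ∣ₚ g → f ∣ g
  ∣ₚ⇒∣ (x , d) = divides x (mk d)

  ≐⇒≈F : ∀ {F P u v} → F ≐ P * u ∕ v → F ≈F frac (P *ₚ u) v
  ≐⇒≈F (rep c _) = un c

modulus≋ : ∀ Φ n → modulus Φ n ≋ Φ * (1# - a * q ^ n) * (a - q ^ n)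
modulus≋ Φ n = trans (reflexive (modulus≡ Φ n)) (*-cong
  (*-congˡ (-cong refl (trans (mono≋ n 1) (trans (*-congˡ (*-identityʳ a)) (*-comm (q ^ n) a)))))
  (-cong refl (trans (mono≋ n 0) (*-identityʳ (q ^ n)))))

congMod : ∀ {P u v} F G → (F -F G) ≐ P * u ∕ v → NZ v → (∀ {h} → h ∣ v → h ∣ P → IsConst h) → CongMod P F G
congMod {P} {u} {v} F G r nz cop = u , v , (λ z → nz (trans (mk z) 0ₚ≋0)) ,
    (λ h hv hP → cop (∣ₚ⇒∣ {h} {v} hv) (∣ₚ⇒∣ {h} {P} hP)) , ≐⇒≈F {F -F G} {P} {u} {v} r

congMod-0 : ∀ {P s t x y} F G → F ≐ s ∕ t → G ≐ x ∕ y → s * y - x * t ≋ 0# → NZ t → NZ y → CongMod P F G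
congMod-0 {P} {s} {t} {x} {y} F G rF rG z nt ny = congMod {P} {0#} F G
  (≐-cancel (t * y) (NZ-* nt ny) (≐-resp (trans z (solve 2 (λ v p → con 0ℤ := v :* (p :* con 0ℤ)) refl (t * y) P)) (sym (*-identityʳ _))
      (≐-- {F} {G} rF rG)))
  NZ-1 (λ h _ → ∣-const h (λ ()))

congruence : ∀ {Φ n x y} F G M → 1 ≤ M → n ≡ suc (M ℕ.+ M) → CyclotomicLike n Φ → F ≐ S a M ∕ D a M → G ≐ x ∕ y →
  AFree x → AFree y → S (q ^ n) M * y ≋ x * D (q ^ n) M → Φ ∣ x → NZ y → Φ ⊥ₚ y → CongMod (modulus Φ n) F G
congruence {Φ} {n} {x} {y} F G M 1≤M ≡.refl g rF rG fx fy ex Φ∣x ny Φ⊥y = build modulus∣p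
  where
  open Difference M 1≤M g x y fx fy ex Φ∣x ny Φ⊥y
  build : modulus' ∣ p → CongMod (modulus Φ n) F G
  build (divides u e) = congMod {modulus Φ n} {u} F G (≐-resp (sym (trans (*-congʳ (modulus≋ Φ n)) e)) refl (≐-- {F} {G} rF rG))
      (NZ-* (NZ-D M) ny)
    (λ hv hP → coprime hv (∣-resp (modulus≋ Φ n) hP))

congruence-1-mod-4 : ∀ {n Φ} F G m → n ≡ 1 ℕ.+ m ℕ.* 4 → CyclotomicLike n Φ →
  F ≐ S a (m ℕ.+ m) ∕ D a (m ℕ.+ m) → G ≐ rhs-num m ∕ rhs-den m → CongMod (modulus Φ n) F G
-- For n = 1 the denominators contain 1 - q, which is -Φ. The argument for 1 ≤ M breaks down, but
-- both sides are equal to 1.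
congruence-1-mod-4 {n} {Φ} F G zero _ _ rF rG = congMod-0 {modulus Φ n} F G rF rG
  (solve 1 (λ q → let 1' = con 1ℤ in (1' :- q) :* (1' :* 1' :* (1' :- q)) :- 1' :* (1' :- q :^ 1 :* 1' :^ 4) :* (1' :- q) := con 0ℤ) refl q) NZ-1-q (NZ-rhs-den 0)
congruence-1-mod-4 {n} {Φ} F G m@(suc _) n≡1+4m g rF rG = congruence {Φ} {n} F G M (s≤s z≤n) n≡ g rF rG (afree-rhs-num m) (afree-rhs-den m)
    (trans (*-congʳ (S-cong M α≋)) (trans (S-at-α₁ m M ℕₚ.≤-refl) (*-congˡ (D-cong M (sym α≋)))))
    (∣-*ˡ (P₂ m) (∣-resp (trans (solve 1 (λ x → :- (x :- con 1ℤ) := con 1ℤ :- x) refl (q ^ n)) (-cong refl α≋)) (∣-neg (∣Q g))))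
    (NZ-rhs-den m) (Modulo.Φ⊥rhs-den M (s≤s z≤n) (subst (λ k → CyclotomicLike k Φ) n≡ g) m (ℕₚ.m≤m+n m m))
  where
  M = m ℕ.+ m
  lem : ∀ m → 1 ℕ.+ m ℕ.* 4 ≡ suc (m ℕ.+ m ℕ.+ (m ℕ.+ m))
  lem = NatSolver.solve-∀
  n≡ : n ≡ suc (M ℕ.+ M)
  n≡ = ≡.trans n≡1+4m (lem m)
  α≋ : q ^ n ≋ α₁ m
  α≋ = trans (reflexive (cong (q ^_) n≡1+4m)) (sym (q^4 1 m))

congruence-3-mod-4 : ∀ {n Φ} F G m → n ≡ 3 ℕ.+ m ℕ.* 4 → CyclotomicLike n Φ →
  F ≐ S a (suc (m ℕ.+ m)) ∕ D a (suc (m ℕ.+ m)) → G ≐ 0# ∕ 1# → CongMod (modulus Φ n) F G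
congruence-3-mod-4 {n} {Φ} F G m n≡3+4m g rF rG = congruence {Φ} {n} F G M (s≤s z≤n) (≡.trans n≡3+4m (lem m)) g rF rG (afree-κ 0ℤ)
    (afree-κ 1ℤ)
    (trans (*-vanishˡ 1# (trans (S-cong M α≋) (S-at-α₃ m M ℕₚ.≤-refl))) (sym (zeroˡ _))) ∣-0 NZ-1 ⊥-1
  where
  M = suc (m ℕ.+ m)
  lem : ∀ m → 3 ℕ.+ m ℕ.* 4 ≡ suc (suc (m ℕ.+ m) ℕ.+ suc (m ℕ.+ m))
  lem = NatSolver.solve-∀
  α≋ : q ^ n ≋ α₃ m
  α≋ = trans (reflexive (cong (q ^_) n≡3+4m)) (sym (q^4 3 m))

≐-lhs : ∀ n {M} → (n ∸ 1) ℕ./ 2 ≡ M → lhs n ≐ S a M ∕ D a M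
≐-lhs n ≡.refl = ≐-sum summand ≐-summand ((n ∸ 1) ℕ./ 2)

≐-rhs-n : ∀ n {m} → (n ∸ 1) ℕ./ 4 ≡ m → n ≡ 1 ℕ.+ m ℕ.* 4 → rhs1 n ≐ rhs-num m ∕ rhs-den m
≐-rhs-n n ≡.refl eq = ≐-rhs ((n ∸ 1) ℕ./ 4) n eq

theorem2 : (n : ℕ) → n % 2 ≡ 1 → (Φ : Poly) → IsCyclotomic n Φ →
    (n % 4 ≡ 1 → CongMod (modulus Φ n) (lhs n) (rhs1 n))
    × (n % 4 ≡ 3 → CongMod (modulus Φ n) (lhs n) 0F)
theorem2 n _ Φ cyc =
    (λ e → case₁ (n ℕ./ 4) (divide 1 e)) , (λ e → case₃ (n ℕ./ 4) (divide 3 e))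
  where
  divide : ∀ r → n % 4 ≡ r → n ≡ r ℕ.+ n ℕ./ 4 ℕ.* 4
  divide r e = ≡.trans (DM.m≡m%n+[m/n]*n n 4) (cong (ℕ._+ n ℕ./ 4 ℕ.* 4) e)
  like : 1 ≤ n → CyclotomicLike n Φ
  like 1≤n = cyclotomic-cyclotomicLike n Φ 1≤n cyc
  case₁ : ∀ m → n ≡ 1 ℕ.+ m ℕ.* 4 → CongMod (modulus Φ n) (lhs n) (rhs1 n)
  case₁ m eq = congruence-1-mod-4 {n} {Φ} (lhs n) (rhs1 n) m eq (like (subst (1 ≤_) (≡.sym eq) (s≤s z≤n))) (≐-lhs n half)
      (≐-rhs-n n quarter eq)
    where
    quarter : (n ∸ 1) ℕ./ 4 ≡ m
    quarter = ≡.trans (cong (λ k → (k ∸ 1) ℕ./ 4) eq) (DM.m*n/n≡m m 4)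
    lem : ∀ m → m ℕ.* 4 ≡ (m ℕ.+ m) ℕ.* 2
    lem = NatSolver.solve-∀
    half : (n ∸ 1) ℕ./ 2 ≡ m ℕ.+ m
    half = ≡.trans (cong (λ k → (k ∸ 1) ℕ./ 2) eq) (≡.trans (cong (ℕ._/ 2) (lem m)) (DM.m*n/n≡m (m ℕ.+ m) 2))
  case₃ : ∀ m → n ≡ 3 ℕ.+ m ℕ.* 4 → CongMod (modulus Φ n) (lhs n) 0F
  case₃ m eq = congruence-3-mod-4 {n} {Φ} (lhs n) 0F m eq (like (subst (1 ≤_) (≡.sym eq) (s≤s z≤n))) (≐-lhs n half) ≐-0
    where
    lem : ∀ m → 2 ℕ.+ m ℕ.* 4 ≡ suc (m ℕ.+ m) ℕ.* 2
    lem = NatSolver.solve-∀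
    half : (n ∸ 1) ℕ./ 2 ≡ suc (m ℕ.+ m)
    half = ≡.trans (cong (λ k → (k ∸ 1) ℕ./ 2) eq) (≡.trans (cong (ℕ._/ 2) (lem m)) (DM.m*n/n≡m (suc (m ℕ.+ m)) 2))
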